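{- The twisted rational zeros of the Tribonacci sequence $T$ are exactly $0,-1,-4,-17,\frac13,-\frac53$.
   Context: The Tribonacci sequence is the map $T:\mathbb{Z}\to\mathbb{Q}$ with $T(0)=0$, $T(1)=T(2)=1$ and $T(n+3)=T(n+2)+T(n+1)+T(n)$ for all $n\in\mathbb{Z}$. With $\lambda_1,\lambda_2,\lambda_3$ the roots of $P(X)=X^3-X^2-X-1$ one has $T(n)=\alpha_1\lambda_1^n+\alpha_2\lambda_2^n+\alpha_3\lambda_3^n$ with $\alpha_i=\lambda_i/P'(\lambda_i)$. For $a=k/\ell\in\mathbb{Q}$ in lowest terms with $\ell>0$, a determination of $\lambda_i^a$ is $\mu^k$ with $\mu\in\overline{\mathbb{Q}}$, $\mu^\ell=\lambda_i$. A rational number $a$ is a twisted rational zero of $T$ if for some determinations of $\lambda_1^a,\lambda_2^a,\lambda_3^a$ and some roots of unity $\xi_1,\xi_2,\xi_3$ we have $\xi_1\alpha_1\lambda_1^a+\xi_2\alpha_2\lambda_2^a+\xi_3\alpha_3\lambda_3^a=0$. -}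

module Defs where

open import Level using (Level; _⊔_) renaming (suc to lsuc)
open import Algebra.Bundles using (CommutativeRing)
open import Data.Nat using (ℕ; zero; suc)
open import Data.Integer using (ℤ; +_; -[1+_])
open import Data.Rational using (ℚ; ↥_; ↧ₙ_)
open import Data.Vec using (Vec; []; _∷_)
open import Data.Product using (Σ; ∃; _×_; _,_)
open import Relation.Nullary using (¬_)

module _ {c ℓ : Level} (R : CommutativeRing c ℓ) where
  open CommutativeRing R

  pow : Carrier → ℕ → Carrier
  pow x zero    = 1#
  pow x (suc n) = x * pow x n

  natCast : ℕ → Carrier
  natCast zero    = 0#
  natCast (suc n) = 1# + natCast n

  evalPoly : ∀ {n} → Vec Carrier n → Carrier → Carrier
  evalPoly []       x = 0#
  evalPoly (a ∷ as) x = a + x * evalPoly as x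

  zpow : (Carrier → Carrier) → Carrier → ℤ → Carrier
  zpow inv x (+ n)     = pow x n
  zpow inv x -[1+ n ]  = pow (inv x) (suc n)

  P : Carrier → Carrier
  P x = pow x 3 - pow x 2 - x - 1#

  P′ : Carrier → Carrier
  P′ x = natCast 3 * pow x 2 - natCast 2 * x - 1#

  IsRootOfUnity : Carrier → Set ℓ
  IsRootOfUnity ξ = ∃ λ (m : ℕ) → pow ξ (suc m) ≈ 1#

  record IsACF0 (inv : Carrier → Carrier) : Set (c ⊔ ℓ) where
    field
      0≉1       : ¬ (0# ≈ 1#)
      inv-cong  : ∀ {x y} → x ≈ y → inv x ≈ inv y
      inverseʳ  : ∀ x → ¬ (x ≈ 0#) → x * inv x ≈ 1#
      char0     : ∀ n → ¬ (natCast (suc n) ≈ 0#)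
      algClosed : ∀ n (cs : Vec Carrier n) →
                  ∃ λ x → pow x (suc n) + evalPoly cs x ≈ 0#

  AreTribRoots : Carrier → Carrier → Carrier → Set ℓ
  AreTribRoots l₁ l₂ l₃ =
    (P l₁ ≈ 0#) × (P l₂ ≈ 0#) × (P l₃ ≈ 0#) ×
    ¬ (l₁ ≈ l₂) × ¬ (l₁ ≈ l₃) × ¬ (l₂ ≈ l₃)

  coeffα : (Carrier → Carrier) → Carrier → Carrier
  coeffα inv l = l * inv (P′ l)

  -- a = k/ℓ (lowest terms, ℓ > 0) is a twisted rational zero: there are
  -- determinations μᵢᵏ of λᵢᵃ (μᵢ^ℓ = λᵢ) and roots of unity ξᵢ with
  -- ξ₁α₁λ₁ᵃ + ξ₂α₂λ₂ᵃ + ξ₃α₃λ₃ᵃ = 0.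
  IsTwistedRationalZero : (Carrier → Carrier) →
    Carrier → Carrier → Carrier → ℚ → Set (c ⊔ ℓ)
  IsTwistedRationalZero inv l₁ l₂ l₃ a =
    Σ Carrier λ μ₁ → Σ Carrier λ μ₂ → Σ Carrier λ μ₃ →
    Σ Carrier λ ξ₁ → Σ Carrier λ ξ₂ → Σ Carrier λ ξ₃ →
      (pow μ₁ (↧ₙ a) ≈ l₁) × (pow μ₂ (↧ₙ a) ≈ l₂) × (pow μ₃ (↧ₙ a) ≈ l₃) ×
      IsRootOfUnity ξ₁ × IsRootOfUnity ξ₂ × IsRootOfUnity ξ₃ ×
      (ξ₁ * coeffα inv l₁ * zpow inv μ₁ (↥ a)
        + ξ₂ * coeffα inv l₂ * zpow inv μ₂ (↥ a)
        + ξ₃ * coeffα inv l₃ * zpow inv μ₃ (↥ a) ≈ 0#)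

{-# OPTIONS --safe #-}
-- Write a = k/ℓ, K = k + ℓ and yᵢ = ξᵢ λᵢ μᵢᵏ.  The equation says that the
-- points (λᵢ , yᵢ) are collinear, yᵢ = A + B λᵢ, while yᵢ^ℓ equals λᵢᴷ up to a
-- root of unity.  Since 8 = Σ (λᵢ - λⱼ)², the slope B is integral away from 2,
-- so y₂/y₃ = 1 modulo t = λ₂ - λ₃.  The units congruent to 1 modulo t have no
-- torsion, because t is ramified of index 2 < 10 above 11, and the roots of
-- unity disappear: y₂^ℓ λ₃ᴷ = y₃^ℓ λ₂ᴷ.  For the same reason the line is
-- determined by a, whence A : B is rational.  A Bézout relation between ℓ and K
-- then gives a unit υ of ℚ(λ) with υ^ℓ = λ³, and the growth of the traces of its
-- powers, equal to 7 and 5 at ℓ and -ℓ, forces ℓ = 1 or ℓ = 3.  For ℓ = 1 the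
-- coefficient of X² in Xᴷ modulo X³ - X² - X - 1 vanishes; for ℓ = 3, as
-- (1 + X)³ = 2X⁴, that of (1 + X)Xʲ with K = 4 + 3j.  Skolem's method with
-- p = 83, where X has order 287, finds all such K and j.
module Submission where

open import Defs
open import Level using (Level; _⊔_)
open import Algebra.Bundles using (CommutativeRing)
open import Data.Nat as ℕ using (ℕ; zero; suc; s≤s; z≤n)
import Data.Nat.Properties as ℕP
import Data.Nat.Divisibility as ℕD
import Data.Nat.GCD as ℕG
import Data.Nat.Solver
open import Data.Nat.Coprimality as Cop using (Coprime)
open import Data.Nat.Induction using (<-rec)
open import Data.Nat.Primality using (Prime; prime?; euclidsLemma; prime⇒irreducible; ¬prime[0])
open import Data.Integer as ℤ using (ℤ; +_; -[1+_]; _⊖_)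
import Data.Integer.Properties as ℤP
import Data.Integer.DivMod as ℤD
import Data.Integer.Divisibility.Signed as ℤS
import Data.Integer.GCD as ℤG
import Data.Integer.Solver
open import Data.Rational as ℚ using (ℚ; mkℚ; _/_; ↥_; ↧_; ↧ₙ_)
import Data.Rational.Properties as ℚP
open import Data.Sign as Sign using (Sign)
open import Data.Fin using (Fin; toℕ; fromℕ<)
import Data.Fin.Properties as FP
open import Data.Empty using (⊥; ⊥-elim)
open import Data.Maybe using (Maybe; just; nothing)
open import Data.Product using (Σ; ∃; _×_; _,_; proj₁; proj₂)
open import Data.Sum using (_⊎_; inj₁; inj₂)
open import Data.List using (List; []; _∷_; _++_; map)
open import Data.List.Membership.Propositional using (_∈_)
import Data.List.Membership.DecPropositional
open import Data.List.Relation.Unary.All as All using (All; []; _∷_)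
open import Data.List.Relation.Unary.Any using (here; there)
open import Data.Vec as Vec using (Vec; []; _∷_; _∷ʳ_)
open import Function.Bundles using (_⇔_; mk⇔)
open import Function.Strict using (force; force-≡)
open import Relation.Binary using (tri<; tri≈; tri>)
open import Relation.Binary.PropositionalEquality as ≡ using (_≡_)
import Relation.Binary.Reasoning.Setoid
open import Relation.Nullary using (¬_; Dec; yes; no)
open import Relation.Nullary.Decidable
  using (toWitness; decidable-stable; from-yes; from-no; _→-dec_; _×-dec_; ¬?)
import Algebra.Properties.Ring
import Algebra.Properties.CommutativeSemiring.Exp
import Algebra.Properties.Semiring.Exp
import Algebra.Properties.Semiring.Mult.TCOptimised
import Algebra.Solver.Ring
import Algebra.Solver.Ring.AlmostCommutativeRing as ACR

-- The proof uses neither Galois groups nor valuations, and equality in R is undecidable.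
-- Integrality therefore means stabilising a finitely generated module over ℤ[λ₁] or ℤ[1/2][λ₁]. The
-- one theorem needed, that an integral inverse of D makes D a unit of the base ring, is Gaussian
-- elimination modulo D. Rationality of A : B comes from uniqueness instead of conjugation: A/B is
-- the only common root of two integer polynomials, and in characteristic 0 such a root is rational.
-- Case distinctions on equality take place in the ring with doubly negated equality; membership in
-- the list of six rationals is decidable, so the double negation disappears at the end. The prime
-- 11 enters because P has discriminant -44: once 2 is inverted, no other prime ramifies, and t² has
-- a cofactor δ with t²δ = 22. The numbers 7 and 5 are the traces of λ³ and λ⁻³. The cube is there
-- because, for φ with φ^ℓ = Cλ, dividing φ³ by the norm of φ cancels the unknown constant C. For ℓ
-- = 3 the prime 83 leaves two spurious residues; these are removed modulo 29, where X¹⁴⁰ = 1.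

private
  module ℤR = Data.Integer.Solver.+-*-Solver

-- Integer coefficients, integral powers and linear certificates in commutative rings.

module RingKit {c ℓ : Level} (R : CommutativeRing c ℓ) where
  open CommutativeRing R public
  open Algebra.Properties.Semiring.Exp semiring public
    using (_^_; ^-congˡ; ^-congʳ; ^-homo-*; ^-assocʳ)
  open Algebra.Properties.CommutativeSemiring.Exp commutativeSemiring public
    using (^-distrib-*)
  open Algebra.Properties.Ring ring public
    using (-‿distribˡ-*; -‿distribʳ-*; -‿involutive; -0#≈0#)
  private
    module M = Algebra.Properties.Semiring.Mult.TCOptimised semiring
    module AP = ACR.AlmostCommutativeRing (ACR.fromCommutativeRing R)
  open Relation.Binary.Reasoning.Setoid setoid public

  -- With the optimised multiple, `1 × x` is `x` by definition, so `ι (+ 1)` is `1#` and the solver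
  -- morphism preserves 0 and 1 by `refl`. Solver constants then match the `0#` and `1#` of the
  -- goals.
  ι : ℤ → Carrier
  ι (+ n)    = n M.× 1#
  ι -[1+ n ] = - (suc n M.× 1#)

  private
    ×-suc : ∀ n → suc n M.× 1# ≈ 1# + n M.× 1#
    ×-suc n = M.1+× n 1#

    cancel-1 : ∀ a b → a - b ≈ (1# + a) - (1# + b)
    cancel-1 a b = sym (begin
      (1# + a) - (1# + b)         ≈⟨ +-congˡ (sym (AP.-‿+-comm 1# b)) ⟩
      (1# + a) + (- 1# + - b)     ≈⟨ +-congʳ (+-comm 1# a) ⟩
      (a + 1#) + (- 1# + - b)     ≈⟨ +-assoc a 1# _ ⟩
      a + (1# + (- 1# + - b))     ≈⟨ +-congˡ (sym (+-assoc 1# (- 1#) (- b))) ⟩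
      a + ((1# - 1#) + - b)       ≈⟨ +-congˡ (trans (+-congʳ (-‿inverseʳ 1#)) (+-identityˡ _)) ⟩
      a - b                       ∎)

  ι-⊖ : ∀ m n → ι (m ⊖ n) ≈ ι (+ m) - ι (+ n)
  ι-⊖ m zero = sym (trans (+-congˡ -0#≈0#) (+-identityʳ _))
  ι-⊖ zero (suc n) = sym (+-identityˡ _)
  ι-⊖ (suc m) (suc n) = begin
    ι (suc m ⊖ suc n)                       ≡⟨ ≡.cong ι (ℤP.[1+m]⊖[1+n]≡m⊖n m n) ⟩
    ι (m ⊖ n)                               ≈⟨ ι-⊖ m n ⟩
    ι (+ m) - ι (+ n)                       ≈⟨ cancel-1 _ _ ⟩
    (1# + ι (+ m)) - (1# + ι (+ n))         ≈⟨ +-cong (sym (×-suc m)) (-‿cong (sym (×-suc n))) ⟩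
    ι (+ suc m) - ι (+ suc n)               ∎

  ι-neg : ∀ i → ι (ℤ.- i) ≈ - ι i
  ι-neg (+ zero)    = sym -0#≈0#
  ι-neg (+ suc n)   = refl
  ι-neg -[1+ n ]    = sym (-‿involutive _)

  ι-+ : ∀ i j → ι (i ℤ.+ j) ≈ ι i + ι j
  ι-+ (+ m)    (+ n)    = M.×-homo-+ 1# m n
  ι-+ (+ m)    -[1+ n ] = ι-⊖ m (suc n)
  ι-+ -[1+ m ] (+ n)    = trans (ι-⊖ n (suc m)) (+-comm _ _)
  ι-+ -[1+ m ] -[1+ n ] = begin
    - (suc (suc (m ℕ.+ n)) M.× 1#)          ≡⟨ ≡.cong (λ z → - (z M.× 1#)) (≡.sym (ℕP.+-suc (suc m) n)) ⟩
    - ((suc m ℕ.+ suc n) M.× 1#)            ≈⟨ -‿cong (M.×-homo-+ 1# (suc m) (suc n)) ⟩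
    - (suc m M.× 1# + suc n M.× 1#)         ≈⟨ sym (AP.-‿+-comm _ _) ⟩
    - (suc m M.× 1#) + - (suc n M.× 1#)     ∎

  private
    ι-+◃ : ∀ n → ι (Sign.+ ℤ.◃ n) ≈ n M.× 1#
    ι-+◃ n = reflexive (≡.cong ι (ℤP.+◃n≡+n n))
    ι--◃ : ∀ n → ι (Sign.- ℤ.◃ n) ≈ - (n M.× 1#)
    ι--◃ n = trans (reflexive (≡.cong ι (ℤP.-◃n≡-n n))) (ι-neg (+ n))

  ι-* : ∀ i j → ι (i ℤ.* j) ≈ ι i * ι j
  ι-* (+ m)    (+ n)    = trans (ι-+◃ (m ℕ.* n)) (M.×1-homo-* m n)
  ι-* (+ m)    -[1+ n ] = trans (ι--◃ (m ℕ.* suc n))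
    (trans (-‿cong (M.×1-homo-* m (suc n))) (-‿distribʳ-* _ _))
  ι-* -[1+ m ] (+ n)    = trans (ι--◃ (suc m ℕ.* n))
    (trans (-‿cong (M.×1-homo-* (suc m) n)) (-‿distribˡ-* _ _))
  ι-* -[1+ m ] -[1+ n ] = trans (ι-+◃ (suc m ℕ.* suc n))
    (trans (M.×1-homo-* (suc m) (suc n))
    (trans (sym (-‿involutive _))
    (trans (-‿cong (-‿distribˡ-* _ _)) (-‿distribʳ-* _ _))))

  ι-cong : ∀ {i j} → i ≡ j → ι i ≈ ι j
  ι-cong ≡.refl = refl

  morphism : ℤ.+-*-rawRing ACR.-Raw-AlmostCommutative⟶ ACR.fromCommutativeRing R
  morphism = record
    { ⟦_⟧ = ι ; +-homo = ι-+ ; *-homo = ι-* ; -‿homo = ι-neg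
    ; 0-homo = refl ; 1-homo = refl }

  private
    ι-≟ : ∀ i j → Maybe (ι i ≈ ι j)
    ι-≟ i j with i ℤ.≟ j
    ... | yes eq = just (ι-cong eq)
    ... | no _   = nothing

  open Algebra.Solver.Ring ℤ.+-*-rawRing (ACR.fromCommutativeRing R) morphism ι-≟ public
    using (Polynomial; solve; _:=_; _:+_; _:*_; _:-_; :-_; con; var; _:^_)

  ι-^ : ∀ i n → ι (i ℤ.^ n) ≈ ι i ^ n
  ι-^ i zero    = refl
  ι-^ i (suc n) = trans (ι-* i (i ℤ.^ n)) (*-congˡ (ι-^ i n))

  infixl 6 _⊕_ _⊝_
  infixl 7 _⊗_

  infix 4 _~_
  -- A wrapper is needed because `ι` computes and unification cannot invert it: from the record
  -- type, `i` and `x` can be inferred. A term built from `⌜_⌝`, `⊕`, `⊗`, `⊝` pushes `ι` through a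
  -- whole integer polynomial at once.
  record _~_ (i : ℤ) (x : Carrier) : Set ℓ where
    constructor hom
    field ι≈ : ι i ≈ x
  open _~_ public

  ⌜_⌝ : ∀ i → i ~ ι i
  ⌜ i ⌝ = hom refl

  _⊕_ : ∀ {i j x y} → i ~ x → j ~ y → (i ℤ.+ j) ~ (x + y)
  _⊕_ {i} {j} (hom p) (hom q) = hom (trans (ι-+ i j) (+-cong p q))

  _⊗_ : ∀ {i j x y} → i ~ x → j ~ y → (i ℤ.* j) ~ (x * y)
  _⊗_ {i} {j} (hom p) (hom q) = hom (trans (ι-* i j) (*-cong p q))

  _⊝_ : ∀ {i j x y} → i ~ x → j ~ y → (i ℤ.- j) ~ (x - y)
  _⊝_ {i} {j} (hom p) (hom q) = hom (trans (ι-+ i (ℤ.- j)) (+-cong p (trans (ι-neg j) (-‿cong q))))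

  x-y≈0⇒x≈y : ∀ {x y} → x - y ≈ 0# → x ≈ y
  x-y≈0⇒x≈y {x} {y} e = begin
    x            ≈⟨ solve 2 (λ x y → x := (x :- y) :+ y) refl x y ⟩
    (x - y) + y  ≈⟨ +-congʳ e ⟩
    0# + y       ≈⟨ +-identityˡ y ⟩
    y            ∎

  x≈y⇒x-y≈0 : ∀ {x y} → x ≈ y → x - y ≈ 0#
  x≈y⇒x-y≈0 {x} {y} e = trans (+-congʳ e) (-‿inverseʳ y)

  1^n≈1 : ∀ n → 1# ^ n ≈ 1#
  1^n≈1 zero    = refl
  1^n≈1 (suc n) = trans (*-identityˡ _) (1^n≈1 n)

  ^-comm-exp : ∀ x m n → (x ^ m) ^ n ≈ (x ^ n) ^ m
  ^-comm-exp x m n = trans (^-assocʳ x m n)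
    (trans (^-congʳ x (ℕP.*-comm m n)) (sym (^-assocʳ x n m)))

  -- x′ plays the role of the inverse of x.
  zp : Carrier → Carrier → ℤ → Carrier
  zp x x′ (+ n)    = x ^ n
  zp x x′ -[1+ n ] = x′ ^ suc n

  zp-cong : ∀ {x x′ y y′} → x ≈ y → x′ ≈ y′ → ∀ k → zp x x′ k ≈ zp y y′ k
  zp-cong p q (+ n)    = ^-congˡ n p
  zp-cong p q -[1+ n ] = ^-congˡ (suc n) q

  zp-distrib : ∀ x x′ y y′ k → zp (x * y) (x′ * y′) k ≈ zp x x′ k * zp y y′ k
  zp-distrib x x′ y y′ (+ n)    = ^-distrib-* x y n
  zp-distrib x x′ y y′ -[1+ n ] = ^-distrib-* x′ y′ (suc n)

  zp-^ : ∀ x x′ n k → zp (x ^ n) (x′ ^ n) k ≈ zp x x′ k ^ n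
  zp-^ x x′ n (+ m)    = ^-comm-exp x n m
  zp-^ x x′ n -[1+ m ] = ^-comm-exp x′ n (suc m)

  module _ {x x′ : Carrier} (inverse : x * x′ ≈ 1#) where

    zp-⊖ : ∀ m n → zp x x′ (m ⊖ n) ≈ x ^ m * x′ ^ n
    zp-⊖ m       zero    = sym (*-identityʳ _)
    zp-⊖ zero    (suc n) = sym (*-identityˡ _)
    zp-⊖ (suc m) (suc n) = begin
      zp x x′ (suc m ⊖ suc n)           ≡⟨ ≡.cong (zp x x′) (ℤP.[1+m]⊖[1+n]≡m⊖n m n) ⟩
      zp x x′ (m ⊖ n)                   ≈⟨ zp-⊖ m n ⟩
      x ^ m * x′ ^ n                    ≈⟨ sym (*-identityˡ _) ⟩
      1# * (x ^ m * x′ ^ n)             ≈⟨ *-congʳ (sym inverse) ⟩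
      (x * x′) * (x ^ m * x′ ^ n)       ≈⟨ solve 4 (λ a b c d → (a :* b) :* (c :* d) := (a :* c) :* (b :* d))
                                             refl x x′ (x ^ m) (x′ ^ n) ⟩
      (x * x ^ m) * (x′ * x′ ^ n)       ∎

    zp-+ : ∀ i j → zp x x′ (i ℤ.+ j) ≈ zp x x′ i * zp x x′ j
    zp-+ (+ m)    (+ n)    = ^-homo-* x m n
    zp-+ (+ m)    -[1+ n ] = zp-⊖ m (suc n)
    zp-+ -[1+ m ] (+ n)    = trans (zp-⊖ n (suc m)) (*-comm _ _)
    zp-+ -[1+ m ] -[1+ n ] = trans
      (^-congʳ x′ (≡.sym (ℕP.+-suc (suc m) n))) (^-homo-* x′ (suc m) (suc n))

    zp-inverse : ∀ k → zp x x′ k * zp x′ x k ≈ 1#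
    zp-inverse (+ n)    = trans (sym (^-distrib-* x x′ n)) (trans (^-congˡ n inverse) (1^n≈1 n))
    zp-inverse -[1+ n ] = trans (sym (^-distrib-* x′ x (suc n)))
      (trans (^-congˡ (suc n) (trans (*-comm x′ x) inverse)) (1^n≈1 (suc n)))

    zp-*ℕ : ∀ i n → zp x x′ (i ℤ.* + n) ≈ zp x x′ i ^ n
    zp-*ℕ i zero    = reflexive (≡.cong (zp x x′) (ℤP.*-zeroʳ i))
    zp-*ℕ i (suc n) = begin
      zp x x′ (i ℤ.* + suc n)            ≡⟨ ≡.cong (zp x x′) (ℤP.*-suc i (+ n)) ⟩
      zp x x′ (i ℤ.+ i ℤ.* + n)          ≈⟨ zp-+ i (i ℤ.* + n) ⟩
      zp x x′ i * zp x x′ (i ℤ.* + n)    ≈⟨ *-congˡ (zp-*ℕ i n) ⟩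
      zp x x′ i * zp x x′ i ^ n          ∎

  zp-neg : ∀ x x′ k → zp x x′ (ℤ.- k) ≈ zp x′ x k
  zp-neg x x′ (+ zero)  = refl
  zp-neg x x′ (+ suc n) = refl
  zp-neg x x′ -[1+ n ]  = refl

  -- Certificates: an equation follows from others once the difference of its sides is an explicit
  -- combination of their differences, and the solver checks that combination. Most of the algebra
  -- modulo P and Vieta's relations has this form.
  lc₁ : ∀ {x y u v} k → u ≈ v → x - y ≈ k * (u - v) → x ≈ y
  lc₁ k p e = x-y≈0⇒x≈y (trans e (trans (*-congˡ (x≈y⇒x-y≈0 p)) (zeroʳ k)))

  lc₂ : ∀ {x y u v u′ v′} k k′ → u ≈ v → u′ ≈ v′ →
        x - y ≈ k * (u - v) + k′ * (u′ - v′) → x ≈ y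
  lc₂ k k′ p p′ e = x-y≈0⇒x≈y (trans e (trans
    (+-cong (trans (*-congˡ (x≈y⇒x-y≈0 p)) (zeroʳ k)) (trans (*-congˡ (x≈y⇒x-y≈0 p′)) (zeroʳ k′)))
    (+-identityˡ 0#)))

  lc₃ : ∀ {x y u v u′ v′ u″ v″} k k′ k″ → u ≈ v → u′ ≈ v′ → u″ ≈ v″ →
        x - y ≈ k * (u - v) + k′ * (u′ - v′) + k″ * (u″ - v″) → x ≈ y
  lc₃ k k′ k″ p p′ p″ e = x-y≈0⇒x≈y (trans e (trans
    (+-cong (trans (+-cong (trans (*-congˡ (x≈y⇒x-y≈0 p)) (zeroʳ k)) (trans (*-congˡ (x≈y⇒x-y≈0 p′)) (zeroʳ k′)))
    (+-identityˡ 0#)) (trans (*-congˡ (x≈y⇒x-y≈0 p″)) (zeroʳ k″))) (+-identityˡ 0#)))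

  record IsSubring {p : Level} (B : Carrier → Set p) : Set (c ⊔ ℓ ⊔ p) where
    field
      B-resp : ∀ {x y} → x ≈ y → B x → B y
      B-+    : ∀ {x y} → B x → B y → B (x + y)
      B-*    : ∀ {x y} → B x → B y → B (x * y)
      B-neg  : ∀ {x} → B x → B (- x)
      B-0    : B 0#
      B-1    : B 1#

    B-minus : ∀ {x y} → B x → B y → B (x - y)
    B-minus Bx By = B-+ Bx (B-neg By)

    B-^ : ∀ {x} n → B x → B (x ^ n)
    B-^ zero    Bx = B-1
    B-^ (suc n) Bx = B-* Bx (B-^ n Bx)

    B-ι : ∀ i → B (ι i)
    B-ι (+ zero)      = B-0
    B-ι (+ suc n)     = B-resp (sym (ι-+ (+ 1) (+ n))) (B-+ B-1 (B-ι (+ n)))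
    B-ι -[1+ zero ]   = B-neg B-1
    B-ι -[1+ suc n ]  = B-resp (sym (ι-+ -[1+ 0 ] -[1+ n ])) (B-+ (B-neg B-1) (B-ι -[1+ n ]))

    private
      -- The binomial coefficient m(m - 1)/2. It stays explicit because its divisibility by 83 for m
      -- = 83 drives the descent in Skolem's method.
      triangle : ℕ → ℕ
      triangle zero    = 0
      triangle (suc m) = triangle m ℕ.+ m

    record Expansion (x : Carrier) (m : ℕ) : Set (c ⊔ ℓ ⊔ p) where
      constructor expansion
      field
        rest   : Carrier
        rest∈B : B rest
        expand : (1# + x) ^ m ≈ 1# + ι (+ m) * x + ι (+ triangle m) * (x * x) + x * x * x * rest

    binomial : ∀ {x} → B x → ∀ m → Expansion x m
    binomial {x} Bx zero = expansion 0# B-0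
      (solve 1 (λ x → con (+ 1) := con (+ 1) :+ con (+ 0) :* x :+ con (+ 0) :* (x :* x) :+ x :* x :* x :* con (+ 0)) refl x)
    binomial {x} Bx (suc m) = expansion (b + T + x * b) (B-+ (B-+ Bb (B-ι (+ triangle m))) (B-* Bx Bb)) (begin
      (1# + x) * (1# + x) ^ m
        ≈⟨ *-congˡ e ⟩
      (1# + x) * (1# + n * x + T * (x * x) + x * x * x * b)
        ≈⟨ solve 4 (λ x n T b → (con (+ 1) :+ x) :* (con (+ 1) :+ n :* x :+ T :* (x :* x) :+ x :* x :* x :* b) :=
             con (+ 1) :+ (con (+ 1) :+ n) :* x :+ (T :+ n) :* (x :* x) :+ x :* x :* x :* (b :+ T :+ x :* b))
             refl x n T b ⟩
      1# + (1# + n) * x + (T + n) * (x * x) + x * x * x * (b + T + x * b)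
        ≈⟨ +-congʳ (+-cong (+-congˡ (*-congʳ (sym (ι-+ (+ 1) (+ m))))) (*-congʳ (sym (ι-+ (+ triangle m) (+ m))))) ⟩
      1# + ι (+ suc m) * x + ι (+ triangle (suc m)) * (x * x) + x * x * x * (b + T + x * b) ∎)
      where
      open Expansion (binomial Bx m) renaming (rest to b; rest∈B to Bb; expand to e)
      n = ι (+ m)
      T = ι (+ triangle m)

    binomial₂ : ∀ {x} → B x → ∀ m → ∃ λ b → B b × (1# + x) ^ m ≈ 1# + ι (+ m) * x + x * x * b
    binomial₂ {x} Bx m =
      ι (+ triangle m) + x * rest , B-+ (B-ι (+ triangle m)) (B-* Bx rest∈B) ,
      trans expand (solve 4 (λ x n T b → con (+ 1) :+ n :* x :+ T :* (x :* x) :+ x :* x :* x :* b :=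
        con (+ 1) :+ n :* x :+ x :* x :* (T :+ x :* b)) refl x (ι (+ m)) (ι (+ triangle m)) rest)
      where open Expansion (binomial Bx m)

    binomial₁ : ∀ {x} → B x → ∀ m → ∃ λ b → B b × (1# + x) ^ m ≈ 1# + x * b
    binomial₁ {x} Bx m =
      let (b , Bb , e) = binomial₂ Bx m
      in ι (+ m) + x * b , B-+ (B-ι (+ m)) (B-* Bx Bb) ,
         trans e (solve 3 (λ x n b → con (+ 1) :+ n :* x :+ x :* x :* b := con (+ 1) :+ x :* (n :+ x :* b))
           refl x (ι (+ m)) b)

-- The norm form of ℤ[X]/(X³ - X² - X - 1) has no nontrivial zero.

module NormForm where
  open import Data.Integer hiding (suc; _≟_)

  open Data.Integer.Solver.+-*-Solver
    using (solve; _:=_; _:+_; _:*_; _:-_; con; Polynomial)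

  -- The norm of a + bX + cX² in ℤ[X]/(X³ - X² - X - 1).
  N : ℤ → ℤ → ℤ → ℤ
  N a b c = a * (a * a + a * b + + 3 * a * c - b * b - + 4 * b * c - c * c)
            + b * (b * b + b * c - c * c) + c * (c * c)

  private
    :N : ∀ {n} → Polynomial n → Polynomial n → Polynomial n → Polynomial n
    :N a b c = a :* (a :* a :+ a :* b :+ con (+ 3) :* a :* c :- b :* b :- con (+ 4) :* b :* c :- c :* c)
            :+ b :* (b :* b :+ b :* c :- c :* c) :+ c :* (c :* c)

  -- Changing one argument at a time keeps the factorisations small. Together the three steps let a,
  -- b, c be replaced by their residues without affecting divisibility of the norm by 3.
  N-stepᵃ : ∀ a a′ b c → N a b c - N a′ b c ≡ (a - a′) *
    (a * a + a * a′ + a′ * a′ + (a + a′) * (b + + 3 * c) - b * b - + 4 * b * c - c * c)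
  N-stepᵃ = solve 4 (λ a a′ b c → :N a b c :- :N a′ b c := (a :- a′) :* (a :* a :+ a :* a′ :+ a′ :* a′ :+ (a :+ a′) :* (b :+ con (+ 3) :* c) :- b :* b :- con (+ 4) :* b :* c :- c :* c)) ≡.refl

  N-stepᵇ : ∀ a b b′ c → N a b c - N a b′ c ≡ (b - b′) *
    (a * (a - b - b′ - + 4 * c) + b * b + b * b′ + b′ * b′ + (b + b′) * c - c * c)
  N-stepᵇ = solve 4 (λ a b b′ c → :N a b c :- :N a b′ c := (b :- b′) :* (a :* (a :- b :- b′ :- con (+ 4) :* c) :+ b :* b :+ b :* b′ :+ b′ :* b′ :+ (b :+ b′) :* c :- c :* c)) ≡.refl

  N-stepᶜ : ∀ a b c c′ → N a b c - N a b c′ ≡ (c - c′) *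
    (a * (+ 3 * a - + 4 * b - c - c′) + b * (b - c - c′) + c * c + c * c′ + c′ * c′)
  N-stepᶜ = solve 4 (λ a b c c′ → :N a b c :- :N a b c′ := (c :- c′) :* (a :* (con (+ 3) :* a :- con (+ 4) :* b :- c :- c′) :+ b :* (b :- c :- c′) :+ c :* c :+ c :* c′ :+ c′ :* c′)) ≡.refl

  N-scale : ∀ a b c → N (a * + 3) (b * + 3) (c * + 3) ≡ N a b c * + 27
  N-scale = solve 3 (λ a b c → :N (a :* con (+ 3)) (b :* con (+ 3)) (c :* con (+ 3)) := :N a b c :* con (+ 27)) ≡.refl

  private
    -- A check of 27 cases. It succeeds because P has no root modulo 3, so that 𝔽₃[X]/(P) is a
    -- field, where only 0 has norm 0.
    3∣⇒ : ∀ (x y z : Fin 3) → (+ 3 ℤS.∣ N (+ toℕ x) (+ toℕ y) (+ toℕ z)) →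
          toℕ x ≡ 0 × toℕ y ≡ 0 × toℕ z ≡ 0
    3∣⇒ = toWitness {a? = FP.all? λ x → FP.all? λ y → FP.all? λ z →
      (+ 3 ℤS.∣? N (+ toℕ x) (+ toℕ y) (+ toℕ z)) →-dec
      ((toℕ x ℕ.≟ 0) ×-dec ((toℕ y ℕ.≟ 0) ×-dec (toℕ z ℕ.≟ 0)))} _

    residue : ∀ a → ∃ λ (x : Fin 3) → ∃ λ q → a ≡ + toℕ x + q * + 3
    residue a = fromℕ< (ℤD.n%ℕd<d a 3) , a /ℕ 3 ,
      ≡.trans (ℤD.a≡a%ℕn+[a/ℕn]*n a 3)
        (≡.cong (λ n → + n + a /ℕ 3 * + 3) (≡.sym (FP.toℕ-fromℕ< (ℤD.n%ℕd<d a 3))))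

    drop : ∀ {x y : ℤ} q w → x ≡ y + q * + 3 → ∀ {u v} → u - v ≡ (x - y) * w →
           + 3 ℤS.∣ u → + 3 ℤS.∣ v
    drop {x} {y} q w e {u} {v} d 3∣u = ≡.subst (+ 3 ℤS.∣_) back
      (ℤS.∣m∣n⇒∣m-n 3∣u (ℤS.divides (q * w) (begin
        (x - y) * w             ≡⟨ ≡.cong (λ z → (z - y) * w) e ⟩
        (y + q * + 3 - y) * w   ≡⟨ lem y q w ⟩
        q * w * + 3             ∎)))
      where
      open ≡.≡-Reasoning
      lem : ∀ y q w → (y + q * + 3 - y) * w ≡ q * w * + 3
      lem = solve 3 (λ y q w → (y :+ q :* con (+ 3) :- y) :* w := q :* w :* con (+ 3)) ≡.refl
      lem₂ : ∀ u v → u - (u - v) ≡ v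
      lem₂ = solve 2 (λ u v → u :- (u :- v) := v) ≡.refl
      back : u - (x - y) * w ≡ v
      back = ≡.trans (≡.cong (λ z → u - z) (≡.sym d)) (lem₂ u v)

    third : ∀ {a x} q → a ≡ + x + q * + 3 → x ≡ 0 → a ≡ q * + 3
    third q e ≡.refl = ≡.trans e (ℤP.+-identityˡ _)

  N-3∣ : ∀ a b c → N a b c ≡ + 0 →
         ∃ λ a′ → ∃ λ b′ → ∃ λ c′ → a ≡ a′ * + 3 × b ≡ b′ * + 3 × c ≡ c′ * + 3
  N-3∣ a b c N≡0 with residue a | residue b | residue c
  ... | x , p , ea | y , q , eb | z , r , ec =
    let d = drop r _ ec (N-stepᶜ (+ toℕ x) (+ toℕ y) c (+ toℕ z))
             (drop q _ eb (N-stepᵇ (+ toℕ x) b (+ toℕ y) c)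
             (drop p _ ea (N-stepᵃ a (+ toℕ x) b c)
             (ℤS.divides (+ 0) N≡0)))
        (x0 , y0 , z0) = 3∣⇒ x y z d
    in p , q , r , third p ea x0 , third q eb y0 , third r ec z0

  private
    size : ℤ → ℤ → ℤ → ℕ
    size a b c = ∣ a ∣ ℕ.+ ∣ b ∣ ℕ.+ ∣ c ∣

    shrink : ∀ m n → m ℕ.* 3 ℕ.≤ suc n → m ℕ.≤ n
    shrink zero    n _        = z≤n
    shrink (suc m) n (s≤s le) = ℕP.≤-trans (s≤s (ℕP.≤-trans (ℕP.m≤m*n m 3) (ℕP.n≤1+n _))) le

    -- Infinite descent by powers of 3, modulo which P is irreducible.
    descent : ∀ n a b c → size a b c ℕ.≤ n → N a b c ≡ + 0 → a ≡ + 0 × b ≡ + 0 × c ≡ + 0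
    descent zero a b c le _ =
      ℤP.∣i∣≡0⇒i≡0 (ℕP.m+n≡0⇒m≡0 ∣ a ∣ s₁) , ℤP.∣i∣≡0⇒i≡0 (ℕP.m+n≡0⇒n≡0 ∣ a ∣ s₁) ,
      ℤP.∣i∣≡0⇒i≡0 (ℕP.m+n≡0⇒n≡0 (∣ a ∣ ℕ.+ ∣ b ∣) s₀)
      where
      s₀ : size a b c ≡ 0
      s₀ = ℕP.n≤0⇒n≡0 le
      s₁ : ∣ a ∣ ℕ.+ ∣ b ∣ ≡ 0
      s₁ = ℕP.m+n≡0⇒m≡0 (∣ a ∣ ℕ.+ ∣ b ∣) s₀
    descent (suc n) a b c le N≡0 =
      let (a′ , b′ , c′ , ea , eb , ec) = N-3∣ a b c N≡0
          (p , q , r) = descent n a′ b′ c′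
            (shrink (size a′ b′ c′) n (ℕP.≤-trans (ℕP.≤-reflexive (size*3 a′ b′ c′ ea eb ec)) le))
            (N/27 a′ b′ c′ ea eb ec N≡0)
      in times3 ea p , times3 eb q , times3 ec r
      where
      times3 : ∀ {x x′} → x ≡ x′ * + 3 → x′ ≡ + 0 → x ≡ + 0
      times3 e z = ≡.trans e (≡.cong (_* + 3) z)
      abs*3 : ∀ {x} x′ → x ≡ x′ * + 3 → ∣ x′ ∣ ℕ.* 3 ≡ ∣ x ∣
      abs*3 x′ e = ≡.trans (≡.sym (ℤP.abs-* x′ (+ 3))) (≡.cong ∣_∣ (≡.sym e))
      size*3 : ∀ {a b c} a′ b′ c′ → a ≡ a′ * + 3 → b ≡ b′ * + 3 → c ≡ c′ * + 3 →
               size a′ b′ c′ ℕ.* 3 ≡ size a b c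
      size*3 a′ b′ c′ ea eb ec = ≡.trans (ℕP.*-distribʳ-+ 3 (∣ a′ ∣ ℕ.+ ∣ b′ ∣) ∣ c′ ∣)
        (≡.cong₂ ℕ._+_ (≡.trans (ℕP.*-distribʳ-+ 3 ∣ a′ ∣ ∣ b′ ∣)
          (≡.cong₂ ℕ._+_ (abs*3 a′ ea) (abs*3 b′ eb))) (abs*3 c′ ec))
      N/27 : ∀ {a b c} a′ b′ c′ → a ≡ a′ * + 3 → b ≡ b′ * + 3 → c ≡ c′ * + 3 →
             N a b c ≡ + 0 → N a′ b′ c′ ≡ + 0
      N/27 {a} {b} {c} a′ b′ c′ ea eb ec z = ℤP.*-cancelʳ-≡ (N a′ b′ c′) (+ 0) (+ 27)
        (≡.trans (≡.sym (N-scale a′ b′ c′)) (≡.trans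
          (≡.sym (≡.trans (≡.cong₂ (λ a b → N a b c) ea eb)
            (≡.cong (N (a′ * + 3) (b′ * + 3)) ec))) z))

  N≡0⇒ : ∀ a b c → N a b c ≡ + 0 → a ≡ + 0 × b ≡ + 0 × c ≡ + 0
  N≡0⇒ a b c = descent (size a b c) a b c ℕP.≤-refl

-- Bézout relations and the prime 11.

prime-11 : Prime 11
prime-11 = from-yes (prime? 11)

prime-∤⇒coprime : ∀ {p m} → Prime p → ¬ (p ℕD.∣ m) → Coprime m p
prime-∤⇒coprime {p} pr p∤m (d∣m , d∣p) with prime⇒irreducible pr d∣p
... | inj₁ d≡1    = d≡1
... | inj₂ ≡.refl = ⊥-elim (p∤m d∣m)

bézout : ∀ {m n} → Coprime m n → ∃ λ u → ∃ λ v → u ℤ.* + m ℤ.+ v ℤ.* + n ≡ + 1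
bézout {m} {n} c with Cop.coprime-Bézout c
... | ℕG.Bézout.+- x y e = + x , ℤ.- + y , from+- x m y n e
  where
  open ≡.≡-Reasoning
  from+- : ∀ x m y n → 1 ℕ.+ y ℕ.* n ≡ x ℕ.* m → + x ℤ.* + m ℤ.+ ℤ.- + y ℤ.* + n ≡ + 1
  from+- x m y n e = begin
    + x ℤ.* + m ℤ.+ ℤ.- + y ℤ.* + n      ≡⟨ ≡.cong₂ ℤ._+_ (≡.sym (ℤP.pos-* x m)) (≡.sym (ℤP.neg-distribˡ-* (+ y) (+ n))) ⟩
    + (x ℕ.* m) ℤ.- + y ℤ.* + n          ≡⟨ ≡.cong₂ (λ a b → + a ℤ.- b) (≡.sym e) (≡.sym (ℤP.pos-* y n)) ⟩
    (+ 1 ℤ.+ + (y ℕ.* n)) ℤ.- + (y ℕ.* n) ≡⟨ ℤP.+-assoc (+ 1) (+ (y ℕ.* n)) (ℤ.- + (y ℕ.* n)) ⟩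
    + 1 ℤ.+ (+ (y ℕ.* n) ℤ.- + (y ℕ.* n)) ≡⟨ ≡.cong (λ z → + 1 ℤ.+ z) (ℤP.+-inverseʳ (+ (y ℕ.* n))) ⟩
    + 1                                  ∎
... | ℕG.Bézout.-+ x y e = ℤ.- + x , + y , from-+ x m y n e
  where
  open ≡.≡-Reasoning
  from-+ : ∀ x m y n → 1 ℕ.+ x ℕ.* m ≡ y ℕ.* n → ℤ.- + x ℤ.* + m ℤ.+ + y ℤ.* + n ≡ + 1
  from-+ x m y n e = begin
    ℤ.- + x ℤ.* + m ℤ.+ + y ℤ.* + n      ≡⟨ ≡.cong₂ ℤ._+_ (≡.sym (ℤP.neg-distribˡ-* (+ x) (+ m))) (≡.sym (ℤP.pos-* y n)) ⟩
    ℤ.- (+ x ℤ.* + m) ℤ.+ + (y ℕ.* n)    ≡⟨ ≡.cong₂ (λ a b → ℤ.- a ℤ.+ + b) (≡.sym (ℤP.pos-* x m)) (≡.sym e) ⟩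
    ℤ.- + (x ℕ.* m) ℤ.+ (+ 1 ℤ.+ + (x ℕ.* m)) ≡⟨ ℤP.+-comm (ℤ.- + (x ℕ.* m)) _ ⟩
    (+ 1 ℤ.+ + (x ℕ.* m)) ℤ.- + (x ℕ.* m) ≡⟨ ℤP.+-assoc (+ 1) (+ (x ℕ.* m)) (ℤ.- + (x ℕ.* m)) ⟩
    + 1 ℤ.+ (+ (x ℕ.* m) ℤ.- + (x ℕ.* m)) ≡⟨ ≡.cong (λ z → + 1 ℤ.+ z) (ℤP.+-inverseʳ (+ (x ℕ.* m))) ⟩
    + 1                                  ∎

11∤2^ : ∀ k → ¬ 11 ℕD.∣ 2 ℕ.^ k
11∤2^ zero    d = from-no (11 ℕD.∣? 1) d
11∤2^ (suc k) d with euclidsLemma 2 (2 ℕ.^ k) prime-11 d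
... | inj₁ d′ = from-no (11 ℕD.∣? 2) d′
... | inj₂ d′ = 11∤2^ k d′

pos-^ : ∀ m n → + (m ℕ.^ n) ≡ (+ m) ℤ.^ n
pos-^ m zero    = ≡.refl
pos-^ m (suc n) = ≡.trans (ℤP.pos-* m (m ℕ.^ n)) (≡.cong (+ m ℤ.*_) (pos-^ m n))

-- The hypotheses are the coordinates of 2ᵏ(1 + D g) = 0, where 2ᵏ g = a + bλ + cλ² and D = 5 + 2λ -
-- 3λ². The combination with coefficients 1, -2, -7 eliminates b and c and leaves 2ᵏ + 22a = 0.
11-power-equation : ∀ k a b c →
  + (2 ℕ.^ k) ℤ.+ + 5 ℤ.* a ℤ.- + 3 ℤ.* b ℤ.- c ≡ + 0 →
  + 2 ℤ.* a ℤ.+ + 2 ℤ.* b ℤ.- + 4 ℤ.* c ≡ + 0 →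
  c ℤ.- + 3 ℤ.* a ℤ.- b ≡ + 0 → ⊥
11-power-equation k a b c p q r = 11∤2^ k (ℕD.divides ℤ.∣ + 2 ℤ.* a ∣ (≡.trans
  (≡.cong ℤ.∣_∣ 2^k≡) (≡.trans (ℤP.∣-i∣≡∣i∣ (+ 2 ℤ.* a ℤ.* + 11)) (ℤP.abs-* (+ 2 ℤ.* a) (+ 11)))))
  where
  open RingKit ℤP.+-*-commutativeRing
  2^k≡ : + (2 ℕ.^ k) ≡ ℤ.- (+ 2 ℤ.* a ℤ.* + 11)
  2^k≡ = lc₃ (+ 1) (ℤ.- + 2) (ℤ.- + 7) p q r
    (solve 4 (λ K a b c → K :- (:- (con (+ 2) :* a :* con (+ 11))) :=
      con (+ 1) :* (K :+ con (+ 5) :* a :- con (+ 3) :* b :- c :- con (+ 0)) :+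
      (:- con (+ 2)) :* (con (+ 2) :* a :+ con (+ 2) :* b :- con (+ 4) :* c :- con (+ 0)) :+
      (:- con (+ 7)) :* (c :- con (+ 3) :* a :- b :- con (+ 0))) ≡.refl (+ (2 ℕ.^ k)) a b c)

-- Growth of the power sums of x³ - ux² + vx - 1.

module PowerSums where
  open Data.Integer.Solver.+-*-Solver
    using (solve; _:=_; _:+_; _:*_; _:-_; :-_; con)
  private
    module ℕS = Data.Nat.Solver.+-*-Solver

  -- Power sums of the roots of x³ - u x² + v x - 1.
  psum : ℤ → ℤ → ℕ → ℤ
  psum u v 0 = + 3
  psum u v 1 = u
  psum u v 2 = u ℤ.* u ℤ.- + 2 ℤ.* v
  psum u v (suc (suc (suc n))) =
    u ℤ.* psum u v (suc (suc n)) ℤ.- v ℤ.* psum u v (suc n) ℤ.+ psum u v n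

  private
    ≢-by-≤ : ∀ {m n i} → i ≡ + m → n ℕ.< m → ¬ i ≡ + n
    ≢-by-≤ ≡.refl n<m e = ℕP.<-irrefl (≡.sym (ℤP.+-injective e)) n<m

  -- Here u = 1 + p and v = -W, so the recurrence has only nonnegative coefficients and the power
  -- sums are natural numbers.
  module Positive (p W : ℕ) where
    U = suc p

    g : ℕ → ℕ
    g 0 = 3
    g 1 = U
    g 2 = U ℕ.* U ℕ.+ 2 ℕ.* W
    g (suc (suc (suc n))) = U ℕ.* g (suc (suc n)) ℕ.+ W ℕ.* g (suc n) ℕ.+ g n

    psum≡ : ∀ n → psum (+ U) (ℤ.- + W) n ≡ + g n
    psum≡ 0 = ≡.refl
    psum≡ 1 = ≡.refl
    psum≡ 2 = ≡.sym (≡.trans (ℤP.pos-+ (U ℕ.* U) (2 ℕ.* W))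
      (≡.trans (≡.cong₂ ℤ._+_ (ℤP.pos-* U U) (ℤP.pos-* 2 W))
      (solve 2 (λ u w → u :* u :+ con (+ 2) :* w := u :* u :- con (+ 2) :* (:- w)) ≡.refl (+ U) (+ W))))
    psum≡ (suc (suc (suc n))) = ≡.trans
      (≡.cong₂ ℤ._+_ (≡.cong₂ (λ x y → + U ℤ.* x ℤ.- (ℤ.- + W) ℤ.* y) (psum≡ (suc (suc n))) (psum≡ (suc n))) (psum≡ n))
      (step (g (suc (suc n))) (g (suc n)) (g n))
      where
      step : ∀ a b c → + U ℤ.* + a ℤ.- (ℤ.- + W) ℤ.* + b ℤ.+ + c ≡ + (U ℕ.* a ℕ.+ W ℕ.* b ℕ.+ c)
      step a b c = ≡.sym (≡.trans (ℤP.pos-+ (U ℕ.* a ℕ.+ W ℕ.* b) c)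
        (≡.cong (ℤ._+ + c) (≡.trans (ℤP.pos-+ (U ℕ.* a) (W ℕ.* b))
        (≡.trans (≡.cong₂ ℤ._+_ (ℤP.pos-* U a) (ℤP.pos-* W b))
        (solve 4 (λ u a w b → u :* a :+ w :* b := u :* a :- (:- w) :* b) ≡.refl (+ U) (+ a) (+ W) (+ b))))))

    increasing : ∀ n → g (suc (suc n)) ℕ.≤ g (suc (suc (suc n)))
    increasing n = ℕP.≤-trans (ℕP.m≤n*m (g (suc (suc n))) U)
      (ℕP.≤-trans (ℕP.m≤m+n _ (W ℕ.* g (suc n))) (ℕP.m≤m+n _ (g n)))

    above : ∀ {b} m → b ℕ.≤ g (suc (suc m)) → ∀ n → b ℕ.≤ g (n ℕ.+ suc (suc m))
    above m le zero    = le
    above m le (suc n) = ℕP.≤-trans (above m le n)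
      (≡.subst (λ k → g k ℕ.≤ g (suc k)) (≡.sym (≡.trans (ℕP.+-suc n (suc m)) (≡.cong suc (ℕP.+-suc n m))))
        (increasing (n ℕ.+ m)))

    above-psum : ∀ {b} m → b ℕ.< g (suc (suc m)) → ∀ n → ¬ psum (+ U) (ℤ.- + W) (n ℕ.+ suc (suc m)) ≡ + b
    above-psum m lt n = ≢-by-≤ (psum≡ (n ℕ.+ suc (suc m))) (above m lt n)

  -- From index 2 on the sums do not decrease, so a value of at least 11 at index 4 bounds all later
  -- ones. The excluded pair u = 1, v = 0 only has the value 5 there and is treated by `1,0` and
  -- `0,1`.
  positive-large : ∀ p W b → b ℕ.≤ 10 → ¬ (p ≡ 0 × W ≡ 0) → ∀ n → ¬ psum (+ suc p) (ℤ.- + W) (n ℕ.+ 4) ≡ + b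
  positive-large p W b b≤10 ne = Positive.above-psum p W 2 (ℕP.≤-trans (s≤s b≤10) (11≤ p W ne))
    where
    11≤ : ∀ p W → ¬ (p ≡ 0 × W ≡ 0) → 11 ℕ.≤ Positive.g p W 4
    11≤ zero    zero    ne = ⊥-elim (ne (≡.refl , ≡.refl))
    11≤ zero    (suc w) _  = ℕP.m+n≤o⇒m≤o 11 (ℕP.≤-reflexive (≡.sym (ℕS.solve 1 (λ w →
      let W = ℕS.con 1 ℕS.:+ w
          a = ℕS.con 1 ℕS.:+ ℕS.con 2 ℕS.:* W
          b = ℕS.con 1 ℕS.:* a ℕS.:+ W ℕS.:* ℕS.con 1 ℕS.:+ ℕS.con 3 in
      ℕS.con 1 ℕS.:* b ℕS.:+ W ℕS.:* a ℕS.:+ ℕS.con 1 ℕS.:=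
      ℕS.con 11 ℕS.:+ (ℕS.con 3 ℕS.:* w ℕS.:+ w ℕS.:* (ℕS.con 5 ℕS.:+ ℕS.con 2 ℕS.:* w))) ≡.refl w)))
    11≤ (suc p) W       _  = ℕP.≤-trans (ℕP.m+n≤o⇒m≤o 11 (ℕP.≤-reflexive (≡.sym (ℕS.solve 2 (λ p W →
      let U = ℕS.con 2 ℕS.:+ p
          a = U ℕS.:* U ℕS.:+ ℕS.con 2 ℕS.:* W in
      U ℕS.:* a ℕS.:+ W ℕS.:* U ℕS.:+ ℕS.con 3 ℕS.:=
      ℕS.con 11 ℕS.:+ (ℕS.con 2 ℕS.:* (ℕS.con 4 ℕS.:* p ℕS.:+ p ℕS.:* p ℕS.:+ ℕS.con 2 ℕS.:* W) ℕS.:+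
         p ℕS.:* (U ℕS.:* U ℕS.:+ ℕS.con 2 ℕS.:* W) ℕS.:+ W ℕS.:* U)) ≡.refl p W))))
      (Positive.increasing (suc p) W 1)

  -- u = v + 1 + k, v = 1 + q; d n is the increment from n+1 to n+2.
  module Dominant (q k : ℕ) where
    s = q ℕ.+ k
    u = suc (suc s)

    record State : Set where
      constructor state
      field x y d : ℕ

    next : State → State
    -- u(y + d) - vy + x exceeds y + d by (u - 1)d + (u - 1 - v)y + x, and u - 1 - v = k: written
    -- this way, no subtraction remains.
    next (state x y d) = state y (y ℕ.+ d) (suc s ℕ.* d ℕ.+ k ℕ.* y ℕ.+ x)

    at : ℕ → State
    at zero    = state 3 u (q ℕ.* q ℕ.+ q ℕ.+ 2 ℕ.* suc q ℕ.* k ℕ.+ k ℕ.* k ℕ.+ k)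
    at (suc n) = next (at n)

    Matches : ℕ → State → Set
    Matches n (state x y d) =
      psum (+ u) (+ suc q) n ≡ + x × psum (+ u) (+ suc q) (suc n) ≡ + y ×
      psum (+ u) (+ suc q) (suc (suc n)) ≡ + (y ℕ.+ d)

    private
      +u≡ : + u ≡ + 2 ℤ.+ (+ q ℤ.+ + k)
      +u≡ = ≡.cong (λ z → + 2 ℤ.+ z) (ℤP.pos-+ q k)

      step : ∀ x y d → + u ℤ.* + (y ℕ.+ d) ℤ.- + suc q ℤ.* + y ℤ.+ + x ≡
                       + (y ℕ.+ d ℕ.+ (suc s ℕ.* d ℕ.+ k ℕ.* y ℕ.+ x))
      step x y d = begin
        + u ℤ.* + (y ℕ.+ d) ℤ.- + suc q ℤ.* + y ℤ.+ + x
          ≡⟨ ≡.cong₂ (λ a b → a ℤ.* b ℤ.- + suc q ℤ.* + y ℤ.+ + x) +u≡ (ℤP.pos-+ y d) ⟩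
        (+ 2 ℤ.+ (+ q ℤ.+ + k)) ℤ.* (+ y ℤ.+ + d) ℤ.- (+ 1 ℤ.+ + q) ℤ.* + y ℤ.+ + x
          ≡⟨ solve 5 (λ q k x y d →
               (con (+ 2) :+ (q :+ k)) :* (y :+ d) :- (con (+ 1) :+ q) :* y :+ x :=
               y :+ d :+ ((con (+ 1) :+ (q :+ k)) :* d :+ k :* y :+ x)) ≡.refl (+ q) (+ k) (+ x) (+ y) (+ d) ⟩
        + y ℤ.+ + d ℤ.+ ((+ 1 ℤ.+ (+ q ℤ.+ + k)) ℤ.* + d ℤ.+ + k ℤ.* + y ℤ.+ + x)
          ≡⟨ ≡.sym (≡.cong₂ ℤ._+_ (ℤP.pos-+ y d) (≡.cong (ℤ._+ + x)
               (≡.cong₂ ℤ._+_ (≡.trans (ℤP.pos-* (suc s) d) (≡.cong (λ z → (+ 1 ℤ.+ z) ℤ.* + d) (ℤP.pos-+ q k))) (ℤP.pos-* k y)))) ⟩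
        + (y ℕ.+ d ℕ.+ (suc s ℕ.* d ℕ.+ k ℕ.* y ℕ.+ x)) ∎
        where open ≡.≡-Reasoning

      start : + u ℤ.* + u ℤ.- + 2 ℤ.* + suc q ≡ + (u ℕ.+ State.d (at 0))
      start = begin
        + u ℤ.* + u ℤ.- + 2 ℤ.* + suc q
          ≡⟨ ≡.cong (λ a → a ℤ.* a ℤ.- + 2 ℤ.* + suc q) +u≡ ⟩
        (+ 2 ℤ.+ (+ q ℤ.+ + k)) ℤ.* (+ 2 ℤ.+ (+ q ℤ.+ + k)) ℤ.- + 2 ℤ.* (+ 1 ℤ.+ + q)
          ≡⟨ solve 2 (λ q k → (con (+ 2) :+ (q :+ k)) :* (con (+ 2) :+ (q :+ k)) :- con (+ 2) :* (con (+ 1) :+ q) :=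
               con (+ 2) :+ (q :+ k) :+ (q :* q :+ q :+ con (+ 2) :* (con (+ 1) :+ q) :* k :+ k :* k :+ k)) ≡.refl (+ q) (+ k) ⟩
        + 2 ℤ.+ (+ q ℤ.+ + k) ℤ.+ (+ q ℤ.* + q ℤ.+ + q ℤ.+ + 2 ℤ.* (+ 1 ℤ.+ + q) ℤ.* + k ℤ.+ + k ℤ.* + k ℤ.+ + k)
          ≡⟨ ≡.cong₂ ℤ._+_ (≡.sym +u≡) (≡.cong (ℤ._+ + k) (≡.cong₂ ℤ._+_
               (≡.cong₂ (λ a b → a ℤ.+ + q ℤ.+ b) (≡.sym (ℤP.pos-* q q))
                 (≡.sym (≡.trans (ℤP.pos-* (2 ℕ.* suc q) k) (≡.cong (ℤ._* + k) (ℤP.pos-* 2 (suc q))))))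
               (≡.sym (ℤP.pos-* k k)))) ⟩
        + (u ℕ.+ State.d (at 0)) ∎
        where open ≡.≡-Reasoning

    matches : ∀ n → Matches n (at n)
    matches zero    = ≡.refl , ≡.refl , start
    matches (suc n) =
      let (p , q , r) = matches n in q , r , forward (State.x (at n)) (State.y (at n)) (State.d (at n)) p q r
      where
      forward : ∀ x y d → psum (+ u) (+ suc q) n ≡ + x → psum (+ u) (+ suc q) (suc n) ≡ + y →
        psum (+ u) (+ suc q) (suc (suc n)) ≡ + (y ℕ.+ d) →
        psum (+ u) (+ suc q) (suc (suc (suc n))) ≡ + (y ℕ.+ d ℕ.+ (suc s ℕ.* d ℕ.+ k ℕ.* y ℕ.+ x))
      forward x y d p₁ p₂ p₃ = ≡.trans
        (≡.cong₂ ℤ._+_ (≡.cong₂ (λ a b → + u ℤ.* a ℤ.- + suc q ℤ.* b) p₃ p₂) p₁) (step x y d)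

    large : ∀ n → 10 ℕ.≤ State.y (at (n ℕ.+ 3))
    large zero = ℕP.m+n≤o⇒m≤o 10 (ℕP.≤-reflexive (≡.sym
      (ℕS.solve 3 (λ s k d →
        let U = ℕS.con 2 ℕS.:+ s
            e = ℕS.con 1 ℕS.:+ s
            d₁ = e ℕS.:* d ℕS.:+ k ℕS.:* U ℕS.:+ ℕS.con 3 in
        U ℕS.:+ d ℕS.:+ d₁ ℕS.:+ (e ℕS.:* d₁ ℕS.:+ k ℕS.:* (U ℕS.:+ d) ℕS.:+ U) ℕS.:=
        ℕS.con 10 ℕS.:+ (s ℕS.:+ d ℕS.:+ (e ℕS.:* d ℕS.:+ k ℕS.:* U) ℕS.:+
          (e ℕS.:* (e ℕS.:* d ℕS.:+ k ℕS.:* U) ℕS.:+ ℕS.con 3 ℕS.:* s) ℕS.:+ k ℕS.:* (U ℕS.:+ d) ℕS.:+ s))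
        ≡.refl s k (State.d (at 0)))))
    large (suc n) = ℕP.≤-trans (large n) (ℕP.m≤m+n _ _)

  dominant-large : ∀ q k b → b ℕ.≤ 9 → ∀ n → ¬ psum (+ suc (suc (q ℕ.+ k))) (+ suc q) (n ℕ.+ 4) ≡ + b
  dominant-large q k b b≤9 n = ≢-by-≤
    (≡.trans (≡.cong (psum (+ suc (suc (q ℕ.+ k))) (+ suc q)) (ℕP.+-suc n 3)) (proj₁ (proj₂ (matches (n ℕ.+ 3)))))
    (ℕP.≤-trans (s≤s b≤9) (large n))
    where open Dominant q k

  -- u = -(2 + k), v = -w: the signs of the power sums alternate.
  module Alternating (k w : ℕ) where
    a = suc (suc k)

    record State : Set where
      constructor state
      field x d e : ℕ

    next : State → State
    -- The next absolute value is a(x + d + e) + w(x + d) - x. Since a = 2 + k, one of the two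
    -- copies of x + d + e absorbs the term -x, and the increment is visibly a natural number.
    next (state x d e) = state (x ℕ.+ d) e (k ℕ.* (x ℕ.+ d ℕ.+ e) ℕ.+ w ℕ.* (x ℕ.+ d) ℕ.+ d ℕ.+ e)

    at : ℕ → State
    at zero    = state a (suc k ℕ.* a ℕ.+ 2 ℕ.* w)
                   (suc (k ℕ.* (8 ℕ.+ 5 ℕ.* k ℕ.+ k ℕ.* k) ℕ.+ w ℕ.* (4 ℕ.+ 3 ℕ.* k)))
    at (suc n) = next (at n)

    sgn : ℕ → ℤ
    sgn zero    = ℤ.- + 1
    sgn (suc n) = ℤ.- sgn n

    f = psum (ℤ.- + a) (ℤ.- + w)

    private
      step : ∀ S x d e → ℤ.- + a ℤ.* (S ℤ.* + (x ℕ.+ d ℕ.+ e)) ℤ.- (ℤ.- + w) ℤ.* (ℤ.- S ℤ.* + (x ℕ.+ d)) ℤ.+ S ℤ.* + x ≡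
             ℤ.- S ℤ.* + (x ℕ.+ d ℕ.+ e ℕ.+ (k ℕ.* (x ℕ.+ d ℕ.+ e) ℕ.+ w ℕ.* (x ℕ.+ d) ℕ.+ d ℕ.+ e))
      step S x d e = ≡.trans
        (≡.cong₂ (λ y z → ℤ.- (+ 2 ℤ.+ + k) ℤ.* (S ℤ.* y) ℤ.- (ℤ.- + w) ℤ.* (ℤ.- S ℤ.* z) ℤ.+ S ℤ.* + x)
          (≡.trans (ℤP.pos-+ (x ℕ.+ d) e) (≡.cong (ℤ._+ + e) (ℤP.pos-+ x d))) (ℤP.pos-+ x d))
        (≡.trans (solve 6 (λ S k w x d e →
            (:- (con (+ 2) :+ k)) :* (S :* (x :+ d :+ e)) :- (:- w) :* ((:- S) :* (x :+ d)) :+ S :* x :=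
            (:- S) :* (x :+ d :+ e :+ (k :* (x :+ d :+ e) :+ w :* (x :+ d) :+ d :+ e)))
            ≡.refl S (+ k) (+ w) (+ x) (+ d) (+ e))
        (≡.cong (λ y → ℤ.- S ℤ.* (+ x ℤ.+ + d ℤ.+ + e ℤ.+ (y ℤ.+ + d ℤ.+ + e)))
          (≡.sym (≡.cong₂ ℤ._+_ (ℤP.pos-* k (x ℕ.+ d ℕ.+ e)) (ℤP.pos-* w (x ℕ.+ d))))))

      start₂ : f 2 ≡ + (a ℕ.+ State.d (at 0))
      start₂ = ≡.trans
        (solve 2 (λ k w → (:- (con (+ 2) :+ k)) :* (:- (con (+ 2) :+ k)) :- con (+ 2) :* (:- w) :=
          con (+ 2) :+ k :+ ((con (+ 1) :+ k) :* (con (+ 2) :+ k) :+ con (+ 2) :* w)) ≡.refl (+ k) (+ w))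
        (≡.cong (λ y → + a ℤ.+ y) (≡.sym (≡.cong₂ ℤ._+_ (ℤP.pos-* (suc k) a) (ℤP.pos-* 2 w))))

      start₃ : f 3 ≡ ℤ.- + (a ℕ.+ State.d (at 0) ℕ.+ State.e (at 0))
      start₃ = ≡.trans
        (solve 2 (λ k w → (:- (con (+ 2) :+ k)) :* ((:- (con (+ 2) :+ k)) :* (:- (con (+ 2) :+ k)) :- con (+ 2) :* (:- w))
            :- (:- w) :* (:- (con (+ 2) :+ k)) :+ con (+ 3) :=
          :- (con (+ 2) :+ k :+ ((con (+ 1) :+ k) :* (con (+ 2) :+ k) :+ con (+ 2) :* w) :+
             (con (+ 1) :+ (k :* (con (+ 8) :+ con (+ 5) :* k :+ k :* k) :+ w :* (con (+ 4) :+ con (+ 3) :* k)))))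
          ≡.refl (+ k) (+ w))
        (≡.cong ℤ.-_ (≡.cong₂ (λ y z → + a ℤ.+ y ℤ.+ (+ 1 ℤ.+ z))
          (≡.sym (≡.cong₂ ℤ._+_ (ℤP.pos-* (suc k) a) (ℤP.pos-* 2 w)))
          (≡.sym (≡.cong₂ ℤ._+_
            (≡.trans (ℤP.pos-* k (8 ℕ.+ 5 ℕ.* k ℕ.+ k ℕ.* k)) (≡.cong (λ y → + k ℤ.* y)
              (≡.cong₂ (λ y z → + 8 ℤ.+ y ℤ.+ z) (ℤP.pos-* 5 k) (ℤP.pos-* k k))))
            (≡.trans (ℤP.pos-* w (4 ℕ.+ 3 ℕ.* k)) (≡.cong (λ y → + w ℤ.* (+ 4 ℤ.+ y)) (ℤP.pos-* 3 k)))))))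

    Matches : ℕ → State → Set
    Matches n (state x d e) =
      f (suc n) ≡ sgn n ℤ.* + x × f (suc (suc n)) ≡ ℤ.- sgn n ℤ.* + (x ℕ.+ d) ×
      f (suc (suc (suc n))) ≡ sgn n ℤ.* + (x ℕ.+ d ℕ.+ e)

    matches : ∀ n → Matches n (at n)
    matches zero = ≡.sym (ℤP.-1*i≡-i (+ a)) ,
      ≡.trans start₂ (≡.sym (ℤP.*-identityˡ _)) ,
      ≡.trans start₃ (≡.sym (ℤP.-1*i≡-i _))
    matches (suc n) =
      let (p , q , r) = matches n in
      q , ≡.trans r (≡.cong (ℤ._* + (x ℕ.+ d ℕ.+ e)) (≡.sym (ℤP.neg-involutive (sgn n)))) , forward p q r
      where
      open State (at n)
      forward : f (suc n) ≡ sgn n ℤ.* + x → f (suc (suc n)) ≡ ℤ.- sgn n ℤ.* + (x ℕ.+ d) →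
                f (suc (suc (suc n))) ≡ sgn n ℤ.* + (x ℕ.+ d ℕ.+ e) →
                f (suc (suc (suc (suc n)))) ≡
                ℤ.- sgn n ℤ.* + (x ℕ.+ d ℕ.+ e ℕ.+ (k ℕ.* (x ℕ.+ d ℕ.+ e) ℕ.+ w ℕ.* (x ℕ.+ d) ℕ.+ d ℕ.+ e))
      forward p q r = ≡.trans
        (≡.cong₂ ℤ._+_ (≡.cong₂ (λ y z → ℤ.- + a ℤ.* y ℤ.- (ℤ.- + w) ℤ.* z) r q) p) (step (sgn n) x d e)

    ∣sgn∣ : ∀ n → ℤ.∣ sgn n ∣ ≡ 1
    ∣sgn∣ zero    = ≡.refl
    ∣sgn∣ (suc n) = ≡.trans (ℤP.∣-i∣≡∣i∣ (sgn n)) (∣sgn∣ n)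

    ∣f∣ : ∀ n → ℤ.∣ f (suc n) ∣ ≡ State.x (at n)
    ∣f∣ n = ≡.trans (≡.cong ℤ.∣_∣ (proj₁ (matches n)))
      (≡.trans (ℤP.abs-* (sgn n) (+ State.x (at n)))
        (≡.trans (≡.cong (ℕ._* State.x (at n)) (∣sgn∣ n)) (ℕP.*-identityˡ _)))

    large : ∀ n → 8 ℕ.≤ State.x (at (n ℕ.+ 3))
    large zero = ℕP.m+n≤o⇒m≤o 8 (ℕP.≤-reflexive (≡.sym
      (ℕS.solve 4 (λ k w D E →
        let a = ℕS.con 2 ℕS.:+ k
            d = ℕS.con 2 ℕS.:+ D
            e = ℕS.con 1 ℕS.:+ E in
        a ℕS.:+ d ℕS.:+ e ℕS.:+ (k ℕS.:* (a ℕS.:+ d ℕS.:+ e) ℕS.:+ w ℕS.:* (a ℕS.:+ d) ℕS.:+ d ℕS.:+ e) ℕS.:=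
        ℕS.con 8 ℕS.:+ (k ℕS.:+ D ℕS.:+ E ℕS.:+ (k ℕS.:* (a ℕS.:+ d ℕS.:+ e) ℕS.:+ w ℕS.:* (a ℕS.:+ d) ℕS.:+ D ℕS.:+ E)))
        ≡.refl k w (k ℕ.+ k ℕ.* suc (suc k) ℕ.+ 2 ℕ.* w)
          (k ℕ.* (8 ℕ.+ 5 ℕ.* k ℕ.+ k ℕ.* k) ℕ.+ w ℕ.* (4 ℕ.+ 3 ℕ.* k)))))
    large (suc n) = ℕP.≤-trans (large n) (ℕP.m≤m+n _ _)

  alternating-large : ∀ k w b → b ℕ.≤ 7 → ∀ n → ¬ psum (ℤ.- + suc (suc k)) (ℤ.- + w) (n ℕ.+ 4) ≡ + b
  alternating-large k w b b≤7 n e = ℕP.<-irrefl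
    (≡.trans (≡.sym (≡.cong ℤ.∣_∣ e)) (≡.trans (≡.cong (λ m → ℤ.∣ f m ∣) (ℕP.+-suc n 3)) (∣f∣ (n ℕ.+ 3))))
    (ℕP.≤-trans (s≤s b≤7) (large n))
    where open Alternating k w

  private
    -- The Perrin sequence 3, 0, 2, 3, 2, 5, 5, 7, 10, 12, 17, ..., belonging to x³ - x - 1. Its
    -- first terms are not monotone, so a lower bound is propagated from three consecutive terms.
    perrin : ℕ → ℕ
    perrin 0 = 3
    perrin 1 = 0
    perrin 2 = 2
    perrin (suc (suc (suc n))) = perrin (suc n) ℕ.+ perrin n

    perrin≡ : ∀ n → psum (+ 0) (ℤ.- + 1) n ≡ + perrin n
    perrin≡ 0 = ≡.refl
    perrin≡ 1 = ≡.refl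
    perrin≡ 2 = ≡.refl
    perrin≡ (suc (suc (suc n))) = ≡.trans
      (solve 3 (λ x y z → con (+ 0) :* x :- (:- con (+ 1)) :* y :+ z := y :+ z) ≡.refl
        (psum (+ 0) (ℤ.- + 1) (suc (suc n))) (psum (+ 0) (ℤ.- + 1) (suc n)) (psum (+ 0) (ℤ.- + 1) n))
      (≡.cong₂ ℤ._+_ (perrin≡ (suc n)) (perrin≡ n))

    perrin-above : ∀ {b} m → b ℕ.≤ perrin m → b ℕ.≤ perrin (1 ℕ.+ m) → b ℕ.≤ perrin (2 ℕ.+ m) →
                   ∀ n → b ℕ.≤ perrin (n ℕ.+ m)
    perrin-above m p q r zero = p
    perrin-above {b} m p q r (suc n) = ≡.subst (λ k → b ℕ.≤ perrin k) (ℕP.+-suc n m)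
      (perrin-above (suc m) q r (ℕP.≤-trans q (ℕP.m≤m+n (perrin (suc m)) (perrin m))) n)

    perrin-≢ : ∀ {b} m n → b ℕ.< perrin m → b ℕ.< perrin (1 ℕ.+ m) → b ℕ.< perrin (2 ℕ.+ m) →
               ¬ psum (+ 0) (ℤ.- + 1) (n ℕ.+ m) ≡ + b
    perrin-≢ m n p q r = ≢-by-≤ (perrin≡ (n ℕ.+ m)) (perrin-above m p q r n)

    -- From index 4 on, the Perrin sequence takes the value 5 only at 5 and 6, where the other sum
    -- is 4 and -2. In `0,-1` it takes the value 7 only at index 7, where the other sum is -1.
    -1,0 : ∀ n → psum (ℤ.- + 1) (+ 0) (n ℕ.+ 4) ≡ + 7 → psum (+ 0) (ℤ.- + 1) (n ℕ.+ 4) ≡ + 5 → ⊥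
    -1,0 0 _ ()
    -1,0 1 ()
    -1,0 2 ()
    -1,0 (suc (suc (suc n))) _ e = perrin-≢ 7 n
      (from-yes (5 ℕ.<? 7)) (from-yes (5 ℕ.<? 10)) (from-yes (5 ℕ.<? 12))
      (≡.subst (λ k → psum (+ 0) (ℤ.- + 1) k ≡ + 5)
        (≡.trans (≡.cong (3 ℕ.+_) (ℕP.+-comm n 4)) (ℕP.+-comm 7 n)) e)

    0,-1 : ∀ n → psum (+ 0) (ℤ.- + 1) (n ℕ.+ 4) ≡ + 7 → psum (ℤ.- + 1) (+ 0) (n ℕ.+ 4) ≡ + 5 → ⊥
    0,-1 0 ()
    0,-1 1 ()
    0,-1 2 ()
    0,-1 3 _ ()
    0,-1 (suc (suc (suc (suc n)))) e _ = perrin-≢ 8 n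
      (from-yes (7 ℕ.<? 10)) (from-yes (7 ℕ.<? 12)) (from-yes (7 ℕ.<? 17))
      (≡.subst (λ k → psum (+ 0) (ℤ.- + 1) k ≡ + 7)
        (≡.trans (≡.cong (4 ℕ.+_) (ℕP.+-comm n 4)) (ℕP.+-comm 8 n)) e)

    shift-4 : ∀ m n {u v b} → psum u v (m ℕ.+ n ℕ.+ 4) ≡ + b → psum u v (n ℕ.+ (m ℕ.+ 4)) ≡ + b
    shift-4 m n {u} {v} {b} = ≡.subst (λ k → psum u v k ≡ + b)
      (≡.trans (≡.cong (ℕ._+ 4) (ℕP.+-comm m n)) (ℕP.+-assoc n m 4))

    1,0 : ∀ n → ¬ psum (+ 1) (+ 0) (n ℕ.+ 4) ≡ + 7
    1,0 0 ()
    1,0 1 ()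
    1,0 (suc (suc n)) e = Positive.above-psum 0 0 4 (from-yes (7 ℕ.<? 10)) n (shift-4 2 n e)

    0,1 : ∀ n → psum (+ 0) (+ 1) (n ℕ.+ 4) ≡ + 7 → ¬ psum (+ 1) (+ 0) (n ℕ.+ 4) ≡ + 5
    0,1 0 ()
    0,1 (suc n) _ e = Positive.above-psum 0 0 3 (from-yes (5 ℕ.<? 6)) n (shift-4 1 n e)

    symmetric : ∀ {x} → x ≡ + 7 → x ≡ + 5 → ⊥
    symmetric ≡.refl ()

    -- If u = v, the two equations contradict each other. Otherwise the sum whose first argument is
    -- the larger one is dominant, and this excludes 7 or 5 according to which argument that is.
    both-positive : ∀ p q n → psum (+ suc p) (+ suc q) (n ℕ.+ 4) ≡ + 7 →
                    psum (+ suc q) (+ suc p) (n ℕ.+ 4) ≡ + 5 → ⊥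
    both-positive p q n e e′ with ℕP.<-cmp p q
    ... | tri≈ _ ≡.refl _ = symmetric e e′
    ... | tri> _ _ q<p with ℕP.m≤n⇒∃[o]m+o≡n q<p
    ...   | k , ≡.refl = dominant-large q k 7 (from-yes (7 ℕ.≤? 9)) n e
    both-positive p q n e e′ | tri< p<q _ _ with ℕP.m≤n⇒∃[o]m+o≡n p<q
    ...   | k , ≡.refl = dominant-large p k 5 (from-yes (5 ℕ.≤? 9)) n e′

    both-negative : ∀ a w n → psum (ℤ.- + a) (ℤ.- + w) (n ℕ.+ 4) ≡ + 7 →
                    psum (ℤ.- + w) (ℤ.- + a) (n ℕ.+ 4) ≡ + 5 → ⊥
    both-negative (suc (suc k)) w n e _ = alternating-large k w 7 ℕP.≤-refl n e
    both-negative a (suc (suc k)) n _ e = alternating-large k a 5 (from-yes (5 ℕ.≤? 7)) n e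
    both-negative 0 0 n e e′ = symmetric e e′
    both-negative 1 1 n e e′ = symmetric e e′
    both-negative 0 1 n e e′ = 0,-1 n e e′
    both-negative 1 0 n e e′ = -1,0 n e e′

    from-four : ∀ u v n → psum u v (n ℕ.+ 4) ≡ + 7 → psum v u (n ℕ.+ 4) ≡ + 5 → ⊥
    from-four (+ suc zero)    (+ zero)     n e _  = 1,0 n e
    from-four (+ suc (suc p)) (+ zero)     n e _  = positive-large (suc p) 0 7 (from-yes (7 ℕ.≤? 10)) (λ ()) n e
    from-four (+ suc p)       -[1+ w ]     n e _  = positive-large p (suc w) 7 (from-yes (7 ℕ.≤? 10)) (λ ()) n e
    from-four (+ suc p)       (+ suc q)    n e e′ = both-positive p q n e e′
    from-four (+ zero)        (+ suc zero) n e e′ = 0,1 n e e′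
    from-four (+ zero)        (+ suc (suc q)) n _ e′ = positive-large (suc q) 0 5 (from-yes (5 ℕ.≤? 10)) (λ ()) n e′
    from-four -[1+ a ]        (+ suc q)    n _ e′ = positive-large q (suc a) 5 (from-yes (5 ℕ.≤? 10)) (λ ()) n e′
    from-four (+ zero)        (+ zero)     n e e′ = symmetric e e′
    from-four (+ zero)        -[1+ w ]     n e e′ = both-negative 0 (suc w) n e e′
    from-four -[1+ a ]        (+ zero)     n e e′ = both-negative (suc a) 0 n e e′
    from-four -[1+ a ]        -[1+ w ]     n e e′ = both-negative (suc a) (suc w) n e e′

    -- (u - v)(u + v + 2) = 2, with factors of the same parity.
    two : ∀ u v → u ℤ.* u ℤ.- + 2 ℤ.* v ≡ + 7 → v ℤ.* v ℤ.- + 2 ℤ.* u ≡ + 5 → ⊥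
    two u v p q = parity (ℤ._%ℕ_ x 2) (ℤ._/ℕ_ x 2) (ℤD.n%ℕd<d x 2) (ℤD.a≡a%ℕn+[a/ℕn]*n x 2)
      where
      x = u ℤ.- v
      y = v ℤ.+ + 1
      product : x ℤ.* (x ℤ.+ + 2 ℤ.* y) ≡ + 2
      product = ≡.trans
        (solve 2 (λ u v → (u :- v) :* (u :- v :+ con (+ 2) :* (v :+ con (+ 1))) :=
          (u :* u :- con (+ 2) :* v) :- (v :* v :- con (+ 2) :* u)) ≡.refl u v)
        (≡.cong₂ ℤ._-_ p q)
      odd : ∀ i → ¬ + 1 ≡ i ℤ.* + 2
      odd i e = from-no (+ 2 ℤS.∣? + 1) (ℤS.divides i e)
      parity : ∀ r m → r ℕ.< 2 → x ≡ + r ℤ.+ m ℤ.* + 2 → ⊥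
      parity 0 m _ e = odd (m ℤ.* (m ℤ.+ y)) (ℤP.*-cancelʳ-≡ (+ 1) (m ℤ.* (m ℤ.+ y) ℤ.* + 2) (+ 2)
        (≡.trans (≡.sym product) (≡.trans (≡.cong (λ x → x ℤ.* (x ℤ.+ + 2 ℤ.* y)) e)
          (solve 2 (λ m y → (con (+ 0) :+ m :* con (+ 2)) :* (con (+ 0) :+ m :* con (+ 2) :+ con (+ 2) :* y) :=
            m :* (m :+ y) :* con (+ 2) :* con (+ 2)) ≡.refl m y))))
      parity 1 m _ e = odd (m ℤ.* (+ 1 ℤ.+ m ℤ.* + 2 ℤ.+ + 2 ℤ.* y) ℤ.+ m ℤ.+ y)
        (≡.trans (solve 1 (λ z → con (+ 1) := (con (+ 1) :+ z) :- z) ≡.refl (+ 1))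
        (≡.trans (≡.cong (ℤ._- + 1) (≡.trans (≡.sym product) (≡.cong (λ x → x ℤ.* (x ℤ.+ + 2 ℤ.* y)) e)))
          (solve 2 (λ m y → (con (+ 1) :+ m :* con (+ 2)) :* (con (+ 1) :+ m :* con (+ 2) :+ con (+ 2) :* y) :- con (+ 1) :=
            (m :* (con (+ 1) :+ m :* con (+ 2) :+ con (+ 2) :* y) :+ m :+ y) :* con (+ 2)) ≡.refl m y)))
      parity (suc (suc r)) m (s≤s (s≤s ())) e

  -- Both surviving indices do occur: u = 7, v = 5 at index 1, and u = 1, v = -1 at index 3, which
  -- is the unit λ itself. Index 2 fails by parity, all indices from 4 on by growth or by inspection
  -- of the few slowly growing sequences.
  psum-7-5 : ∀ u v l → psum u v l ≡ + 7 → psum v u l ≡ + 5 → l ≡ 1 ⊎ l ≡ 3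
  psum-7-5 u v 0 ()
  psum-7-5 u v 1 _ _ = inj₁ ≡.refl
  psum-7-5 u v 2 p q = ⊥-elim (two u v p q)
  psum-7-5 u v 3 _ _ = inj₂ ≡.refl
  psum-7-5 u v (suc (suc (suc (suc n)))) p q = ⊥-elim (from-four u v n
    (≡.subst (λ k → psum u v k ≡ + 7) (ℕP.+-comm 4 n) p)
    (≡.subst (λ k → psum v u k ≡ + 5) (ℕP.+-comm 4 n) q))

-- Computation in ℤ[X]/(X³ - X² - X - 1) and the sieve tables.

module Coordinates where

  -- Not a record: η would prevent sharing in the computations below.
  data Triple : Set where
    triple : ℤ → ℤ → ℤ → Triple

  c₂ : Triple → ℤ
  c₂ (triple _ _ c) = c

  -- Evaluates a coordinate before it is passed on. Otherwise several hundred shifts would build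
  -- nested unevaluated sums, in which each coordinate is used more than once.
  forceℤ : ∀ {A : Set} → ℤ → (ℤ → A) → A
  forceℤ (+ n)    k = force n λ n → k (+ n)
  forceℤ -[1+ n ] k = force n λ n → k -[1+ n ]

  forceℤ-≡ : ∀ {A : Set} i (k : ℤ → A) → forceℤ i k ≡ k i
  forceℤ-≡ (+ n)    k = force-≡ n _
  forceℤ-≡ -[1+ n ] k = force-≡ n _

  shift unshift : Triple → Triple
  shift   (triple a b c) = forceℤ (a ℤ.+ c) λ x → forceℤ (b ℤ.+ c) λ y → triple c x y
  unshift (triple a b c) = forceℤ (b ℤ.- a) λ x → forceℤ (c ℤ.- a) λ y → triple x y a

  shift-≡ : ∀ a b c → shift (triple a b c) ≡ triple c (a ℤ.+ c) (b ℤ.+ c)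
  shift-≡ a b c = ≡.trans (forceℤ-≡ (a ℤ.+ c) _) (forceℤ-≡ (b ℤ.+ c) _)

  unshift-≡ : ∀ a b c → unshift (triple a b c) ≡ triple (b ℤ.- a) (c ℤ.- a) a
  unshift-≡ a b c = ≡.trans (forceℤ-≡ (b ℤ.- a) _) (forceℤ-≡ (c ℤ.- a) _)

  iterate : (Triple → Triple) → ℕ → Triple → Triple
  iterate f zero    e = e
  iterate f (suc n) e = f (iterate f n e)

  -- Multiplication by Xᵏ in ℤ[X]/(X³ - X² - X - 1).
  act : ℤ → Triple → Triple
  act (+ n)    = iterate shift n
  act -[1+ n ] = iterate unshift (suc n)

  1ᵀ 1+Xᵀ : Triple
  1ᵀ   = triple (+ 1) (+ 0) (+ 0)
  1+Xᵀ = triple (+ 1) (+ 1) (+ 0)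

  infixl 6 _+ᵀ_
  _+ᵀ_ : Triple → Triple → Triple
  triple a b c +ᵀ triple a′ b′ c′ = triple (a ℤ.+ a′) (b ℤ.+ b′) (c ℤ.+ c′)

  infixl 7 _*ᵀ_
  _*ᵀ_ : ℤ → Triple → Triple
  i *ᵀ triple a b c = triple (i ℤ.* a) (i ℤ.* b) (i ℤ.* c)

  infixl 7 _/ᵀ_
  _/ᵀ_ : Triple → (q : ℕ) .{{_ : ℕ.NonZero q}} → Triple
  triple a b c /ᵀ q = triple (a ℤ./ℕ q) (b ℤ./ℕ q) (c ℤ./ℕ q)

  residues : (q M : ℕ) → Triple → List ℕ → Set
  residues q M w rs = (r : Fin M) → (+ q) ℤS.∣ c₂ (act (+ toℕ r) w) → toℕ r ∈ rs

  private
    open Data.List.Membership.DecPropositional ℕ._≟_ using (_∈?_)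
    residues? : ∀ q M w rs → Dec (residues q M w rs)
    residues? q M w rs = FP.all? λ r → (+ q ℤS.∣? c₂ (act (+ toℕ r) w)) →-dec (toℕ r ∈? rs)

  -- The quotients of X^(±287) - 1 by 83 and of X^(±140) - 1 by 29. That the floor divisions are
  -- exact is confirmed by the equations `G₈₃-eq` to `H₂₉-eq`, which hold by computation.
  G₈₃ H₈₃ G₂₉ H₂₉ : Triple
  G₈₃ = (act (+ 287) 1ᵀ +ᵀ (ℤ.- + 1) *ᵀ 1ᵀ) /ᵀ 83
  H₈₃ = (act (ℤ.- + 287) 1ᵀ +ᵀ (ℤ.- + 1) *ᵀ 1ᵀ) /ᵀ 83
  G₂₉ = (act (+ 140) 1ᵀ +ᵀ (ℤ.- + 1) *ᵀ 1ᵀ) /ᵀ 29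
  H₂₉ = (act (ℤ.- + 140) 1ᵀ +ᵀ (ℤ.- + 1) *ᵀ 1ᵀ) /ᵀ 29

  -- wG and wH are w times the derivatives of X²⁸⁷ⁿ and X⁻²⁸⁷ⁿ at n = 0,
  -- modulo 83.
  Regular : Triple → Triple → Triple → ℤ → Set
  Regular w wG wH k = c₂ (act k w) ≡ + 0 ×
    ¬ 83 ℕD.∣ ℤ.∣ c₂ (act k wG) ∣ × ¬ 83 ℕD.∣ ℤ.∣ c₂ (act k wH) ∣

  private
    regular? : ∀ w wG wH k → Dec (Regular w wG wH k)
    regular? w wG wH k = (c₂ (act k w) ℤ.≟ + 0) ×-dec
      (¬? (83 ℕD.∣? ℤ.∣ c₂ (act k wG) ∣) ×-dec ¬? (83 ℕD.∣? ℤ.∣ c₂ (act k wH) ∣))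

    incompatible? : ∀ r → Dec (All (λ s → ¬ (+ 7 ℤS.∣ + r ℤ.- + s)) (0 ∷ 21 ∷ 54 ∷ 112 ∷ 138 ∷ []))
    incompatible? r = All.all? (λ s → ¬? (+ 7 ℤS.∣? + r ℤ.- + s)) _

  V₈₃ V₈₃′ : Triple
  V₈₃  = G₈₃ +ᵀ shift G₈₃
  V₈₃′ = H₈₃ +ᵀ shift H₈₃

  -- The results of these long computations are sealed, so that later type checking does not unfold
  -- them.
  abstract
    -- The exponents K = a + 1 belonging to a = 0, -1, -4, -17.
    T-regular : All (Regular 1ᵀ G₈₃ H₈₃) (+ 1 ∷ + 0 ∷ -[1+ 2 ] ∷ -[1+ 15 ] ∷ [])
    T-regular = toWitness {a? = All.all? (regular? 1ᵀ G₈₃ H₈₃) _} _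

    -- With K = 4 + 3j, the values j = 0 and j = -2 belong to a = 1/3 and a = -5/3.
    V-regular : All (Regular 1+Xᵀ V₈₃ V₈₃′) (+ 0 ∷ -[1+ 1 ] ∷ [])
    V-regular = toWitness {a? = All.all? (regular? 1+Xᵀ V₈₃ V₈₃′) _} _

    -- The residues 74 and 125 modulo 287 pass the sieve at 83 without containing a zero. They are 4
    -- and 6 modulo 7 = gcd(287, 140), whereas the residues left by the sieve at 29 are 0 or 5
    -- modulo 7.
    incompatible-74 : All (λ s → ¬ (+ 7 ℤS.∣ + 74 ℤ.- + s)) (0 ∷ 21 ∷ 54 ∷ 112 ∷ 138 ∷ [])
    incompatible-74 = toWitness {a? = incompatible? 74} _

    incompatible-125 : All (λ s → ¬ (+ 7 ℤS.∣ + 125 ℤ.- + s)) (0 ∷ 21 ∷ 54 ∷ 112 ∷ 138 ∷ [])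
    incompatible-125 = toWitness {a? = incompatible? 125} _

    G₈₃-eq : act (+ 287) 1ᵀ ≡ 1ᵀ +ᵀ + 83 *ᵀ G₈₃
    G₈₃-eq = ≡.refl
    H₈₃-eq : act (ℤ.- + 287) 1ᵀ ≡ 1ᵀ +ᵀ + 83 *ᵀ H₈₃
    H₈₃-eq = ≡.refl
    G₂₉-eq : act (+ 140) 1ᵀ ≡ 1ᵀ +ᵀ + 29 *ᵀ G₂₉
    G₂₉-eq = ≡.refl
    H₂₉-eq : act (ℤ.- + 140) 1ᵀ ≡ 1ᵀ +ᵀ + 29 *ᵀ H₂₉
    H₂₉-eq = ≡.refl

    sieve-T : residues 83 287 1ᵀ (0 ∷ 1 ∷ 271 ∷ 284 ∷ [])
    sieve-T = toWitness {a? = residues? 83 287 1ᵀ _} _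
    sieve-V : residues 83 287 1+Xᵀ (0 ∷ 74 ∷ 125 ∷ 285 ∷ [])
    sieve-V = toWitness {a? = residues? 83 287 1+Xᵀ _} _
    sieve-V₂₉ : residues 29 140 1+Xᵀ (0 ∷ 21 ∷ 54 ∷ 112 ∷ 138 ∷ [])
    sieve-V₂₉ = toWitness {a? = residues? 29 140 1+Xᵀ _} _

-- Divisibility, fractions in lowest terms and the list of zeros.

abstract
  83-prime : Prime 83
  83-prime = from-yes (prime? 83)

module Divisibility where
  open Data.Integer.Solver.+-*-Solver

  private
    regroup : ∀ p n q g z e → p ℤ.* q ℤ.* (n ℤ.* g ℤ.+ p ℤ.* (n ℤ.* z ℤ.+ q ℤ.* e)) ≡
      + 0 ℤ.+ n ℤ.* (p ℤ.* q) ℤ.* g ℤ.+ n ℤ.* (p ℤ.* q) ℤ.* p ℤ.* z ℤ.+ (p ℤ.* q) ℤ.* (p ℤ.* q) ℤ.* e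
    regroup = solve 6 (λ p n q g z e → p :* q :* (n :* g :+ p :* (n :* z :+ q :* e)) :=
      con (+ 0) :+ n :* (p :* q) :* g :+ n :* (p :* q) :* p :* z :+ (p :* q) :* (p :* q) :* e) ≡.refl

    move : ∀ {x y} → x ℤ.+ y ≡ + 0 → x ≡ ℤ.- y
    move {x} {y} e = ℤP.i-j≡0⇒i≡j x (ℤ.- y) (≡.trans (≡.cong (λ z → x ℤ.+ z) (ℤP.neg-involutive y)) e)

  -- Division by p q leaves n g + p(n z + q e) = 0, so p divides n g and hence n. The equation has
  -- the unsimplified shape, with its initial `+ 0`, in which the coefficient of λ² arises in
  -- `Skolem`.
  leading-term : ∀ {p} → Prime p → ∀ n (q g z e : ℤ) → ¬ q ≡ + 0 → ¬ p ℕD.∣ ℤ.∣ g ∣ →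
    + 0 ≡ + 0 ℤ.+ + n ℤ.* (+ p ℤ.* q) ℤ.* g ℤ.+ + n ℤ.* (+ p ℤ.* q) ℤ.* + p ℤ.* z
          ℤ.+ (+ p ℤ.* q) ℤ.* (+ p ℤ.* q) ℤ.* e → p ℕD.∣ n
  leading-term {p} pr n q g z e q≢0 p∤g eq =
    conclude (ℤP.i*j≡0⇒i≡0∨j≡0 (+ p ℤ.* q) (≡.trans (regroup (+ p) (+ n) q g z e) (≡.sym eq)))
    where
    x = + n ℤ.* z ℤ.+ q ℤ.* e
    absurd : (+ p ≡ + 0) ⊎ (q ≡ + 0) → ⊥
    absurd (inj₁ p≡0) = ¬prime[0] (≡.subst Prime (ℤP.+-injective p≡0) pr)
    absurd (inj₂ q≡0) = q≢0 q≡0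
    choose : (p ℕD.∣ n) ⊎ (p ℕD.∣ ℤ.∣ g ∣) → p ℕD.∣ n
    choose (inj₁ d) = d
    choose (inj₂ d) = ⊥-elim (p∤g d)
    conclude : (+ p ℤ.* q ≡ + 0) ⊎ (+ n ℤ.* g ℤ.+ + p ℤ.* x ≡ + 0) → p ℕD.∣ n
    conclude (inj₁ e) = ⊥-elim (absurd (ℤP.i*j≡0⇒i≡0∨j≡0 (+ p) e))
    conclude (inj₂ e) = choose (euclidsLemma n ℤ.∣ g ∣ pr (ℕD.divides ℤ.∣ x ∣
      (≡.trans (≡.sym (ℤP.abs-* (+ n) g)) (≡.trans (≡.cong ℤ.∣_∣ (move {+ n ℤ.* g} {+ p ℤ.* x} e))
      (≡.trans (ℤP.∣-i∣≡∣i∣ (+ p ℤ.* x)) (≡.trans (ℤP.abs-* (+ p) x) (ℕP.*-comm p ℤ.∣ x ∣)))))))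

record LowestTerms (p q : ℤ) : Set where
  constructor lowest
  field
    p′      : ℤ
    d       : ℕ
    g       : ℤ
    coprime : Coprime ℤ.∣ p′ ∣ (suc d)
    g≢0     : ¬ g ≡ + 0
    p≡      : p ≡ p′ ℤ.* g
    q≡      : q ≡ + suc d ℤ.* g

lowestTerms : ∀ p q → ¬ q ≡ + 0 → LowestTerms p q
lowestTerms p (+ zero)  q≢0 = ⊥-elim (q≢0 ≡.refl)
lowestTerms p (+ suc n) q≢0 = reduce (p ℚ./ suc n) (ℚP.↥-/ p (suc n)) (ℚP.↧-/ p (suc n))
  where
  reduce : ∀ (r : ℚ) → ↥ r ℤ.* ℤG.gcd p (+ suc n) ≡ p → ↧ r ℤ.* ℤG.gcd p (+ suc n) ≡ + suc n → LowestTerms p (+ suc n)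
  reduce (mkℚ p′ d c) e₁ e₂ = lowest p′ d (ℤG.gcd p (+ suc n)) (Cop.recompute c)
    (λ g≡0 → q≢0 (≡.trans (≡.sym e₂) (≡.trans (≡.cong (+ suc d ℤ.*_) g≡0) (ℤP.*-zeroʳ (+ suc d)))))
    (≡.sym e₁) (≡.sym e₂)
lowestTerms p -[1+ n ] q≢0 = negate (lowestTerms p (+ suc n) (λ ()))
  where
  negate : LowestTerms p (+ suc n) → LowestTerms p -[1+ n ]
  negate (lowest p′ d g c g≢0 e₁ e₂) = lowest (ℤ.- p′) d (ℤ.- g)
    (≡.subst (λ z → Coprime z (suc d)) (≡.sym (ℤP.∣-i∣≡∣i∣ p′)) c)
    (λ e → g≢0 (≡.trans (≡.sym (ℤP.neg-involutive g)) (≡.cong ℤ.-_ e)))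
    (≡.trans e₁ (ℤR.solve 2 (λ a b → a ℤR.:* b ℤR.:= (ℤR.:- a) ℤR.:* (ℤR.:- b)) ≡.refl p′ g))
    (≡.trans (≡.cong ℤ.-_ e₂) (ℤP.neg-distribʳ-* (+ suc d) g))

-- Adding a multiple of the denominator makes the coefficient of K a natural number. This is wanted
-- because it becomes the exponent of p + qλ, which need not be a unit, so that only nonnegative
-- powers of it have coordinates in ℤ.
bézoutℕ : ∀ K l → Coprime ℤ.∣ K ∣ (suc l) → ∃ λ x → ∃ λ y → x ℤ.* + suc l ℤ.+ K ℤ.* + y ≡ + 1
bézoutℕ K l c =
  let (u , v , e) = bézout c
      (w , e′) = withSign K u v e
      (y , e″) = positive w
  in v ℤ.- K ℤ.* + ℤ.∣ w ∣ , y , ≡.trans (≡.cong (λ y → (v ℤ.- K ℤ.* + ℤ.∣ w ∣) ℤ.* + suc l ℤ.+ K ℤ.* y) (≡.sym e″))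
       (≡.trans (shift K v w (+ ℤ.∣ w ∣) (+ suc l)) e′)
  where
  withSign : ∀ K u v → u ℤ.* + ℤ.∣ K ∣ ℤ.+ v ℤ.* + suc l ≡ + 1 → ∃ λ w → w ℤ.* K ℤ.+ v ℤ.* + suc l ≡ + 1
  withSign (+ k)    u v e = u , e
  withSign -[1+ k ] u v e = ℤ.- u , ≡.trans
    (≡.cong (ℤ._+ v ℤ.* + suc l) (ℤR.solve 2 (λ u k → (ℤR.:- u) ℤR.:* (ℤR.:- k) ℤR.:= u ℤR.:* k) ≡.refl u (+ suc k))) e
  positive : ∀ w → ∃ λ y → w ℤ.+ + ℤ.∣ w ∣ ℤ.* + suc l ≡ + y
  positive (+ w) = w ℕ.+ w ℕ.* suc l , ≡.cong (λ z → + w ℤ.+ z) (≡.sym (ℤP.pos-* w (suc l)))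
  positive -[1+ w ] = suc w ℕ.* l , ≡.trans
    (≡.cong (λ z → -[1+ w ] ℤ.+ + suc w ℤ.* z) (ℤP.pos-+ 1 l))
    (≡.trans (ℤR.solve 2 (λ w l → (ℤR.:- w) ℤR.:+ w ℤR.:* (ℤR.con (+ 1) ℤR.:+ l) ℤR.:= w ℤR.:* l) ≡.refl (+ suc w) (+ l))
      (≡.sym (ℤP.pos-* (suc w) l)))
  shift : ∀ K v w a L → (v ℤ.- K ℤ.* a) ℤ.* L ℤ.+ K ℤ.* (w ℤ.+ a ℤ.* L) ≡ w ℤ.* K ℤ.+ v ℤ.* L
  shift = ℤR.solve 5 (λ K v w a L → (v ℤR.:- K ℤR.:* a) ℤR.:* L ℤR.:+ K ℤR.:* (w ℤR.:+ a ℤR.:* L) ℤR.:= w ℤR.:* K ℤR.:+ v ℤR.:* L) ≡.refl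

twistedZeros : List ℚ
twistedZeros = (+ 0) / 1 ∷ -[1+ 0 ] / 1 ∷ -[1+ 3 ] / 1 ∷ -[1+ 16 ] / 1 ∷ (+ 1) / 3 ∷ -[1+ 4 ] / 3 ∷ []

-- Parity of the coordinates of (X - 1)²Xᵏ.

module OddCoordinate where
  open Coordinates

  -- (X - 1)²
  square : Triple
  square = triple (+ 1) (ℤ.- + 2) (+ 1)

  -- Modulo 2 one has P = (X - 1)³, so X acts trivially on (X - 1)² = 1 + X². The pattern odd, even,
  -- odd is therefore kept by `shift` and `unshift`.
  data Odd : Triple → Set where
    odd : ∀ a b c → Odd (triple (+ 1 ℤ.+ + 2 ℤ.* a) (+ 2 ℤ.* b) (+ 1 ℤ.+ + 2 ℤ.* c))

  private
    open Data.Integer.Solver.+-*-Solver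

    odd-by : ∀ {x y z} a b c → x ≡ + 1 ℤ.+ + 2 ℤ.* a → y ≡ + 2 ℤ.* b → z ≡ + 1 ℤ.+ + 2 ℤ.* c → Odd (triple x y z)
    odd-by a b c ≡.refl ≡.refl ≡.refl = odd a b c

    odd-shift : ∀ {e} → Odd e → Odd (shift e)
    odd-shift (odd a b c) = ≡.subst Odd (≡.sym (shift-≡ (+ 1 ℤ.+ + 2 ℤ.* a) (+ 2 ℤ.* b) (+ 1 ℤ.+ + 2 ℤ.* c)))
      (odd-by c (+ 1 ℤ.+ a ℤ.+ c) (b ℤ.+ c) ≡.refl
        (solve 2 (λ a c → (con (+ 1) :+ con (+ 2) :* a) :+ (con (+ 1) :+ con (+ 2) :* c) := con (+ 2) :* (con (+ 1) :+ a :+ c)) ≡.refl a c)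
        (solve 2 (λ b c → con (+ 2) :* b :+ (con (+ 1) :+ con (+ 2) :* c) := con (+ 1) :+ con (+ 2) :* (b :+ c)) ≡.refl b c))

    odd-unshift : ∀ {e} → Odd e → Odd (unshift e)
    odd-unshift (odd a b c) = ≡.subst Odd (≡.sym (unshift-≡ (+ 1 ℤ.+ + 2 ℤ.* a) (+ 2 ℤ.* b) (+ 1 ℤ.+ + 2 ℤ.* c)))
      (odd-by (b ℤ.- a ℤ.- + 1) (c ℤ.- a) a
        (solve 2 (λ a b → con (+ 2) :* b :- (con (+ 1) :+ con (+ 2) :* a) := con (+ 1) :+ con (+ 2) :* (b :- a :- con (+ 1))) ≡.refl a b)
        (solve 2 (λ a c → (con (+ 1) :+ con (+ 2) :* c) :- (con (+ 1) :+ con (+ 2) :* a) := con (+ 2) :* (c :- a)) ≡.refl a c)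
        ≡.refl)

    odd-iterate : ∀ {f} → (∀ {e} → Odd e → Odd (f e)) → ∀ n {e} → Odd e → Odd (iterate f n e)
    odd-iterate h zero    o = o
    odd-iterate h (suc n) o = h (odd-iterate h n o)

  odd-act : ∀ k → Odd (act k square)
  odd-act (+ n)    = odd-iterate odd-shift n (odd (+ 0) (ℤ.- + 1) (+ 0))
  odd-act -[1+ n ] = odd-iterate odd-unshift (suc n) (odd (+ 0) (ℤ.- + 1) (+ 0))

  odd-≢0 : ∀ {e} → Odd e → ¬ c₂ e ≡ + 0
  odd-≢0 (odd a b c) e = contra (ℕP.m*n≡1⇒m≡1 2 ℤ.∣ c ∣ (≡.trans (≡.sym (ℤP.abs-* (+ 2) c))
    (≡.cong ℤ.∣_∣ (isolate (+ 2 ℤ.* c) e))))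
    where
    contra : 2 ≡ 1 → ⊥
    contra ()
    isolate : ∀ x → + 1 ℤ.+ x ≡ + 0 → x ≡ -[1+ 0 ]
    isolate x e = ≡.trans (≡.sym (≡.trans (≡.sym (ℤP.+-assoc (ℤ.- + 1) (+ 1) x)) (ℤP.+-identityˡ x)))
      (≡.cong (λ y → ℤ.- + 1 ℤ.+ y) e)

-- From the exponent K back to the rational number a.

module Membership where
  private
    at : ∀ {d k k′} .(c : Coprime ℤ.∣ k ∣ (suc d)) → k ≡ k′ →
         (.(c′ : Coprime ℤ.∣ k′ ∣ (suc d)) → mkℚ k′ d c′ ∈ twistedZeros) → mkℚ k d c ∈ twistedZeros
    at c ≡.refl h = h c

    recover : ∀ {n k K} → n ℤ.+ k ≡ K → k ≡ K ℤ.- n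
    recover {n} {k} e = ≡.trans (ℤR.solve 2 (λ n k → k ℤR.:= (n ℤR.:+ k) ℤR.:- n) ≡.refl n k) (≡.cong (ℤ._- n) e)

  from-1 : ∀ {k} .(c : Coprime ℤ.∣ k ∣ 1) → + 1 ℤ.+ k ∈ (+ 1 ∷ + 0 ∷ -[1+ 2 ] ∷ -[1+ 15 ] ∷ []) → mkℚ k 0 c ∈ twistedZeros
  from-1 {k} c (here e)                         = at c (recover {+ 1} {k} e) λ _ → here ≡.refl
  from-1 {k} c (there (here e))                 = at c (recover {+ 1} {k} e) λ _ → there (here ≡.refl)
  from-1 {k} c (there (there (here e)))         = at c (recover {+ 1} {k} e) λ _ → there (there (here ≡.refl))
  from-1 {k} c (there (there (there (here e)))) = at c (recover {+ 1} {k} e) λ _ → there (there (there (here ≡.refl)))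

  from-3 : ∀ {k} .(c : Coprime ℤ.∣ k ∣ 3) j → + 3 ℤ.+ k ≡ + 4 ℤ.+ j ℤ.* + 3 → j ∈ (+ 0 ∷ -[1+ 1 ] ∷ []) → mkℚ k 2 c ∈ twistedZeros
  from-3 {k} c _ e (here ≡.refl)         = at c (recover {+ 3} {k} e) λ _ → there (there (there (there (here ≡.refl))))
  from-3 {k} c _ e (there (here ≡.refl)) = at c (recover {+ 3} {k} e) λ _ → there (there (there (there (there (here ≡.refl)))))

  -- K = 0 means that the numerator is minus the denominator; lowest terms then force the
  -- denominator 1 and a = -1.
  from-0 : ∀ {k d} .(c : Coprime ℤ.∣ k ∣ (suc d)) → + suc d ℤ.+ k ≡ + 0 → mkℚ k d c ∈ twistedZeros
  from-0 {k} {d} c e = at c (≡.trans (recover {+ suc d} {k} e) (ℤP.+-identityˡ -[1+ d ])) λ c′ → same (one c′) c′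
    where
    one : .(Coprime (suc d) (suc d)) → d ≡ 0
    one c = ℕP.suc-injective (Cop.recompute c (ℕD.∣-refl , ℕD.∣-refl))
    same : ∀ {d} → d ≡ 0 → .(c : Coprime (suc d) (suc d)) → mkℚ -[1+ d ] d c ∈ twistedZeros
    same ≡.refl c = there (here ≡.refl)

module OverField {c ℓ : Level} (R : CommutativeRing c ℓ)
  (inv : CommutativeRing.Carrier R → CommutativeRing.Carrier R) (acf : IsACF0 R inv) where

  open RingKit R
  open IsACF0 acf

  -- Integrality by stabilised modules, and Nakayama's lemma.

  module Lattices where

    module Over {B : Carrier → Set ℓ} (isSubring : IsSubring B) where
      open IsSubring isSubring

      data Span : List Carrier → Carrier → Set (c ⊔ ℓ) where
        nil  : ∀ {x} → x ≈ 0# → Span [] x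
        cons : ∀ {v V b r x} → B b → Span V r → x ≈ b * v + r → Span (v ∷ V) x

      span-resp : ∀ {V x y} → x ≈ y → Span V x → Span V y
      span-resp e (nil q)      = nil (trans (sym e) q)
      span-resp e (cons b r q) = cons b r (trans (sym e) q)

      span-0 : ∀ {V} → Span V 0#
      span-0 {[]}    = nil refl
      span-0 {v ∷ V} = cons B-0 span-0 (solve 1 (λ v → con (+ 0) := con (+ 0) :* v :+ con (+ 0)) refl v)

      span-+ : ∀ {V x y} → Span V x → Span V y → Span V (x + y)
      span-+ (nil p) (nil q) = nil (trans (+-cong p q) (+-identityˡ _))
      span-+ (cons {v} {b = b} {r} B₁ S₁ p) (cons {b = b′} {r = r′} B₂ S₂ q) =
        cons (B-+ B₁ B₂) (span-+ S₁ S₂)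
          (trans (+-cong p q)
            (solve 5 (λ v b r b′ r′ → (b :* v :+ r) :+ (b′ :* v :+ r′) := (b :+ b′) :* v :+ (r :+ r′))
              refl v b r b′ r′))

      span-scale : ∀ {V a x} → B a → Span V x → Span V (a * x)
      span-scale Ba (nil p) = nil (trans (*-congˡ p) (zeroʳ _))
      span-scale {a = a} Ba (cons {v} {b = b} {r} Bb S p) =
        cons (B-* Ba Bb) (span-scale Ba S)
          (trans (*-congˡ p)
            (solve 4 (λ a b v r → a :* (b :* v :+ r) := (a :* b) :* v :+ a :* r) refl a b v r))

      weaken : ∀ {v V x} → Span V x → Span (v ∷ V) x
      weaken {v} {x = x} S = cons B-0 S (solve 2 (λ v x → x := con (+ 0) :* v :+ x) refl v x)

      span-head : ∀ {v V} → Span (v ∷ V) v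
      span-head {v} = cons B-1 span-0 (solve 1 (λ v → v := con (+ 1) :* v :+ con (+ 0)) refl v)

      span-++ˡ : ∀ {V} W {x} → Span V x → Span (V ++ W) x
      span-++ˡ W (nil p)      = span-resp (sym p) span-0
      span-++ˡ W (cons b S p) = cons b (span-++ˡ W S) p

      span-++ʳ : ∀ V {W x} → Span W x → Span (V ++ W) x
      span-++ʳ []      S = S
      span-++ʳ (v ∷ V) S = weaken (span-++ʳ V S)

      span-split : ∀ V {W x} → Span (V ++ W) x →
                   ∃ λ y → ∃ λ z → Span V y × Span W z × x ≈ y + z
      span-split []      S = _ , _ , nil refl , S , sym (+-identityˡ _)
      span-split (v ∷ V) (cons {b = b} Bb S p) with span-split V S
      ... | y , z , Sy , Sz , q = b * v + y , z , cons Bb Sy refl , Sz ,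
        trans p (trans (+-congˡ q) (sym (+-assoc _ _ _)))

      span-map : ∀ g {V x} → Span V x → Span (map (g *_) V) (g * x)
      span-map g (nil p) = nil (trans (*-congˡ p) (zeroʳ g))
      span-map g (cons {v} {b = b} {r} Bb S p) = cons Bb (span-map g S)
        (trans (*-congˡ p)
          (solve 4 (λ g b v r → g :* (b :* v :+ r) := b :* (g :* v) :+ g :* r) refl g b v r))

      span-unmap : ∀ g V {x} → Span (map (g *_) V) x → ∃ λ y → Span V y × x ≈ g * y
      span-unmap g []      (nil p) = 0# , nil refl , trans p (sym (zeroʳ g))
      span-unmap g (v ∷ V) (cons {b = b} {r} Bb S p) with span-unmap g V S
      ... | y , Sy , q = b * v + y , cons Bb Sy refl ,
        trans p (trans (+-congˡ q)
          (solve 4 (λ g b v y → b :* (g :* v) :+ g :* y := g :* (b :* v :+ y)) refl g b v y))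

      record Order (V : List Carrier) (x : Carrier) : Set (c ⊔ ℓ) where
        constructor stabilises
        field act : ∀ {s} → Span V s → Span V (x * s)
      open Order

      order-resp : ∀ {V x y} → x ≈ y → Order V x → Order V y
      order-resp e f = stabilises λ S → span-resp (*-congʳ e) (act f S)

      order-+ : ∀ {V x y} → Order V x → Order V y → Order V (x + y)
      order-+ {x = x} {y} f g = stabilises λ S →
        span-resp (sym (distribʳ _ x y)) (span-+ (act f S) (act g S))

      order-* : ∀ {V x y} → Order V x → Order V y → Order V (x * y)
      order-* {x = x} {y} f g = stabilises λ S →
        span-resp (sym (*-assoc x y _)) (act f (act g S))

      order-B : ∀ {V b} → B b → Order V b
      order-B Bb = stabilises (span-scale Bb)

      adj : Carrier → List Carrier → ℕ → List Carrier
      adj g V zero    = []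
      adj g V (suc j) = V ++ map (g *_) (adj g V j)

      module _ (g : Carrier) (V : List Carrier) where

        adj-* : ∀ j {x} → Span (adj g V j) x → Span (adj g V (suc j)) (g * x)
        adj-* j S = span-++ʳ V (span-map g S)

        adj-mono : ∀ j {x} → Span (adj g V j) x → Span (adj g V (suc j)) x
        adj-mono zero    (nil p) = span-resp (sym p) span-0
        adj-mono (suc j) S with span-split V S
        ... | y , z , Sy , Sz , p with span-unmap g (adj g V j) Sz
        ... | w , Sw , q = span-resp (sym (trans p (+-congˡ q)))
          (span-+ (span-++ˡ _ Sy) (adj-* (suc j) (adj-mono j Sw)))

        adj-top : ∀ j {x} → Span (adj g V (suc j)) x →
                  ∃ λ y → ∃ λ s → Span (adj g V j) y × Span V s × x ≈ y + g ^ j * s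
        adj-top zero S with span-split V S
        ... | y , z , Sy , nil q , p = 0# , y , nil refl , Sy ,
          trans p (trans (+-congˡ q)
            (solve 1 (λ y → y :+ con (+ 0) := con (+ 0) :+ con (+ 1) :* y) refl y))
        adj-top (suc j) S with span-split V S
        ... | y , z , Sy , Sz , p with span-unmap g (adj g V (suc j)) Sz
        ... | w , Sw , q with adj-top j Sw
        ... | y′ , s , Sy′ , Ss , r = y + g * y′ , s ,
          span-+ (span-++ˡ _ Sy) (adj-* j Sy′) , Ss ,
          trans p (trans (+-congˡ (trans q (*-congˡ r)))
            (solve 5 (λ y g y′ G s → y :+ g :* (y′ :+ G :* s) := (y :+ g :* y′) :+ (g :* G) :* s)
              refl y g y′ (g ^ j) s))

        adj-act : ∀ j {x} → Order V x → ∀ {s} → Span (adj g V j) s → Span (adj g V j) (x * s)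
        adj-act zero    f (nil p) = nil (trans (*-congˡ p) (zeroʳ _))
        adj-act (suc j) {x} f S with span-split V S
        ... | y , z , Sy , Sz , p with span-unmap g (adj g V j) Sz
        ... | w , Sw , q = span-resp
          (sym (trans (*-congˡ (trans p (+-congˡ q)))
            (solve 4 (λ x y g w → x :* (y :+ g :* w) := x :* y :+ g :* (x :* w)) refl x y g w)))
          (span-+ (span-++ˡ _ (act f Sy)) (adj-* j (adj-act j f Sw)))

      record Lattice : Set (c ⊔ ℓ) where
        constructor lattice
        field
          gens : List Carrier
          one  : Span gens 1#

      -- Elements stabilising a finitely generated module that contains 1
      -- are integral over B.
      infix 4 _∈O_
      _∈O_ : Carrier → Lattice → Set (c ⊔ ℓ)
      x ∈O L = Order (Lattice.gens L) x

      unitLattice : Lattice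
      unitLattice = lattice (1# ∷ []) span-head

      -- Every new integral element enlarges the module. `lift` carries the elements that were
      -- integral before into the larger order, so that successive adjunctions compose.
      record Extension (L : Lattice) (G : Lattice → Set (c ⊔ ℓ)) : Set (c ⊔ ℓ) where
        constructor extension
        field
          ext      : Lattice
          lift     : ∀ x → x ∈O L → x ∈O ext
          holds    : G ext

      -- The hypothesis is a monic relation of degree n + 1 for g, expressed on V. The new module V
      -- + gV + ... + gⁿV is stable under g because only the top power leaves it and the relation
      -- brings it back; old elements of the order act on it because they commute with g.
      adjoin : ∀ L g n →
               (∀ {s} → Span (Lattice.gens L) s →
                  Span (adj g (Lattice.gens L) (suc n)) (g ^ suc n * s)) →
               Extension L (g ∈O_)
      adjoin (lattice V one) g n top = extension
        (lattice (adj g V (suc n)) (span-++ˡ (map (g *_) (adj g V n)) one))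
        (λ x f → stabilises (adj-act g V (suc n) f))
        (stabilises λ S → fold (adj-top g V (suc n) (adj-* g V (suc n) S)))
        where
        fold : ∀ {x} → (∃ λ y → ∃ λ s → Span (adj g V (suc n)) y × Span V s × x ≈ y + g ^ suc n * s) →
               Span (adj g V (suc n)) x
        fold (y , s , Sy , Ss , p) = span-resp (sym p) (span-+ Sy (top Ss))

      adjoinRoot : ∀ L g n → g ^ suc n ∈O L → Extension L (g ∈O_)
      adjoinRoot L g n f = adjoin L g n λ S → span-++ˡ _ (act f S)

      adjoinRoots : ∀ L gs → All (λ g → ∃ λ n → g ^ suc n ∈O L) gs →
                    Extension L (λ L′ → All (_∈O L′) gs)
      adjoinRoots L [] [] = extension L (λ _ z → z) []
      adjoinRoots L (g ∷ gs) ((n , f) ∷ fs) =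
        extension E₂.ext (λ x z → E₂.lift x (E₁.lift x z)) (E₂.lift g E₁.holds ∷ E₂.holds)
        where
        module E₁ = Extension (adjoinRoot L g n f)
        rest : All (λ g → ∃ λ n → g ^ suc n ∈O E₁.ext) gs
        rest = All.map (λ { (m , h) → m , E₁.lift _ h }) fs
        module E₂ = Extension (adjoinRoots E₁.ext gs rest)

      module Nakayama {D : Carrier} (D∈B : B D) where

        Row : List Carrier → Carrier → Set (c ⊔ ℓ)
        Row V v = ∃ λ g → B g × ∃ λ s → Span V s × (1# + D * g) * v ≈ D * s

        -- Gaussian elimination: the pivots stay congruent to 1 modulo D.
        annihilator : ∀ V → All (Row V) V →
                      ∃ λ g → B g × (∀ {x} → Span V x → (1# + D * g) * x ≈ 0#)
        annihilator [] [] = 0# , B-0 , λ { (nil p) → trans (*-congˡ p) (zeroʳ _) }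
        annihilator (v ∷ V) ((g , Bg , s , cons {b = b} {r} Bb Sr q , e) ∷ rows) =
          result (annihilator V (All.map reduce rows))
          where
          -- The row is (1 + D g)v = D(b v + r). Moving D b v to the left removes v from the
          -- right-hand side, and the pivot 1 + D(g - b) is still 1 modulo D.
          g′ = g - b
          Bg′ : B g′
          Bg′ = B-+ Bg (B-neg Bb)
          pivot : (1# + D * g′) * v ≈ D * r
          pivot = begin
            (1# + D * (g - b)) * v                 ≈⟨ solve 4 (λ D g b v → (con (+ 1) :+ D :* (g :- b)) :* v :=
                                                        (con (+ 1) :+ D :* g) :* v :- D :* (b :* v)) refl D g b v ⟩
            (1# + D * g) * v - D * (b * v)         ≈⟨ +-congʳ (trans e (*-congˡ q)) ⟩
            D * (b * v + r) - D * (b * v)          ≈⟨ solve 4 (λ D b v r → D :* (b :* v :+ r) :- D :* (b :* v) := D :* r)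
                                                        refl D b v r ⟩
            D * r                                  ∎
          times : ∀ {x y} → B x → B y → B (x + y + D * (x * y))
          times Bx By = B-+ (B-+ Bx By) (B-* D∈B (B-* Bx By))
          expand : ∀ x y w → (1# + D * (x + y + D * (x * y))) * w ≈ (1# + D * x) * ((1# + D * y) * w)
          expand x y w = solve 4 (λ D x y w →
            (con (+ 1) :+ D :* (x :+ y :+ D :* (x :* y))) :* w :=
            (con (+ 1) :+ D :* x) :* ((con (+ 1) :+ D :* y) :* w)) refl D x y w
          reduce : ∀ {w} → Row (v ∷ V) w → Row V w
          reduce {w} (h , Bh , s′ , cons {b = b′} {r′} Bb′ Sr′ q′ , e′) =
            g′ + h + D * (g′ * h) , times Bg′ Bh ,
            (b′ * (D * r) + (1# + D * g′) * r′) ,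
            span-+ (span-scale Bb′ (span-scale D∈B Sr))
                   (span-scale (B-+ B-1 (B-* D∈B Bg′)) Sr′) , (begin
            (1# + D * (g′ + h + D * (g′ * h))) * w       ≈⟨ expand g′ h w ⟩
            (1# + D * g′) * ((1# + D * h) * w)           ≈⟨ *-congˡ (trans e′ (*-congˡ q′)) ⟩
            (1# + D * g′) * (D * (b′ * v + r′))          ≈⟨ solve 5 (λ D g b v r →
                (con (+ 1) :+ D :* g) :* (D :* (b :* v :+ r)) :=
                D :* (b :* ((con (+ 1) :+ D :* g) :* v) :+ (con (+ 1) :+ D :* g) :* r))
                refl D g′ b′ v r′ ⟩
            D * (b′ * ((1# + D * g′) * v) + (1# + D * g′) * r′)
                                                         ≈⟨ *-congˡ (+-congʳ (*-congˡ pivot)) ⟩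
            D * (b′ * (D * r) + (1# + D * g′) * r′)      ∎)
          result : (∃ λ h → B h × (∀ {x} → Span V x → (1# + D * h) * x ≈ 0#)) →
                   ∃ λ h → B h × (∀ {x} → Span (v ∷ V) x → (1# + D * h) * x ≈ 0#)
          result (h , Bh , kill) = h + g′ + D * (h * g′) , times Bh Bg′ , kills
            where
            kills : ∀ {x} → Span (v ∷ V) x → (1# + D * (h + g′ + D * (h * g′))) * x ≈ 0#
            kills {x} (cons {b = b″} {r″} _ S″ q″) = begin
              (1# + D * (h + g′ + D * (h * g′))) * x                 ≈⟨ trans (expand h g′ x) (*-congˡ (*-congˡ q″)) ⟩
              (1# + D * h) * ((1# + D * g′) * (b″ * v + r″))         ≈⟨ solve 5 (λ q p b v r →
                  q :* (p :* (b :* v :+ r)) := q :* (b :* (p :* v)) :+ p :* (q :* r))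
                  refl (1# + D * h) (1# + D * g′) b″ v r″ ⟩
              (1# + D * h) * (b″ * ((1# + D * g′) * v)) + (1# + D * g′) * ((1# + D * h) * r″)
                ≈⟨ +-cong (*-congˡ (*-congˡ pivot)) (*-congˡ (kill S″)) ⟩
              (1# + D * h) * (b″ * (D * r)) + (1# + D * g′) * 0#
                ≈⟨ solve 5 (λ q p b d r → q :* (b :* (d :* r)) :+ p :* con (+ 0) := b :* (d :* (q :* r)))
                  refl (1# + D * h) (1# + D * g′) b″ D r ⟩
              b″ * (D * ((1# + D * h) * r))                          ≈⟨ *-congˡ (*-congˡ (kill Sr)) ⟩
              b″ * (D * 0#)                                          ≈⟨ solve 2 (λ b D → b :* (D :* con (+ 0)) := con (+ 0)) refl b″ D ⟩
              0#                                                     ∎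

        -- If o = D⁻¹ stabilises the module M, then DM = M, so some 1 + D g with g in B kills M;
        -- since M contains 1, this element is 0. Thus an integral inverse of D already lies in B,
        -- namely as -g.
        inverse⇒ : ∀ L {o} → o ∈O L → D * o ≈ 1# → ∃ λ g → B g × 1# + D * g ≈ 0#
        inverse⇒ (lattice V one) {o} o∈ Do≈1 with annihilator V (rows V λ S → S)
          where
          rows : ∀ W → (∀ {x} → Span W x → Span V x) → All (Row V) W
          rows []      inc = []
          rows (w ∷ W) inc =
            (0# , B-0 , o * w , act o∈ (inc span-head) , (begin
              (1# + D * 0#) * w   ≈⟨ solve 2 (λ D w → (con (+ 1) :+ D :* con (+ 0)) :* w := con (+ 1) :* w) refl D w ⟩
              1# * w              ≈⟨ *-congʳ (sym Do≈1) ⟩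
              (D * o) * w         ≈⟨ *-assoc D o w ⟩
              D * (o * w)         ∎))
            ∷ rows W (λ S → inc (weaken S))
        ... | g , Bg , kill = g , Bg , trans (sym (*-identityʳ _)) (kill one)

  -- Characteristic 0 and the absence of torsion congruent to 1 modulo t.

  module Field where

    natCast≈ι : ∀ n → natCast R n ≈ ι (+ n)
    natCast≈ι zero    = refl
    natCast≈ι (suc n) = trans (+-congˡ (natCast≈ι n)) (sym (ι-+ (+ 1) (+ n)))

    ι≈0⇒≡0 : ∀ i → ι i ≈ 0# → i ≡ + 0
    ι≈0⇒≡0 (+ zero)   _ = ≡.refl
    ι≈0⇒≡0 (+ suc n)  e = ⊥-elim (char0 n (trans (natCast≈ι (suc n)) e))
    ι≈0⇒≡0 -[1+ n ]   e = ⊥-elim (char0 n (trans (natCast≈ι (suc n))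
      (trans (sym (-‿involutive _)) (trans (-‿cong e) -0#≈0#))))

    ι-injective : ∀ i j → ι i ≈ ι j → i ≡ j
    ι-injective i j e = ℤP.i-j≡0⇒i≡j i j (ι≈0⇒≡0 (i ℤ.- j) (trans (ι≈ (⌜ i ⌝ ⊝ ⌜ j ⌝)) (x≈y⇒x-y≈0 e)))

    ι≉0 : ∀ i → ¬ i ≡ + 0 → ¬ ι i ≈ 0#
    ι≉0 i i≢0 e = i≢0 (ι≈0⇒≡0 i e)

    cancelˡ : ∀ {x y} → ¬ x ≈ 0# → x * y ≈ 0# → y ≈ 0#
    cancelˡ {x} {y} x≉0 e = begin
      y                ≈⟨ sym (*-identityˡ y) ⟩
      1# * y           ≈⟨ *-congʳ (sym (inverseʳ x x≉0)) ⟩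
      (x * inv x) * y  ≈⟨ solve 3 (λ x i y → (x :* i) :* y := i :* (x :* y)) refl x (inv x) y ⟩
      inv x * (x * y)  ≈⟨ trans (*-congˡ e) (zeroʳ _) ⟩
      0#               ∎

    *-cancelˡ-≈ : ∀ {x y z} → ¬ x ≈ 0# → x * y ≈ x * z → y ≈ z
    *-cancelˡ-≈ {x} {y} {z} x≉0 e = x-y≈0⇒x≈y (cancelˡ x≉0
      (trans (solve 3 (λ x y z → x :* (y :- z) := x :* y :- x :* z) refl x y z) (x≈y⇒x-y≈0 e)))

    *-≉0 : ∀ {x y} → ¬ x ≈ 0# → ¬ y ≈ 0# → ¬ x * y ≈ 0#
    *-≉0 x≉0 y≉0 e = y≉0 (cancelˡ x≉0 e)

    unit-≉0 : ∀ {x y} → x * y ≈ 1# → ¬ x ≈ 0#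
    unit-≉0 {x} {y} e x≈0 = 0≉1 (trans (sym (trans (*-congʳ x≈0) (zeroˡ y))) e)

    ^-≉0 : ∀ {x} n → ¬ x ≈ 0# → ¬ x ^ n ≈ 0#
    ^-≉0 zero    x≉0 e = 0≉1 (sym e)
    ^-≉0 (suc n) x≉0 e = ^-≉0 n x≉0 (cancelˡ x≉0 e)

    -- Away from 2, t generates an ideal above 11 of ramification index 2,
    -- whereas a primitive eleventh root of unity needs index at least 10 to
    -- be congruent to 1 modulo t.
    module Torsion (stable : ∀ {x y} → ¬ ¬ (x ≈ y) → x ≈ y)
      {p : Level} {O : Carrier → Set p} (isSubring : IsSubring O)
      {t δ u v : Carrier} (O-t : O t) (O-δ : O δ) (O-u : O u) (O-v : O v)
      (t²δ≈22 : t * t * δ ≈ ι (+ 22)) (uδ+vt²≈2 : u * δ + v * (t * t) ≈ ι (+ 2))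
      (t∤2 : ∀ {o} → O o → ¬ t * o ≈ ι (+ 2)) where
      open IsSubring isSubring

      private
        t≉0 : ¬ t ≈ 0#
        t≉0 t≈0 = ι≉0 (+ 22) (λ ()) (trans (sym t²δ≈22)
          (trans (*-congʳ (trans (*-congʳ t≈0) (zeroˡ t))) (zeroˡ δ)))

        -- If t divided δ, it would divide uδ + vt² = 2.
        δ∉tO : ∀ {o} → O o → ¬ δ ≈ t * o
        δ∉tO {o} Oo e = t∤2 (B-+ (B-* O-u Oo) (B-* O-v O-t)) (begin
          t * (u * o + v * t)       ≈⟨ solve 4 (λ t u o v → t :* (u :* o :+ v :* t) := u :* (t :* o) :+ v :* (t :* t))
                                         refl t u o v ⟩
          u * (t * o) + v * (t * t) ≈⟨ +-congʳ (*-congˡ (sym e)) ⟩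
          u * δ + v * (t * t)       ≈⟨ uδ+vt²≈2 ⟩
          ι (+ 2)                   ∎)

        -- Write xm + 11y = 1. With m = -t o and 22 = t²δ, the number 2 = 2xm + 22y would be a
        -- multiple of t.
        coprime-case : ∀ {m} → ¬ (11 ℕD.∣ m) → ∀ {o} → O o → ¬ ι (+ m) + t * o ≈ 0#
        coprime-case {m} 11∤m {o} Oo e =
          let (x , y , eq) = bézout (prime-∤⇒coprime prime-11 11∤m) in contra x y eq
          where
          contra : ∀ x y → x ℤ.* + m ℤ.+ y ℤ.* + 11 ≡ + 1 → ⊥
          contra x y eq = t∤2 (B-minus (B-* (B-ι y) (B-* O-t O-δ)) (B-* (B-* (B-ι (+ 2)) (B-ι x)) Oo)) (begin
            t * (ι y * (t * δ) - ι (+ 2) * ι x * o)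
              ≈⟨ lc₂ (- (ι (+ 2) * ι x)) (ι y) e t²δ≈22
                   (solve 6 (λ t y δ x o m →
                      t :* (y :* (t :* δ) :- con (+ 2) :* x :* o) :- con (+ 2) :* (x :* m :+ y :* con (+ 11)) :=
                      :- (con (+ 2) :* x) :* (m :+ t :* o :- con (+ 0)) :+ y :* (t :* t :* δ :- con (+ 22)))
                      refl t (ι y) δ (ι x) o (ι (+ m))) ⟩
            ι (+ 2) * (ι x * ι (+ m) + ι y * ι (+ 11))
              ≈⟨ *-congˡ (sym (ι≈ (⌜ x ⌝ ⊗ ⌜ + m ⌝ ⊕ ⌜ y ⌝ ⊗ ⌜ + 11 ⌝))) ⟩
            ι (+ 2) * ι (x ℤ.* + m ℤ.+ y ℤ.* + 11)
              ≈⟨ trans (*-congˡ (ι-cong eq)) (*-identityʳ _) ⟩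
            ι (+ 2) ∎)

        -- (1 + x)¹¹ - 1 = x(11(1 + x g) + x¹⁰), where g collects the inner binomial coefficients
        -- divided by 11. For x = t o and 22 = t²δ, twice the cofactor of x is t²(δ(1 + x g) +
        -- 2o²x⁸). If x were nonzero, the last bracket would vanish and t would divide δ.
        eleventh-root : ∀ {w o} → O o → w ≈ 1# + t * o → w ^ 11 ≈ 1# → w ≈ 1#
        eleventh-root {w} {o} Oo w≈ w¹¹≈1 = stable λ w≉1 →
          let x≉0 : ¬ x ≈ 0#
              x≉0 x≈0 = w≉1 (trans w≈ (trans (+-congˡ x≈0) (+-identityʳ 1#)))
              S≈0 : ι (+ 11) * (1# + x * g) + x ^ 10 ≈ 0#
              S≈0 = cancelˡ x≉0 (begin
                x * (ι (+ 11) * (1# + x * g) + x ^ 10)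
                  ≈⟨ solve 1 (λ x → x :* (con (+ 11) :* (con (+ 1) :+ x :* (con (+ 5) :+ x :* (con (+ 15) :+
                       x :* (con (+ 30) :+ x :* (con (+ 42) :+ x :* (con (+ 42) :+ x :* (con (+ 30) :+
                       x :* (con (+ 15) :+ x :* (con (+ 5) :+ x))))))))) :+ x :^ 10) :=
                       (con (+ 1) :+ x) :^ 11 :- con (+ 1)) refl x ⟩
                (1# + x) ^ 11 - 1#
                  ≈⟨ x≈y⇒x-y≈0 (trans (^-congˡ 11 (sym w≈)) w¹¹≈1) ⟩
                0# ∎)
              E≈0 : t * t * (δ * (1# + x * g) + ι (+ 2) * o ^ 2 * (t * o) ^ 8) ≈ 0#
              E≈0 = lc₂ (ι (+ 2)) (1# + x * g) S≈0 t²δ≈22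
                (solve 5 (λ t δ g o o⁸ →
                   t :* t :* (δ :* (con (+ 1) :+ t :* o :* g) :+ con (+ 2) :* o :^ 2 :* o⁸) :- con (+ 0) :=
                   con (+ 2) :* (con (+ 11) :* (con (+ 1) :+ t :* o :* g) :+ (t :* o) :* ((t :* o) :* o⁸) :- con (+ 0)) :+
                   (con (+ 1) :+ t :* o :* g) :* (t :* t :* δ :- con (+ 22))) refl t δ g o ((t * o) ^ 8))
          in δ∉tO (B-neg (B-+ (B-* O-δ (B-* Oo Og)) (B-* (B-* (B-ι (+ 2)) (B-^ 2 Oo)) (B-* Oo (B-^ 7 Ox)))))
               (lc₁ 1# (cancelˡ (*-≉0 t≉0 t≉0) E≈0)
                 (solve 5 (λ t δ g o x⁷ →
                    δ :- t :* (:- (δ :* (o :* g) :+ con (+ 2) :* o :^ 2 :* (o :* x⁷))) :=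
                    con (+ 1) :* (δ :* (con (+ 1) :+ t :* o :* g) :+ con (+ 2) :* o :^ 2 :* (t :* o :* x⁷) :- con (+ 0)))
                    refl t δ g o ((t * o) ^ 7)))
          where
          x = t * o
          Ox : O x
          Ox = B-* O-t Oo
          g = ι (+ 5) + x * (ι (+ 15) + x * (ι (+ 30) + x * (ι (+ 42) + x * (ι (+ 42) + x * (ι (+ 30) +
                x * (ι (+ 15) + x * (ι (+ 5) + x)))))))
          step : ∀ i {y} → O y → O (ι i + x * y)
          step i Oy = B-+ (B-ι i) (B-* Ox Oy)
          Og : O g
          Og = step (+ 5) (step (+ 15) (step (+ 30) (step (+ 42) (step (+ 42) (step (+ 30) (step (+ 15) (B-+ (B-ι (+ 5)) Ox)))))))

      -- If m = 11q, then z^q is again 1 modulo t and its eleventh power is 1, so z^q = 1 and m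
      -- decreases. If 11 does not divide m, then zᵐ - 1 is z - 1 times an element m + t(...), which
      -- cannot vanish.
      torsion-free : ∀ m → ¬ m ≡ 0 → ∀ {z o} → O o → z ≈ 1# + t * o → z ^ m ≈ 1# → z ≈ 1#
      torsion-free = <-rec _ go
        where
        go : ∀ m → (∀ {k} → k ℕ.< m → ¬ k ≡ 0 → ∀ {z o} → O o → z ≈ 1# + t * o → z ^ k ≈ 1# → z ≈ 1#) →
             ¬ m ≡ 0 → ∀ {z o} → O o → z ≈ 1# + t * o → z ^ m ≈ 1# → z ≈ 1#
        go m rec m≢0 {z} {o} Oo z≈ zᵐ≈1 = stable λ z≉1 → contra z≉1 (11 ℕD.∣? m)
          where
          contra : ¬ z ≈ 1# → Dec (11 ℕD.∣ m) → ⊥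
          contra z≉1 (yes (ℕD.divides q m≡q*11)) = z≉1 (rec q<m q≢0 Oo z≈ zq≈1)
            where
            q≢0 : ¬ q ≡ 0
            q≢0 q≡0 = m≢0 (≡.trans m≡q*11 (≡.cong (ℕ._* 11) q≡0))
            q<m : q ℕ.< m
            q<m = ≡.subst (q ℕ.<_) (≡.sym m≡q*11)
              (ℕP.m<m*n q 11 {{ℕ.≢-nonZero q≢0}} (s≤s (s≤s z≤n)))
            zq≈1 : z ^ q ≈ 1#
            zq≈1 =
              let (b , Ob , e) = binomial₁ (B-* O-t Oo) q
              in eleventh-root (B-* Oo Ob)
                   (trans (^-congˡ q z≈) (trans e (+-congˡ (*-assoc t o b))))
                   (trans (^-assocʳ z q 11) (trans (^-congʳ z (≡.sym m≡q*11)) zᵐ≈1))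
          contra z≉1 (no 11∤m) =
            let (b , Ob , e) = binomial₂ (B-* O-t Oo) m
                x≉0 : ¬ t * o ≈ 0#
                x≉0 x≈0 = z≉1 (trans z≈ (trans (+-congˡ x≈0) (+-identityʳ 1#)))
            in coprime-case 11∤m (B-* Oo Ob) (cancelˡ x≉0 (begin
                 t * o * (ι (+ m) + t * (o * b))
                   ≈⟨ solve 4 (λ t o m b → t :* o :* (m :+ t :* (o :* b)) :=
                        (con (+ 1) :+ m :* (t :* o) :+ t :* o :* (t :* o) :* b) :- con (+ 1)) refl t o (ι (+ m)) b ⟩
                 (1# + ι (+ m) * (t * o) + t * o * (t * o) * b) - 1#
                   ≈⟨ x≈y⇒x-y≈0 (trans (sym e) (trans (^-congˡ m (sym z≈)) zᵐ≈1)) ⟩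
                 0# ∎))

  -- The rings generated by the roots of P, and Vieta's relations.

  module TribonacciField where

    open Field public

    Root : Carrier → Set ℓ
    Root x = x * x * x ≈ x * x + x + 1#

    -- The inverse of a root of P as a polynomial in it, so that negative powers stay in ℤ[λ].
    κ : Carrier → Carrier
    κ x = x * x - x - 1#

    κ-inverse : ∀ {x} → Root x → x * κ x ≈ 1#
    κ-inverse {x} r = lc₁ 1# r (solve 1 (λ x → x :* (x :* x :- x :- con (+ 1)) :- con (+ 1) :=
      con (+ 1) :* (x :* x :* x :- (x :* x :+ x :+ con (+ 1)))) refl x)

    ev : Carrier → ℤ → ℤ → ℤ → Carrier
    ev x a b c = ι a + ι b * x + ι c * (x * x)

    private
      N~ : ∀ a b c → NormForm.N a b c ~
           (ι a * (ι a * ι a + ι a * ι b + ι (+ 3) * ι a * ι c - ι b * ι b - ι (+ 4) * ι b * ι c - ι c * ι c)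
             + ι b * (ι b * ι b + ι b * ι c - ι c * ι c) + ι c * (ι c * ι c))
      N~ a b c = A ⊗ (A ⊗ A ⊕ A ⊗ B ⊕ ⌜ + 3 ⌝ ⊗ A ⊗ C ⊝ B ⊗ B ⊝ ⌜ + 4 ⌝ ⊗ B ⊗ C ⊝ C ⊗ C)
                 ⊕ B ⊗ (B ⊗ B ⊕ B ⊗ C ⊝ C ⊗ C) ⊕ C ⊗ (C ⊗ C)
        where
        A = ⌜ a ⌝
        B = ⌜ b ⌝
        C = ⌜ c ⌝

    module _ {x : Carrier} (root : Root x) where

      -- The norm is a multiple of a + bx + cx².
      independent : ∀ a b c → ev x a b c ≈ 0# → a ≡ + 0 × b ≡ + 0 × c ≡ + 0
      independent a b c e = NormForm.N≡0⇒ a b c (ι≈0⇒≡0 (NormForm.N a b c) (trans (ι≈ (N~ a b c)) (adjugate (ι a) (ι b) (ι c) e)))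
        where
        adjugate : ∀ a b c → a + b * x + c * (x * x) ≈ 0# →
          a * (a * a + a * b + ι (+ 3) * a * c - b * b - ι (+ 4) * b * c - c * c)
             + b * (b * b + b * c - c * c) + c * (c * c) ≈ 0#
        adjugate a b c e = lc₂ (A₀ + A₁ * x + A₂ * (x * x)) (- (c * A₂ * x + (c * A₁ + b * A₂ + c * A₂))) e root
          (solve 4 (λ x a b c →
            let A₀ = a :* a :+ a :* b :+ con (+ 3) :* a :* c :- b :* b :- con (+ 2) :* b :* c
                A₁ = con (+ 2) :* c :* c :- a :* b :- b :* b :- b :* c
                A₂ = b :* b :+ b :* c :- a :* c :- c :* c in
            (a :* (a :* a :+ a :* b :+ con (+ 3) :* a :* c :- b :* b :- con (+ 4) :* b :* c :- c :* c)
             :+ b :* (b :* b :+ b :* c :- c :* c) :+ c :* (c :* c)) :- con (+ 0) :=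
            (A₀ :+ A₁ :* x :+ A₂ :* (x :* x)) :* (a :+ b :* x :+ c :* (x :* x) :- con (+ 0)) :+
            (:- (c :* A₂ :* x :+ (c :* A₁ :+ b :* A₂ :+ c :* A₂))) :* (x :* x :* x :- (x :* x :+ x :+ con (+ 1))))
            refl x a b c)
          where
          A₀ = a * a + a * b + ι (+ 3) * a * c - b * b - ι (+ 2) * b * c
          A₁ = ι (+ 2) * c * c - a * b - b * b - b * c
          A₂ = b * b + b * c - a * c - c * c

    record Λ (x r : Carrier) : Set ℓ where
      constructor coords
      field
        c₀ c₁ c₂ : ℤ
        value    : r ≈ ev x c₀ c₁ c₂

    module _ {x : Carrier} (root : Root x) where
      open IsSubring

      private
        Λ-+ : ∀ {r s} → Λ x r → Λ x s → Λ x (r + s)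
        Λ-+ (coords a b c p) (coords a′ b′ c′ q) = coords (a ℤ.+ a′) (b ℤ.+ b′) (c ℤ.+ c′) (begin
          _ ≈⟨ +-cong p q ⟩
          ev x a b c + ev x a′ b′ c′
            ≈⟨ regroup x (ι a) (ι b) (ι c) (ι a′) (ι b′) (ι c′) ⟩
          (ι a + ι a′) + (ι b + ι b′) * x + (ι c + ι c′) * (x * x)
            ≈⟨ sym (+-cong (+-cong (ι-+ a a′) (*-congʳ (ι-+ b b′))) (*-congʳ (ι-+ c c′))) ⟩
          ev x (a ℤ.+ a′) (b ℤ.+ b′) (c ℤ.+ c′) ∎)
          where
          regroup : ∀ x a b c a′ b′ c′ → (a + b * x + c * (x * x)) + (a′ + b′ * x + c′ * (x * x)) ≈
                    (a + a′) + (b + b′) * x + (c + c′) * (x * x)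
          regroup x a b c a′ b′ c′ = begin
            (a + b * x + c * (x * x)) + (a′ + b′ * x + c′ * (x * x))
              ≈⟨ solve 6 (λ a B C a′ B′ C′ → (a :+ B :+ C) :+ (a′ :+ B′ :+ C′) := (a :+ a′) :+ (B :+ B′) :+ (C :+ C′))
                   refl a (b * x) (c * (x * x)) a′ (b′ * x) (c′ * (x * x)) ⟩
            (a + a′) + (b * x + b′ * x) + (c * (x * x) + c′ * (x * x))
              ≈⟨ sym (+-cong (+-congˡ (distribʳ x b b′)) (distribʳ (x * x) c c′)) ⟩
            (a + a′) + (b + b′) * x + (c + c′) * (x * x) ∎

        Λ-scale : ∀ i {r} → Λ x r → Λ x (ι i * r)
        Λ-scale i (coords a b c p) = coords (i ℤ.* a) (i ℤ.* b) (i ℤ.* c) (begin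
          _ ≈⟨ *-congˡ p ⟩
          ι i * ev x a b c
            ≈⟨ solve 5 (λ x i a b c → i :* (a :+ b :* x :+ c :* (x :* x)) :=
                 i :* a :+ i :* b :* x :+ i :* c :* (x :* x)) refl x (ι i) (ι a) (ι b) (ι c) ⟩
          ι i * ι a + ι i * ι b * x + ι i * ι c * (x * x)
            ≈⟨ sym (+-cong (+-cong (ι-* i a) (*-congʳ (ι-* i b))) (*-congʳ (ι-* i c))) ⟩
          ev x (i ℤ.* a) (i ℤ.* b) (i ℤ.* c) ∎)

        Λ-shift : ∀ {r} → Λ x r → Λ x (x * r)
        Λ-shift (coords a b c p) = coords c (a ℤ.+ c) (b ℤ.+ c) (begin
          _ ≈⟨ *-congˡ p ⟩
          x * ev x a b c
            ≈⟨ lc₁ (ι c) root (solve 4 (λ x a b c →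
                 x :* (a :+ b :* x :+ c :* (x :* x)) :- (c :+ (a :+ c) :* x :+ (b :+ c) :* (x :* x)) :=
                 c :* (x :* x :* x :- (x :* x :+ x :+ con (+ 1)))) refl x (ι a) (ι b) (ι c)) ⟩
          ι c + (ι a + ι c) * x + (ι b + ι c) * (x * x)
            ≈⟨ sym (+-cong (+-congˡ (*-congʳ (ι-+ a c))) (*-congʳ (ι-+ b c))) ⟩
          ev x c (a ℤ.+ c) (b ℤ.+ c) ∎)

        Λ-resp : ∀ {r s} → r ≈ s → Λ x r → Λ x s
        Λ-resp e (coords a b c p) = coords a b c (trans (sym e) p)

        Λ-ι : ∀ i → Λ x (ι i)
        Λ-ι i = coords i (+ 0) (+ 0)
          (solve 2 (λ x i → i := i :+ con (+ 0) :* x :+ con (+ 0) :* (x :* x)) refl x (ι i))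

      Λ-isSubring : IsSubring (Λ x)
      Λ-isSubring .B-resp = Λ-resp
      Λ-isSubring .B-+ = Λ-+
      Λ-isSubring .B-* {_} {s} (coords a b c p) q = Λ-resp
        (sym (trans (*-congʳ p) (solve 5 (λ x a b c s → (a :+ b :* x :+ c :* (x :* x)) :* s :=
          a :* s :+ b :* (x :* s) :+ c :* (x :* (x :* s))) refl x (ι a) (ι b) (ι c) s)))
        (Λ-+ (Λ-+ (Λ-scale a q) (Λ-scale b (Λ-shift q))) (Λ-scale c (Λ-shift (Λ-shift q))))
      Λ-isSubring .B-neg {r} q = Λ-resp (solve 1 (λ r → con (ℤ.- (+ 1)) :* r := :- r) refl r) (Λ-scale (ℤ.- (+ 1)) q)
      Λ-isSubring .B-0 = Λ-ι (+ 0)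
      Λ-isSubring .B-1 = Λ-ι (+ 1)

      Λ-x : Λ x x
      Λ-x = coords (+ 0) (+ 1) (+ 0)
          (solve 1 (λ x → x := con (+ 0) :+ con (+ 1) :* x :+ con (+ 0) :* (x :* x)) refl x)

    -- ℤ[1/2][x], given by a power of 2 that clears the denominator. Only 8 times the slope of a
    -- line is visibly integral; and with 2 inverted, 11 is the only prime left in the discriminant
    -- -44.
    Λ₂ : Carrier → Carrier → Set ℓ
    Λ₂ x r = ∃ λ k → Λ x (ι (+ 2) ^ k * r)

    half : Carrier
    half = inv (ι (+ 2))

    2*half : ι (+ 2) * half ≈ 1#
    2*half = inverseʳ (ι (+ 2)) (ι≉0 (+ 2) λ ())

    module _ {x : Carrier} (root : Root x) where
      open IsSubring
      private
        module S = IsSubring (Λ-isSubring root)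
        2^∈ : ∀ k → Λ x (ι (+ 2) ^ k)
        2^∈ k = S.B-^ k (S.B-ι (+ 2))

      Λ⊂Λ₂ : ∀ {r} → Λ x r → Λ₂ x r
      Λ⊂Λ₂ q = 0 , S.B-resp (sym (*-identityˡ _)) q

      Λ₂-isSubring : IsSubring (Λ₂ x)
      Λ₂-isSubring .B-resp e (k , q) = k , S.B-resp (*-congˡ e) q
      Λ₂-isSubring .B-+ {r} {s} (k , p) (j , q) = k ℕ.+ j , S.B-resp
        (trans (solve 4 (λ K J r s → J :* (K :* r) :+ K :* (J :* s) := (K :* J) :* (r :+ s))
                 refl (ι (+ 2) ^ k) (ι (+ 2) ^ j) r s)
               (*-congʳ (sym (^-homo-* (ι (+ 2)) k j))))
        (S.B-+ (S.B-* (2^∈ j) p) (S.B-* (2^∈ k) q))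
      Λ₂-isSubring .B-* {r} {s} (k , p) (j , q) = k ℕ.+ j , S.B-resp
        (trans (solve 4 (λ K J r s → (K :* r) :* (J :* s) := (K :* J) :* (r :* s))
                 refl (ι (+ 2) ^ k) (ι (+ 2) ^ j) r s)
               (*-congʳ (sym (^-homo-* (ι (+ 2)) k j))))
        (S.B-* p q)
      Λ₂-isSubring .B-neg {r} (k , p) = k , S.B-resp (-‿distribʳ-* _ r) (S.B-neg p)
      Λ₂-isSubring .B-0 = Λ⊂Λ₂ S.B-0
      Λ₂-isSubring .B-1 = Λ⊂Λ₂ S.B-1

      Λ₂-half : Λ₂ x half
      Λ₂-half = 1 , S.B-resp (sym (trans (*-congʳ (*-identityʳ _)) 2*half)) S.B-1

    record Roots (l₁ l₂ l₃ : Carrier) : Set ℓ where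
      field
        root₁ : Root l₁
        root₂ : Root l₂
        root₃ : Root l₃
        l₁≉l₂ : ¬ l₁ ≈ l₂
        l₁≉l₃ : ¬ l₁ ≈ l₃
        l₂≉l₃ : ¬ l₂ ≈ l₃

      private
        quadratic : ∀ {a b} → ¬ a ≈ b → Root a → Root b → a * a + a * b + b * b - a - b - 1# ≈ 0#
        quadratic {a} {b} a≉b p q = cancelˡ {a - b} (λ e → a≉b (x-y≈0⇒x≈y e))
          (lc₂ 1# (- 1#) p q (solve 2 (λ a b →
            (a :- b) :* (a :* a :+ a :* b :+ b :* b :- a :- b :- con (+ 1)) :- con (+ 0) :=
            con (+ 1) :* (a :* a :* a :- (a :* a :+ a :+ con (+ 1))) :+
            (:- con (+ 1)) :* (b :* b :* b :- (b :* b :+ b :+ con (+ 1)))) refl a b))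

      e₁ : l₁ + l₂ + l₃ ≈ 1#
      e₁ = x-y≈0⇒x≈y (cancelˡ {l₂ - l₃} (λ e → l₂≉l₃ (x-y≈0⇒x≈y e))
        (lc₂ 1# (- 1#) (quadratic l₁≉l₂ root₁ root₂) (quadratic l₁≉l₃ root₁ root₃)
          (solve 3 (λ a b c → (b :- c) :* (a :+ b :+ c :- con (+ 1)) :- con (+ 0) :=
            con (+ 1) :* (a :* a :+ a :* b :+ b :* b :- a :- b :- con (+ 1) :- con (+ 0)) :+
            (:- con (+ 1)) :* (a :* a :+ a :* c :+ c :* c :- a :- c :- con (+ 1) :- con (+ 0))) refl l₁ l₂ l₃)))

      e₂ : l₁ * l₂ + l₁ * l₃ + l₂ * l₃ ≈ - 1#
      e₂ = lc₂ (l₁ + l₂) (- 1#) e₁ (quadratic l₁≉l₂ root₁ root₂)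
        (solve 3 (λ a b c → (a :* b :+ a :* c :+ b :* c) :- (:- con (+ 1)) :=
          (a :+ b) :* (a :+ b :+ c :- con (+ 1)) :+
          (:- con (+ 1)) :* (a :* a :+ a :* b :+ b :* b :- a :- b :- con (+ 1) :- con (+ 0))) refl l₁ l₂ l₃)

      l₂l₃≈κ : l₂ * l₃ ≈ κ l₁
      l₂l₃≈κ = lc₂ (- l₁) 1# e₁ e₂
        (solve 3 (λ a b c → b :* c :- (a :* a :- a :- con (+ 1)) :=
          :- a :* (a :+ b :+ c :- con (+ 1)) :+
          con (+ 1) :* (a :* b :+ a :* c :+ b :* c :- (:- con (+ 1)))) refl l₁ l₂ l₃)

      e₃ : l₁ * l₂ * l₃ ≈ 1#
      e₃ = trans (*-assoc l₁ l₂ l₃) (trans (*-congˡ l₂l₃≈κ) (κ-inverse root₁))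

      t : Carrier
      t = l₂ - l₃

      -- The square of t, which is symmetric in l₂ and l₃ and so lies in ℤ[l₁]. Its norm is the
      -- discriminant -44 of P.
      D : Carrier
      D = ι (+ 5) + ι (+ 2) * l₁ - ι (+ 3) * (l₁ * l₁)

      t²≈D : t * t ≈ D
      t²≈D = lc₂ (l₂ + l₃ + 1# - l₁) (- ι (+ 4)) e₁ l₂l₃≈κ
        (solve 3 (λ a b c → (b :- c) :* (b :- c) :- (con (+ 5) :+ con (+ 2) :* a :- con (+ 3) :* (a :* a)) :=
          (b :+ c :+ con (+ 1) :- a) :* (a :+ b :+ c :- con (+ 1)) :+
          (:- con (+ 4)) :* (b :* c :- (a :* a :- a :- con (+ 1)))) refl l₁ l₂ l₃)

    rotate : ∀ {l₁ l₂ l₃} → Roots l₁ l₂ l₃ → Roots l₂ l₃ l₁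
    rotate r = record
      { root₁ = root₂ ; root₂ = root₃ ; root₃ = root₁
      ; l₁≉l₂ = l₂≉l₃ ; l₁≉l₃ = λ e → l₁≉l₂ (sym e) ; l₂≉l₃ = λ e → l₁≉l₃ (sym e) }
      where open Roots r

    P≈0⇒Root : ∀ {x} → Defs.P R x ≈ 0# → Root x
    P≈0⇒Root {x} e = lc₁ 1# e (solve 1 (λ x → x :* x :* x :- (x :* x :+ x :+ con (+ 1)) :=
      con (+ 1) :* (x :^ 3 :- x :^ 2 :- x :- con (+ 1) :- con (+ 0))) refl x)

    toRoots : ∀ {l₁ l₂ l₃} → AreTribRoots R l₁ l₂ l₃ → Roots l₁ l₂ l₃
    toRoots (p₁ , p₂ , p₃ , n₁₂ , n₁₃ , n₂₃) = record
      { root₁ = P≈0⇒Root p₁ ; root₂ = P≈0⇒Root p₂ ; root₃ = P≈0⇒Root p₃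
      ; l₁≉l₂ = n₁₂ ; l₁≉l₃ = n₁₃ ; l₂≉l₃ = n₂₃ }

    P′≈ : ∀ {l₁ l₂ l₃} → Roots l₁ l₂ l₃ → P′ R l₁ ≈ (l₁ - l₂) * (l₁ - l₃)
    P′≈ {l₁} {l₂} {l₃} r = trans
      (+-congʳ (+-cong (*-congʳ (natCast≈ι 3)) (-‿cong (*-congʳ (natCast≈ι 2)))))
      (lc₂ l₁ (- 1#) e₁ l₂l₃≈κ (solve 3 (λ a b c → (con (+ 3) :* a :^ 2 :- con (+ 2) :* a :- con (+ 1)) :- (a :- b) :* (a :- c) :=
        a :* (a :+ b :+ c :- con (+ 1)) :+ (:- con (+ 1)) :* (b :* c :- (a :* a :- a :- con (+ 1)))) refl l₁ l₂ l₃))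
      where open Roots r

    -- The determinant of the points (lᵢ , yᵢ), up to sign.
    weighted-sum : ∀ {l₁ l₂ l₃} → Roots l₁ l₂ l₃ → ∀ y₁ y₂ y₃ →
      (l₁ - l₂) * (l₁ - l₃) * (l₂ - l₃) * (y₁ * inv (P′ R l₁) + y₂ * inv (P′ R l₂) + y₃ * inv (P′ R l₃)) ≈
      y₁ * (l₂ - l₃) + y₂ * (l₃ - l₁) + y₃ * (l₁ - l₂)
    weighted-sum {l₁} {l₂} {l₃} roots y₁ y₂ y₃ = begin
      (l₁ - l₂) * (l₁ - l₃) * (l₂ - l₃) * (y₁ * inv (P′ R l₁) + y₂ * inv (P′ R l₂) + y₃ * inv (P′ R l₃))
        ≈⟨ solve 6 (λ a b c x y z → (a :- b) :* (a :- c) :* (b :- c) :* (x :+ y :+ z) :=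
             (a :- b) :* (a :- c) :* (b :- c) :* x :+ (b :- c) :* (b :- a) :* (c :- a) :* y :+
             (c :- a) :* (c :- b) :* (a :- b) :* z) refl l₁ l₂ l₃
             (y₁ * inv (P′ R l₁)) (y₂ * inv (P′ R l₂)) (y₃ * inv (P′ R l₃)) ⟩
      (l₁ - l₂) * (l₁ - l₃) * (l₂ - l₃) * (y₁ * inv (P′ R l₁)) + (l₂ - l₃) * (l₂ - l₁) * (l₃ - l₁) * (y₂ * inv (P′ R l₂))
        + (l₃ - l₁) * (l₃ - l₂) * (l₁ - l₂) * (y₃ * inv (P′ R l₃))
        ≈⟨ +-cong (+-cong (weight roots y₁ (l₂ - l₃)) (weight (rotate roots) y₂ (l₃ - l₁)))
             (weight (rotate (rotate roots)) y₃ (l₁ - l₂)) ⟩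
      y₁ * (l₂ - l₃) + y₂ * (l₃ - l₁) + y₃ * (l₁ - l₂) ∎
      where
      weight : ∀ {a b c} (r : Roots a b c) y w → (a - b) * (a - c) * w * (y * inv (P′ R a)) ≈ y * w
      weight {a} {b} {c} r y w = begin
        (a - b) * (a - c) * w * (y * inv (P′ R a))
          ≈⟨ solve 4 (λ p w y i → p :* w :* (y :* i) := y :* (p :* i :* w)) refl ((a - b) * (a - c)) w y (inv (P′ R a)) ⟩
        y * ((a - b) * (a - c) * inv (P′ R a) * w)
          ≈⟨ *-congˡ (*-congʳ (trans (*-congʳ (sym (P′≈ r))) (inverseʳ (P′ R a) P′≉0))) ⟩
        y * (1# * w)
          ≈⟨ *-congˡ (*-identityˡ w) ⟩
        y * w ∎
        where
        P′≉0 : ¬ P′ R a ≈ 0#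
        P′≉0 z = *-≉0 (λ e → Roots.l₁≉l₂ r (x-y≈0⇒x≈y e)) (λ e → Roots.l₁≉l₃ r (x-y≈0⇒x≈y e)) (trans (sym (P′≈ r)) z)

  -- Skolem's method for the coefficient of λ².

  module Zeros where

    open TribonacciField
    open Coordinates

    evT : Carrier → Triple → Carrier
    evT l (triple a b c) = ev l a b c

    module OverRoot {l : Carrier} (root : Root l) where
      open IsSubring (Λ-isSubring root)

      evT-shift : ∀ e → l * evT l e ≈ evT l (shift e)
      evT-shift (triple a b c) = trans (begin
        l * ev l a b c
          ≈⟨ lc₁ (ι c) root (solve 4 (λ x a b c →
               x :* (a :+ b :* x :+ c :* (x :* x)) :- (c :+ (a :+ c) :* x :+ (b :+ c) :* (x :* x)) :=
               c :* (x :* x :* x :- (x :* x :+ x :+ con (+ 1)))) refl l (ι a) (ι b) (ι c)) ⟩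
        ι c + (ι a + ι c) * l + (ι b + ι c) * (l * l)
          ≈⟨ sym (+-cong (+-congˡ (*-congʳ (ι-+ a c))) (*-congʳ (ι-+ b c))) ⟩
        ev l c (a ℤ.+ c) (b ℤ.+ c) ∎)
        (reflexive (≡.cong (evT l) (≡.sym (shift-≡ a b c))))

      evT-unshift : ∀ e → κ l * evT l e ≈ evT l (unshift e)
      evT-unshift (triple a b c) = trans (begin
        κ l * ev l a b c
          ≈⟨ lc₁ (ι b + ι c * l) root (solve 4 (λ x a b c →
               (x :* x :- x :- con (+ 1)) :* (a :+ b :* x :+ c :* (x :* x)) :- ((b :- a) :+ (c :- a) :* x :+ a :* (x :* x)) :=
               (b :+ c :* x) :* (x :* x :* x :- (x :* x :+ x :+ con (+ 1)))) refl l (ι a) (ι b) (ι c)) ⟩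
        (ι b - ι a) + (ι c - ι a) * l + ι a * (l * l)
          ≈⟨ sym (+-congʳ (+-cong (ι≈ (⌜ b ⌝ ⊝ ⌜ a ⌝)) (*-congʳ (ι≈ (⌜ c ⌝ ⊝ ⌜ a ⌝))))) ⟩
        ev l (b ℤ.- a) (c ℤ.- a) a ∎)
        (reflexive (≡.cong (evT l) (≡.sym (unshift-≡ a b c))))

      private
        iterate-ev : ∀ {x} f → (∀ e → x * evT l e ≈ evT l (f e)) → ∀ n e → x ^ n * evT l e ≈ evT l (iterate f n e)
        iterate-ev f h zero    e = *-identityˡ _
        iterate-ev {x} f h (suc n) e = trans (*-assoc x (x ^ n) (evT l e))
          (trans (*-congˡ (iterate-ev f h n e)) (h (iterate f n e)))

      evT-act : ∀ k e → zp l (κ l) k * evT l e ≈ evT l (act k e)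
      evT-act (+ n)    e = iterate-ev shift evT-shift n e
      evT-act -[1+ n ] e = iterate-ev unshift evT-unshift (suc n) e

      evT-1 : evT l 1ᵀ ≈ 1#
      evT-1 = solve 1 (λ x → con (+ 1) :+ con (+ 0) :* x :+ con (+ 0) :* (x :* x) := con (+ 1)) refl l

      evT-1+X : evT l 1+Xᵀ ≈ 1# + l
      evT-1+X = solve 1 (λ x → con (+ 1) :+ con (+ 1) :* x :+ con (+ 0) :* (x :* x) := con (+ 1) :+ x) refl l

      -- Only the coefficient of l² appears as an index: its vanishing is what collinearity gives,
      -- and indexing by it makes the arithmetic of these coefficients a matter of types. The other
      -- two coordinates are existential.
      record Has (r : Carrier) (k : ℤ) : Set ℓ where
        constructor has
        field
          a b : ℤ
          value≈ : r ≈ ev l a b k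

      has-evT : ∀ e → Has (evT l e) (c₂ e)
      has-evT (triple a b c) = has a b refl

      has-resp : ∀ {r s k} → r ≈ s → Has r k → Has s k
      has-resp e (has a b p) = has a b (trans (sym e) p)

      has-+ : ∀ {r s k j} → Has r k → Has s j → Has (r + s) (k ℤ.+ j)
      has-+ {k = k} {j} (has a b p) (has a′ b′ q) = has (a ℤ.+ a′) (b ℤ.+ b′) (begin
        _ ≈⟨ +-cong p q ⟩
        ev l a b k + ev l a′ b′ j
          ≈⟨ regroup (ι a) (ι b) (ι k) (ι a′) (ι b′) (ι j) ⟩
        (ι a + ι a′) + (ι b + ι b′) * l + (ι k + ι j) * (l * l)
          ≈⟨ sym (+-cong (+-cong (ι-+ a a′) (*-congʳ (ι-+ b b′))) (*-congʳ (ι-+ k j))) ⟩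
        ev l (a ℤ.+ a′) (b ℤ.+ b′) (k ℤ.+ j) ∎)
        where
        regroup : ∀ a b c a′ b′ c′ → (a + b * l + c * (l * l)) + (a′ + b′ * l + c′ * (l * l)) ≈
                  (a + a′) + (b + b′) * l + (c + c′) * (l * l)
        regroup a b c a′ b′ c′ = trans
          (solve 6 (λ a B C a′ B′ C′ → (a :+ B :+ C) :+ (a′ :+ B′ :+ C′) := (a :+ a′) :+ (B :+ B′) :+ (C :+ C′))
            refl a (b * l) (c * (l * l)) a′ (b′ * l) (c′ * (l * l)))
          (sym (+-cong (+-congˡ (distribʳ l b b′)) (distribʳ (l * l) c c′)))

      has-scale : ∀ i {r k} → Has r k → Has (ι i * r) (i ℤ.* k)
      has-scale i {k = k} (has a b p) = has (i ℤ.* a) (i ℤ.* b) (begin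
        _ ≈⟨ *-congˡ p ⟩
        ι i * ev l a b k
          ≈⟨ solve 5 (λ x i a b c → i :* (a :+ b :* x :+ c :* (x :* x)) :=
               i :* a :+ i :* b :* x :+ i :* c :* (x :* x)) refl l (ι i) (ι a) (ι b) (ι k) ⟩
        ι i * ι a + ι i * ι b * l + ι i * ι k * (l * l)
          ≈⟨ sym (+-cong (+-cong (ι-* i a) (*-congʳ (ι-* i b))) (*-congʳ (ι-* i k))) ⟩
        ev l (i ℤ.* a) (i ℤ.* b) (i ℤ.* k) ∎)

      has-Λ : ∀ {r} → Λ l r → ∃ (Has r)
      has-Λ (coords a b c p) = c , has a b p

      has-unique : ∀ {r k j} → Has r k → Has r j → k ≡ j
      has-unique {r} {k} {j} h h′ =
        let has a b e = has-+ h (has-scale (ℤ.- + 1) h′)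
            (_ , _ , z) = independent root a b (k ℤ.+ (ℤ.- + 1) ℤ.* j)
              (trans (sym e) (solve 1 (λ r → r :+ con (ℤ.- + 1) :* r := con (+ 0)) refl r))
        in ℤP.i-j≡0⇒i≡j k j (≡.trans (≡.cong (λ x → k ℤ.+ x) (≡.sym (ℤP.-1*i≡-i j))) z)

      evT-shape : ∀ q G → evT l (1ᵀ +ᵀ q *ᵀ G) ≈ 1# + ι q * evT l G
      evT-shape q (triple a b c) = begin
        ι (+ 1 ℤ.+ q ℤ.* a) + ι (+ 0 ℤ.+ q ℤ.* b) * l + ι (+ 0 ℤ.+ q ℤ.* c) * (l * l)
          ≈⟨ +-cong (+-cong (ι≈ (⌜ + 1 ⌝ ⊕ ⌜ q ⌝ ⊗ ⌜ a ⌝)) (*-congʳ (ι≈ (⌜ + 0 ⌝ ⊕ ⌜ q ⌝ ⊗ ⌜ b ⌝))))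
               (*-congʳ (ι≈ (⌜ + 0 ⌝ ⊕ ⌜ q ⌝ ⊗ ⌜ c ⌝))) ⟩
        (1# + ι q * ι a) + (0# + ι q * ι b) * l + (0# + ι q * ι c) * (l * l)
          ≈⟨ solve 5 (λ x q a b c → (con (+ 1) :+ q :* a) :+ (con (+ 0) :+ q :* b) :* x :+ (con (+ 0) :+ q :* c) :* (x :* x) :=
               con (+ 1) :+ q :* (a :+ b :* x :+ c :* (x :* x))) refl l (ι q) (ι a) (ι b) (ι c) ⟩
        1# + ι q * ev l a b c ∎

      Λ-evT : ∀ e → Λ l (evT l e)
      Λ-evT (triple a b c) = coords a b c refl

      infixl 10 l^_
      l^_ : ℤ → Carrier
      l^ k = zp l (κ l) k

      Λ-l^ : ∀ k → Λ l (l^ k)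
      Λ-l^ k = B-resp (trans (sym (evT-act k 1ᵀ)) (trans (*-congˡ evT-1) (*-identityʳ _))) (Λ-evT (act k 1ᵀ))

      l^-shape : ∀ k q G → act k 1ᵀ ≡ 1ᵀ +ᵀ q *ᵀ G → l^ k ≈ 1# + ι q * evT l G
      l^-shape k q G e = begin
        l^ k                     ≈⟨ sym (*-identityʳ _) ⟩
        l^ k * 1#                ≈⟨ *-congˡ (sym evT-1) ⟩
        l^ k * evT l 1ᵀ          ≈⟨ evT-act k 1ᵀ ⟩
        evT l (act k 1ᵀ)         ≡⟨ ≡.cong (evT l) e ⟩
        evT l (1ᵀ +ᵀ q *ᵀ G)     ≈⟨ evT-shape q G ⟩
        1# + ι q * evT l G       ∎

      l^-* : ∀ M n → l^ (n ℤ.* + M) ≈ (l^ (ℤ.sign n ℤ.◃ M)) ^ ℤ.∣ n ∣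
      l^-* M (+ n) = trans (reflexive (≡.cong l^_ (ℤP.*-comm (+ n) (+ M))))
        (trans (zp-*ℕ (κ-inverse root) (+ M) n) (^-congˡ n (reflexive (≡.cong l^_ (≡.sym (ℤP.+◃n≡+n M))))))
      l^-* M -[1+ n ] = trans (reflexive (≡.cong l^_ sign-swap))
        (trans (zp-*ℕ (κ-inverse root) (ℤ.- + M) (suc n)) (^-congˡ (suc n) (reflexive (≡.cong l^_ (≡.sym (ℤP.-◃n≡-n M))))))
        where
        sign-swap : -[1+ n ] ℤ.* + M ≡ (ℤ.- + M) ℤ.* + suc n
        sign-swap = ≡.trans (≡.sym (ℤP.neg-distribˡ-* (+ suc n) (+ M)))
          (≡.trans (≡.cong ℤ.-_ (ℤP.*-comm (+ suc n) (+ M))) (ℤP.neg-distribˡ-* (+ M) (+ suc n)))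

      record Period (q M : ℕ) : Set ℓ where
        field
          G H : Triple
          forward  : l^ (Sign.+ ℤ.◃ M) ≈ 1# + ι (+ q) * evT l G
          backward : l^ (Sign.- ℤ.◃ M) ≈ 1# + ι (+ q) * evT l H

      -- l^(nM) is 1 modulo q in ℤ[l], for negative n by way of `H`. Hence the coefficients of l² at
      -- k and at the remainder of k modulo M are congruent modulo q.
      sieve : ∀ {q M} .{{_ : ℕ.NonZero M}} → Period q M → ∀ w k → Has (l^ k * evT l w) (+ 0) →
              + q ℤS.∣ c₂ (act (+ (k ℤ.%ℕ M)) w)
      sieve {q} {M} P w k h = ℤS.divides (ℤ.- proj₁ hs) (ℤP.i-j≡0⇒i≡j (c₂ (act (+ r) w)) (ℤ.- proj₁ hs ℤ.* + q)
          (≡.trans (≡.cong (λ z → c₂ (act (+ r) w) ℤ.- z) (swap (proj₁ hs) (+ q))) (≡.trans (minus-neg (c₂ (act (+ r) w)) _)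
          (≡.sym (has-unique h (has-resp (sym split) (has-+ (has-evT (act (+ r) w)) (has-scale (+ q) (proj₂ hs)))))))))
        where
        open Period P
        r = k ℤ.%ℕ M
        n = k ℤ./ℕ M
        swap : ∀ x y → ℤ.- x ℤ.* y ≡ ℤ.- (y ℤ.* x)
        swap x y = ≡.trans (≡.sym (ℤP.neg-distribˡ-* x y)) (≡.cong ℤ.-_ (ℤP.*-comm x y))
        minus-neg : ∀ x y → x ℤ.- (ℤ.- y) ≡ x ℤ.+ y
        minus-neg x y = ≡.cong (λ z → x ℤ.+ z) (ℤP.neg-involutive y)
        power : ∀ {Y} E m → Y ≈ 1# + ι (+ q) * evT l E → ∃ λ b → Λ l b × Y ^ m ≈ 1# + ι (+ q) * b
        power E m p =
          let (b , Λb , e) = binomial₁ (B-* (B-ι (+ q)) (Λ-evT E)) m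
          in evT l E * b , B-* (Λ-evT E) Λb , trans (^-congˡ m p) (trans e (+-congˡ (*-assoc _ _ b)))
        periodic : ∀ n → ∃ λ b → Λ l b × l^ (n ℤ.* + M) ≈ 1# + ι (+ q) * b
        periodic (+ m)    = let (b , Λb , e) = power G m forward in b , Λb , trans (l^-* M (+ m)) e
        periodic -[1+ m ] = let (b , Λb , e) = power H (suc m) backward in b , Λb , trans (l^-* M -[1+ m ]) e
        b  = proj₁ (periodic n)
        hs : ∃ (Has (l^ (+ r) * evT l w * b))
        hs = has-Λ (B-* (B-* (Λ-l^ (+ r)) (Λ-evT w)) (proj₁ (proj₂ (periodic n))))
        split : l^ k * evT l w ≈ evT l (act (+ r) w) + ι (+ q) * (l^ (+ r) * evT l w * b)
        split = begin
          l^ k * evT l w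
            ≡⟨ ≡.cong (λ i → l^ i * evT l w) (ℤD.a≡a%ℕn+[a/ℕn]*n k M) ⟩
          l^ (+ r ℤ.+ n ℤ.* + M) * evT l w
            ≈⟨ *-congʳ (zp-+ (κ-inverse root) (+ r) (n ℤ.* + M)) ⟩
          l^ (+ r) * l^ (n ℤ.* + M) * evT l w
            ≈⟨ *-congʳ (*-congˡ (proj₂ (proj₂ (periodic n)))) ⟩
          l^ (+ r) * (1# + ι (+ q) * b) * evT l w
            ≈⟨ solve 4 (λ x q b w → x :* (con (+ 1) :+ q :* b) :* w := x :* w :+ q :* (x :* w :* b))
                 refl (l^ (+ r)) (ι (+ q)) b (evT l w) ⟩
          l^ (+ r) * evT l w + ι (+ q) * (l^ (+ r) * evT l w * b)
            ≈⟨ +-congʳ (evT-act (+ r) w) ⟩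
          evT l (act (+ r) w) + ι (+ q) * (l^ (+ r) * evT l w * b) ∎

      -- The coefficient of X² in W Yⁿ is n pq·(coefficient in W G) modulo
      -- higher powers of p = 83.
      module Skolem {W G : Carrier} (ΛW : Λ l W) (ΛG : Λ l G) (W₀ : Has W (+ 0))
        {g : ℤ} (WG : Has (W * G) g) (83∤g : ¬ 83 ℕD.∣ ℤ.∣ g ∣) where

        -- The statement is general in q and Z so that the induction can replace n = 83m by m and Y
        -- by Y⁸³: then q becomes 83q and Z changes, while G, the derivative modulo 83, stays the
        -- same.
        Claim : ℕ → Set (c ⊔ ℓ)
        Claim n = ¬ n ≡ 0 → ∀ q → ¬ q ≡ + 0 → ∀ {Y Z} → Λ l Z →
          Y ≈ 1# + ι (+ 83) * ι q * (G + ι (+ 83) * Z) → ¬ Has (W * Y ^ n) (+ 0)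

        nonvanishing : ∀ n → Claim n
        nonvanishing = <-rec Claim step
          where
          step : ∀ n → (∀ {m} → m ℕ.< n → Claim m) → Claim n
          step n rec n≢0 q q≢0 {Y} {Z} ΛZ Y≈ h = descend (Divisibility.leading-term 83-prime n q g (proj₁ hz) (proj₁ he) q≢0 83∤g
              (has-unique h (has-resp (sym expand)
                (has-+ (has-+ (has-+ W₀ (has-scale (+ n ℤ.* (+ 83 ℤ.* q)) WG))
                  (has-scale (+ n ℤ.* (+ 83 ℤ.* q) ℤ.* + 83) (proj₂ hz)))
                  (has-scale ((+ 83 ℤ.* q) ℤ.* (+ 83 ℤ.* q)) (proj₂ he))))))
            where
            G′ = G + ι (+ 83) * Z
            x = ι (+ 83) * ι q * G′
            ΛG′ : Λ l G′
            ΛG′ = B-+ ΛG (B-* (B-ι (+ 83)) ΛZ)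
            Λx : Λ l x
            Λx = B-* (B-* (B-ι (+ 83)) (B-ι q)) ΛG′
            bin = binomial₂ Λx n
            b = proj₁ bin
            hz : ∃ (Has (W * Z))
            hz = has-Λ (B-* ΛW ΛZ)
            he : ∃ (Has (W * (G′ * G′ * b)))
            he = has-Λ (B-* ΛW (B-* (B-* ΛG′ ΛG′) (proj₁ (proj₂ bin))))
            p = ι (+ 83)
            Q = ι (+ 83) * ι q
            ~Q : (+ 83 ℤ.* q) ~ Q
            ~Q = ⌜ + 83 ⌝ ⊗ ⌜ q ⌝
            expand : W * Y ^ n ≈ W + ι (+ n ℤ.* (+ 83 ℤ.* q)) * (W * G) + ι (+ n ℤ.* (+ 83 ℤ.* q) ℤ.* + 83) * (W * Z)
                                  + ι ((+ 83 ℤ.* q) ℤ.* (+ 83 ℤ.* q)) * (W * (G′ * G′ * b))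
            expand = begin
              W * Y ^ n
                ≈⟨ *-congˡ (trans (^-congˡ n Y≈) (proj₂ (proj₂ bin))) ⟩
              W * (1# + ι (+ n) * x + x * x * b)
                ≈⟨ solve 5 (λ W n Q G′ b → W :* (con (+ 1) :+ n :* (Q :* G′) :+ (Q :* G′) :* (Q :* G′) :* b) :=
                     W :+ n :* Q :* (W :* G′) :+ Q :* Q :* (W :* (G′ :* G′ :* b))) refl W (ι (+ n)) Q G′ b ⟩
              W + ι (+ n) * Q * (W * G′) + Q * Q * (W * (G′ * G′ * b))
                ≈⟨ +-congʳ (solve 5 (λ W N p G Z → W :+ N :* (W :* (G :+ p :* Z)) :=
                     W :+ N :* (W :* G) :+ N :* p :* (W :* Z)) refl W (ι (+ n) * Q) p G Z) ⟩
              W + ι (+ n) * Q * (W * G) + ι (+ n) * Q * p * (W * Z) + Q * Q * (W * (G′ * G′ * b))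
                ≈⟨ sym (+-cong (+-cong (+-congˡ (*-congʳ (ι≈ (⌜ + n ⌝ ⊗ ~Q))))
                     (*-congʳ (ι≈ (⌜ + n ⌝ ⊗ ~Q ⊗ ⌜ + 83 ⌝)))) (*-congʳ (ι≈ (~Q ⊗ ~Q)))) ⟩
              W + ι (+ n ℤ.* (+ 83 ℤ.* q)) * (W * G) + ι (+ n ℤ.* (+ 83 ℤ.* q) ℤ.* + 83) * (W * Z)
                + ι ((+ 83 ℤ.* q) ℤ.* (+ 83 ℤ.* q)) * (W * (G′ * G′ * b)) ∎
            open Expansion (binomial Λx 83) renaming (rest to d; rest∈B to Λd; expand to Y⁸³)
            descend : 83 ℕD.∣ n → ⊥
            descend (ℕD.divides m n≡m*83) = rec m<n m≢0 (+ 83 ℤ.* q)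
              (λ e → q≢0 (ℤP.*-cancelˡ-≡ (+ 83) q (+ 0) e))
              {Y ^ 83} {Z + ι (+ 41) * ι q * (G′ * G′) + ι q * ι q * (G′ * G′ * G′ * d)}
              (B-+ (B-+ ΛZ (B-* (B-* (B-ι (+ 41)) (B-ι q)) (B-* ΛG′ ΛG′)))
                (B-* (B-* (B-ι q) (B-ι q)) (B-* (B-* (B-* ΛG′ ΛG′) ΛG′) Λd)))
              (begin
                Y ^ 83
                  ≈⟨ trans (^-congˡ 83 Y≈) Y⁸³ ⟩
                -- `triangle 83` is 41·83. Thanks to this extra factor 83 the quadratic term only
                -- alters Z; the cubic term does so because x contains 83.
                1# + p * x + ι (+ 41 ℤ.* + 83) * (x * x) + x * x * x * d
                  ≈⟨ +-congʳ (+-congˡ (*-congʳ (ι-* (+ 41) (+ 83)))) ⟩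
                1# + p * x + ι (+ 41) * p * (x * x) + x * x * x * d
                  ≈⟨ solve 5 (λ p f q G′ d → let x = p :* q :* G′ in
                       con (+ 1) :+ p :* x :+ f :* p :* (x :* x) :+ x :* x :* x :* d :=
                       con (+ 1) :+ p :* (p :* q) :* (G′ :+ p :*
                         (f :* q :* (G′ :* G′) :+ q :* q :* (G′ :* G′ :* G′ :* d)))) refl p (ι (+ 41)) (ι q) G′ d ⟩
                1# + p * (p * ι q) * (G′ + p * (ι (+ 41) * ι q * (G′ * G′) + ι q * ι q * (G′ * G′ * G′ * d)))
                  ≈⟨ +-congˡ (*-cong (*-congˡ (sym (ι-* (+ 83) q)))
                       (solve 5 (λ p G Z u v → G :+ p :* Z :+ p :* (u :+ v) := G :+ p :* (Z :+ u :+ v))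
                         refl p G Z (ι (+ 41) * ι q * (G′ * G′)) (ι q * ι q * (G′ * G′ * G′ * d)))) ⟩
                1# + p * ι (+ 83 ℤ.* q) * (G + p * (Z + ι (+ 41) * ι q * (G′ * G′) + ι q * ι q * (G′ * G′ * G′ * d))) ∎)
              (has-resp (*-congˡ (trans (^-congʳ Y (≡.trans n≡m*83 (ℕP.*-comm m 83))) (sym (^-assocʳ Y 83 m)))) h)
              where
              m≢0 : ¬ m ≡ 0
              m≢0 m≡0 = n≢0 (≡.trans n≡m*83 (≡.cong (ℕ._* 83) m≡0))
              m<n : m ℕ.< n
              m<n = ≡.subst (m ℕ.<_) (≡.sym n≡m*83) (ℕP.m<m*n m 83 {{ℕ.≢-nonZero m≢0}} (s≤s (s≤s z≤n)))

      period₈₃ : Period 83 287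
      period₈₃ = record
        { G = G₈₃ ; H = H₈₃
        ; forward  = l^-shape (+ 287) (+ 83) G₈₃ G₈₃-eq
        ; backward = l^-shape (ℤ.- + 287) (+ 83) H₈₃ H₈₃-eq }

      period₂₉ : Period 29 140
      period₂₉ = record
        { G = G₂₉ ; H = H₂₉
        ; forward  = l^-shape (+ 140) (+ 29) G₂₉ G₂₉-eq
        ; backward = l^-shape (ℤ.- + 140) (+ 29) H₂₉ H₂₉-eq }

      module Isolated {q M} (P : Period q M) (q≡83 : q ≡ 83) {w wG wH : Triple} (k₀ : ℤ)
        (wG≈ : evT l w * evT l (Period.G P) ≈ evT l wG) (wH≈ : evT l w * evT l (Period.H P) ≈ evT l wH)
        (regular : Regular w wG wH k₀) where
        open Period P
        open Σ regular using () renaming (proj₁ to zero₀)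
        open Σ (proj₂ regular) using () renaming (proj₁ to G∤; proj₂ to H∤)

        private
          W = l^ k₀ * evT l w
          ΛW : Λ l W
          ΛW = B-* (Λ-l^ k₀) (Λ-evT w)
          W₀ : Has W (+ 0)
          W₀ = has-resp (sym (evT-act k₀ w)) (≡.subst (Has _) zero₀ (has-evT (act k₀ w)))
          derivative : ∀ {E wE} → evT l w * evT l E ≈ evT l wE → Has (W * evT l E) (c₂ (act k₀ wE))
          derivative {wE = wE} e = has-resp
            (trans (sym (evT-act k₀ wE)) (trans (*-congˡ (sym e)) (sym (*-assoc _ _ _)))) (has-evT (act k₀ wE))
          initial : ∀ {Y E} → Y ≈ 1# + ι (+ q) * E → Y ≈ 1# + ι (+ 83) * ι (+ 1) * (E + ι (+ 83) * 0#)
          initial {Y} {E} e = trans e (trans (+-congˡ (*-congʳ (reflexive (≡.cong (λ n → ι (+ n)) q≡83))))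
            (solve 2 (λ p E → con (+ 1) :+ p :* E := con (+ 1) :+ p :* con (+ 1) :* (E :+ p :* con (+ 0))) refl (ι (+ 83)) E))
          split : ∀ n → l^ (k₀ ℤ.+ n ℤ.* + M) * evT l w ≈ W * (l^ (ℤ.sign n ℤ.◃ M)) ^ ℤ.∣ n ∣
          split n = trans (*-congʳ (trans (zp-+ (κ-inverse root) k₀ (n ℤ.* + M)) (*-congˡ (l^-* M n))))
            (solve 3 (λ a b c → (a :* b) :* c := (a :* c) :* b) refl (l^ k₀) _ (evT l w))

        -- l^(k₀ + nM) w is W Y^|n| with W = l^k₀ w and Y the M-th power of l or of its inverse,
        -- according to the sign of n. `Skolem` applies with q = 1 and Z = 0, so k₀ is the only zero
        -- in its residue class.
        isolated : ∀ n → Has (l^ (k₀ ℤ.+ n ℤ.* + M) * evT l w) (+ 0) → n ≡ + 0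
        isolated (+ zero)    _ = ≡.refl
        isolated (+ suc n)   h = ⊥-elim (Skolem.nonvanishing {W} {evT l G} ΛW (Λ-evT G) W₀ {c₂ (act k₀ wG)} (derivative {G} {wG} wG≈) G∤
          (suc n) (λ ()) (+ 1) (λ ()) {_} {0#} B-0 (initial {_} {evT l G} forward) (has-resp (split (+ suc n)) h))
        isolated -[1+ n ]    h = ⊥-elim (Skolem.nonvanishing {W} {evT l H} ΛW (Λ-evT H) W₀ {c₂ (act k₀ wH)} (derivative {H} {wH} wH≈) H∤
          (suc n) (λ ()) (+ 1) (λ ()) {_} {0#} B-0 (initial {_} {evT l H} backward) (has-resp (split -[1+ n ]) h))

      module IsoT (k₀ : ℤ) = Isolated period₈₃ ≡.refl {1ᵀ} {G₈₃} {H₈₃} k₀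
        (trans (*-congʳ evT-1) (*-identityˡ _)) (trans (*-congʳ evT-1) (*-identityˡ _))

      private
        1+X* : ∀ e → evT l 1+Xᵀ * evT l e ≈ evT l (e +ᵀ shift e)
        1+X* e = begin
          evT l 1+Xᵀ * evT l e              ≈⟨ *-congʳ evT-1+X ⟩
          (1# + l) * evT l e                ≈⟨ solve 2 (λ x e → (con (+ 1) :+ x) :* e := e :+ con (+ 1) :* (x :* e)) refl l (evT l e) ⟩
          evT l e + 1# * (l * evT l e)      ≈⟨ +-congˡ (trans (*-identityˡ _) (evT-shift e)) ⟩
          evT l e + evT l (shift e)         ≈⟨ add e (shift e) ⟩
          evT l (e +ᵀ shift e)              ∎
          where
          add : ∀ e f → evT l e + evT l f ≈ evT l (e +ᵀ f)
          add (triple a b c) (triple a′ b′ c′) = sym (begin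
            ev l (a ℤ.+ a′) (b ℤ.+ b′) (c ℤ.+ c′)
              ≈⟨ +-cong (+-cong (ι-+ a a′) (*-congʳ (ι-+ b b′))) (*-congʳ (ι-+ c c′)) ⟩
            (ι a + ι a′) + (ι b + ι b′) * l + (ι c + ι c′) * (l * l)
              ≈⟨ +-cong (+-congˡ (distribʳ l _ _)) (distribʳ (l * l) _ _) ⟩
            (ι a + ι a′) + (ι b * l + ι b′ * l) + (ι c * (l * l) + ι c′ * (l * l))
              ≈⟨ solve 6 (λ a B C a′ B′ C′ → (a :+ a′) :+ (B :+ B′) :+ (C :+ C′) := (a :+ B :+ C) :+ (a′ :+ B′ :+ C′))
                   refl (ι a) (ι b * l) (ι c * (l * l)) (ι a′) (ι b′ * l) (ι c′ * (l * l)) ⟩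
            ev l a b c + ev l a′ b′ c′ ∎)

      module IsoV (k₀ : ℤ) = Isolated period₈₃ ≡.refl {1+Xᵀ} {V₈₃} {V₈₃′} k₀
        (1+X* G₈₃) (1+X* H₈₃)

      private
        residue∈ : ∀ {q M w rs} .{{_ : ℕ.NonZero M}} → Period q M → residues q M w rs →
                   ∀ k → Has (l^ k * evT l w) (+ 0) → k ℤ.%ℕ M ∈ rs
        residue∈ {M = M} {w} {rs} P table k h = ≡.subst (_∈ rs) toℕ≡
          (table (fromℕ< (ℤD.n%ℕd<d k M)) (≡.subst (λ r → _ ℤS.∣ c₂ (act (+ r) w)) (≡.sym toℕ≡) (sieve P w k h)))
          where
          toℕ≡ : toℕ (fromℕ< (ℤD.n%ℕd<d k M)) ≡ k ℤ.%ℕ M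
          toℕ≡ = FP.toℕ-fromℕ< (ℤD.n%ℕd<d k M)

        quotient-form : ∀ k M .{{_ : ℕ.NonZero M}} {r} → k ℤ.%ℕ M ≡ r → k ≡ + r ℤ.+ (k ℤ./ℕ M) ℤ.* + M
        quotient-form k M e = ≡.trans (ℤD.a≡a%ℕn+[a/ℕn]*n k M) (≡.cong (λ r → + r ℤ.+ (k ℤ./ℕ M) ℤ.* + M) e)

        raise : ∀ r k₀ n M → r ≡ k₀ ℤ.+ M → r ℤ.+ n ℤ.* M ≡ k₀ ℤ.+ (n ℤ.+ + 1) ℤ.* M
        raise r k₀ n M e = ≡.trans (≡.cong (ℤ._+ n ℤ.* M) e)
          (ℤR.solve 3 (λ k n M → k ℤR.:+ M ℤR.:+ n ℤR.:* M ℤR.:= k ℤR.:+ (n ℤR.:+ ℤR.con (+ 1)) ℤR.:* M) ≡.refl k₀ n M)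

        settle : ∀ {w k k₀} n → k ≡ k₀ ℤ.+ n ℤ.* + 287 → Has (l^ k * evT l w) (+ 0) →
                 (∀ n → Has (l^ (k₀ ℤ.+ n ℤ.* + 287) * evT l w) (+ 0) → n ≡ + 0) → k ≡ k₀
        settle {w} {k} {k₀} n e h iso = ≡.trans e (≡.trans
          (≡.cong (λ n → k₀ ℤ.+ n ℤ.* + 287) (iso n (≡.subst (λ k → Has (l^ k * evT l w) (+ 0)) e h))) (ℤP.+-identityʳ k₀))

      -- Each class left by the sieve contains exactly one zero. The classes 271 and 284 are those
      -- of -16 and -3, hence the shift of the quotient by 1.
      T-zeros : ∀ k → Has (l^ k * evT l 1ᵀ) (+ 0) → k ∈ (+ 1 ∷ + 0 ∷ -[1+ 2 ] ∷ -[1+ 15 ] ∷ [])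
      T-zeros k h = classify (residue∈ period₈₃ sieve-T k h) T-regular
        where
        n = k ℤ./ℕ 287
        classify : k ℤ.%ℕ 287 ∈ (0 ∷ 1 ∷ 271 ∷ 284 ∷ []) →
          All (Regular 1ᵀ G₈₃ H₈₃) (+ 1 ∷ + 0 ∷ -[1+ 2 ] ∷ -[1+ 15 ] ∷ []) →
          k ∈ (+ 1 ∷ + 0 ∷ -[1+ 2 ] ∷ -[1+ 15 ] ∷ [])
        classify (here e) (_ ∷ reg ∷ _) =
          there (here (settle {1ᵀ} n (quotient-form k 287 e) h (IsoT.isolated (+ 0) reg)))
        classify (there (here e)) (reg ∷ _) =
          here (settle {1ᵀ} n (quotient-form k 287 e) h (IsoT.isolated (+ 1) reg))
        classify (there (there (here e))) (_ ∷ _ ∷ _ ∷ reg ∷ []) =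
          there (there (there (here (settle {1ᵀ} (n ℤ.+ + 1)
            (≡.trans (quotient-form k 287 e) (raise (+ 271) -[1+ 15 ] n (+ 287) ≡.refl)) h
            (IsoT.isolated -[1+ 15 ] reg)))))
        classify (there (there (there (here e)))) (_ ∷ _ ∷ reg ∷ _) =
          there (there (here (settle {1ᵀ} (n ℤ.+ + 1)
            (≡.trans (quotient-form k 287 e) (raise (+ 284) -[1+ 2 ] n (+ 287) ≡.refl)) h
            (IsoT.isolated -[1+ 2 ] reg))))

      private
        -- 287 and 140 are multiples of 7.
        incompatible : ∀ k r s → ¬ (+ 7 ℤS.∣ + r ℤ.- + s) → k ℤ.%ℕ 287 ≡ r → k ℤ.%ℕ 140 ≡ s → ⊥
        incompatible k r s 7∤ e e′ = 7∤ (ℤS.divides (+ 20 ℤ.* y ℤ.- + 41 ℤ.* x)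
          (difference (+ r) (+ s) x y (≡.trans (≡.sym (quotient-form k 287 e)) (quotient-form k 140 e′))))
          where
          x = k ℤ./ℕ 287
          y = k ℤ./ℕ 140
          difference : ∀ r s x y → r ℤ.+ x ℤ.* + 287 ≡ s ℤ.+ y ℤ.* + 140 →
            r ℤ.- s ≡ (+ 20 ℤ.* y ℤ.- + 41 ℤ.* x) ℤ.* + 7
          difference r s x y eq = ≡.trans
            (ℤR.solve 3 (λ r s x → r ℤR.:- s ℤR.:=
              ((r ℤR.:+ x ℤR.:* ℤR.con (+ 287)) ℤR.:- s) ℤR.:- x ℤR.:* ℤR.con (+ 287)) ≡.refl r s x)
            (≡.trans (≡.cong (λ z → z ℤ.- s ℤ.- x ℤ.* + 287) eq)
            (ℤR.solve 3 (λ s x y → (s ℤR.:+ y ℤR.:* ℤR.con (+ 140)) ℤR.:- s ℤR.:- x ℤR.:* ℤR.con (+ 287) ℤR.:=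
              (ℤR.con (+ 20) ℤR.:* y ℤR.:- ℤR.con (+ 41) ℤR.:* x) ℤR.:* ℤR.con (+ 7)) ≡.refl s x y))

        excluded : ∀ k r → All (λ s → ¬ (+ 7 ℤS.∣ + r ℤ.- + s)) (0 ∷ 21 ∷ 54 ∷ 112 ∷ 138 ∷ []) →
                   k ℤ.%ℕ 287 ≡ r → Has (l^ k * evT l 1+Xᵀ) (+ 0) → ⊥
        excluded k r 7∤ e h =
          incompatible k r (k ℤ.%ℕ 140) (All.lookup 7∤ (residue∈ period₂₉ sieve-V₂₉ k h)) e ≡.refl

      V-zeros : ∀ k → Has (l^ k * evT l 1+Xᵀ) (+ 0) → k ∈ (+ 0 ∷ -[1+ 1 ] ∷ [])
      V-zeros k h = classify (residue∈ period₈₃ sieve-V k h) V-regular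
        where
        n = k ℤ./ℕ 287
        classify : k ℤ.%ℕ 287 ∈ (0 ∷ 74 ∷ 125 ∷ 285 ∷ []) →
          All (Regular 1+Xᵀ V₈₃ V₈₃′) (+ 0 ∷ -[1+ 1 ] ∷ []) → k ∈ (+ 0 ∷ -[1+ 1 ] ∷ [])
        classify (here e) (reg ∷ _) =
          here (settle {1+Xᵀ} n (quotient-form k 287 e) h (IsoV.isolated (+ 0) reg))
        classify (there (here e)) _ = ⊥-elim (excluded k 74 incompatible-74 e h)
        classify (there (there (here e))) _ = ⊥-elim (excluded k 125 incompatible-125 e h)
        classify (there (there (there (here e)))) (_ ∷ reg ∷ _) =
          there (here (settle {1+Xᵀ} (n ℤ.+ + 1)
            (≡.trans (quotient-form k 287 e) (raise (+ 285) -[1+ 1 ] n (+ 287) ≡.refl)) h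
            (IsoV.isolated -[1+ 1 ] reg)))

  -- Roots of polynomials over the field, and polynomials over ℤ.

  module Polynomials where

    open TribonacciField

    pow≈^ : ∀ x n → pow R x n ≈ x ^ n
    pow≈^ x zero    = refl
    pow≈^ x (suc n) = *-congˡ (pow≈^ x n)

    private
      evC : ∀ {n} → Vec Carrier n → Carrier → Carrier
      evC = evalPoly R

      evC-scale : ∀ {n} a (cs : Vec Carrier n) x → evC (Vec.map (a *_) cs) x ≈ a * evC cs x
      evC-scale a []       x = sym (zeroʳ a)
      evC-scale a (c ∷ cs) x = trans (+-congˡ (*-congˡ (evC-scale a cs x)))
        (solve 4 (λ a c x e → a :* c :+ x :* (a :* e) := a :* (c :+ x :* e)) refl a c x (evC cs x))

      evC-zero : ∀ n x → evC (Vec.replicate n 0#) x ≈ 0#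
      evC-zero zero    x = refl
      evC-zero (suc n) x = trans (+-identityˡ _) (trans (*-congˡ (evC-zero n x)) (zeroʳ x))

      evC-∷ʳ : ∀ {n} (cs : Vec Carrier n) d x → evC (cs ∷ʳ d) x ≈ evC cs x + d * x ^ n
      evC-∷ʳ []       d x = solve 2 (λ d x → d :+ x :* con (+ 0) := con (+ 0) :+ d :* con (+ 1)) refl d x
      evC-∷ʳ {suc n} (c ∷ cs) d x = trans (+-congˡ (*-congˡ (evC-∷ʳ cs d x)))
        (solve 5 (λ c x e d p → c :+ x :* (e :+ d :* p) := c :+ x :* e :+ d :* (x :* p)) refl c x (evC cs x) d (x ^ n))

      evC-+ : ∀ {n} (as bs : Vec Carrier n) x → evC (Vec.zipWith _+_ as bs) x ≈ evC as x + evC bs x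
      evC-+ []       []       x = sym (+-identityˡ _)
      evC-+ (a ∷ as) (b ∷ bs) x = trans (+-congˡ (*-congˡ (evC-+ as bs x)))
        (solve 5 (λ a b x g h → a :+ b :+ x :* (g :+ h) := a :+ x :* g :+ (b :+ x :* h)) refl a b x (evC as x) (evC bs x))

      module _ (τ : Carrier) where

        timesLinear : ∀ {n} → Vec Carrier n → Vec Carrier (suc n)
        timesLinear cs = Vec.zipWith _+_ (0# ∷ cs) (Vec.map (τ *_) cs ∷ʳ 0#)

        timesLinear-ev : ∀ {n} (cs : Vec Carrier n) z → evC (timesLinear cs) z ≈ (z + τ) * evC cs z
        timesLinear-ev {n} cs z = begin
          evC (timesLinear cs) z
            ≈⟨ evC-+ (0# ∷ cs) (Vec.map (τ *_) cs ∷ʳ 0#) z ⟩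
          (0# + z * evC cs z) + evC (Vec.map (τ *_) cs ∷ʳ 0#) z
            ≈⟨ +-congˡ (trans (evC-∷ʳ (Vec.map (τ *_) cs) 0# z) (+-congʳ (evC-scale τ cs z))) ⟩
          (0# + z * evC cs z) + (τ * evC cs z + 0# * z ^ n)
            ≈⟨ solve 4 (λ z e t p → (con (+ 0) :+ z :* e) :+ (t :* e :+ con (+ 0) :* p) := (z :+ t) :* e) refl z (evC cs z) τ (z ^ n) ⟩
          (z + τ) * evC cs z ∎

        translate : ∀ {n} (bs : Vec Carrier n) → ∃ λ (cs : Vec Carrier n) → ∀ z → evC bs (z + τ) ≈ evC cs z
        translate [] = [] , λ z → refl
        translate {suc n} (b ∷ bs) =
          let (cs , e) = translate bs
          in Vec.zipWith _+_ (b ∷ Vec.replicate n 0#) (timesLinear cs) , λ z → sym (begin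
            evC (Vec.zipWith _+_ (b ∷ Vec.replicate n 0#) (timesLinear cs)) z
              ≈⟨ evC-+ (b ∷ Vec.replicate n 0#) (timesLinear cs) z ⟩
            (b + z * evC (Vec.replicate n 0#) z) + evC (timesLinear cs) z
              ≈⟨ +-cong (trans (+-congˡ (trans (*-congˡ (evC-zero n z)) (zeroʳ z))) (+-identityʳ b)) (timesLinear-ev cs z) ⟩
            b + (z + τ) * evC cs z
              ≈⟨ +-congˡ (*-congˡ (sym (e z))) ⟩
            b + (z + τ) * evC bs (z + τ) ∎)

        power-top : ∀ n → ∃ λ (cs : Vec Carrier n) → ∀ z → (z + τ) ^ n ≈ evC cs z + z ^ n
        power-top zero = [] , λ z → sym (+-identityˡ 1#)
        power-top (suc n) =
          let (cs , e) = power-top n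
          in Vec.zipWith _+_ (timesLinear cs) (Vec.replicate n 0# ∷ʳ τ) , λ z → sym (begin
            evC (Vec.zipWith _+_ (timesLinear cs) (Vec.replicate n 0# ∷ʳ τ)) z + z * z ^ n
              ≈⟨ +-congʳ (trans (evC-+ (timesLinear cs) _ z) (+-cong (timesLinear-ev cs z)
                   (trans (evC-∷ʳ (Vec.replicate n 0#) τ z) (+-congʳ (evC-zero n z))))) ⟩
            (z + τ) * evC cs z + (0# + τ * z ^ n) + z * z ^ n
              ≈⟨ solve 4 (λ z t e p → (z :+ t) :* e :+ (con (+ 0) :+ t :* p) :+ z :* p := (z :+ t) :* (e :+ p)) refl z τ (evC cs z) (z ^ n) ⟩
            (z + τ) * (evC cs z + z ^ n)
              ≈⟨ *-congˡ (sym (e z)) ⟩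
            (z + τ) * (z + τ) ^ n ∎)

        power-two-top : ∀ n → ∃ λ (cs : Vec Carrier n) → ∀ z →
          (z + τ) ^ suc n ≈ evC cs z + ι (+ suc n) * τ * z ^ n + z ^ suc n
        power-two-top zero = [] , λ z → solve 2 (λ z t → (z :+ t) :* con (+ 1) := con (+ 0) :+ con (+ 1) :* t :* con (+ 1) :+ z :* con (+ 1)) refl z τ
        power-two-top (suc n) =
          let (cs , e) = power-two-top n
          in Vec.zipWith _+_ (timesLinear cs) (Vec.replicate n 0# ∷ʳ (τ * (ι (+ suc n) * τ))) , λ z → sym (begin
            evC (Vec.zipWith _+_ (timesLinear cs) (Vec.replicate n 0# ∷ʳ (τ * (ι (+ suc n) * τ)))) z
              + ι (+ suc (suc n)) * τ * (z * z ^ n) + z * (z * z ^ n)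
              ≈⟨ +-congʳ (+-cong (trans (evC-+ (timesLinear cs) _ z) (+-cong (timesLinear-ev cs z)
                   (trans (evC-∷ʳ (Vec.replicate n 0#) _ z) (+-congʳ (evC-zero n z)))))
                   (*-congʳ (*-congʳ (ι-+ (+ 1) (+ suc n))))) ⟩
            (z + τ) * evC cs z + (0# + τ * (ι (+ suc n) * τ) * z ^ n) + (1# + ι (+ suc n)) * τ * (z * z ^ n) + z * (z * z ^ n)
              ≈⟨ solve 5 (λ z t e n p → (z :+ t) :* e :+ (con (+ 0) :+ t :* (n :* t) :* p) :+ (con (+ 1) :+ n) :* t :* (z :* p) :+ z :* (z :* p) :=
                   (z :+ t) :* (e :+ n :* t :* p :+ z :* p)) refl z τ (evC cs z) (ι (+ suc n)) (z ^ n) ⟩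
            (z + τ) * (evC cs z + ι (+ suc n) * τ * z ^ n + z * z ^ n)
              ≈⟨ *-congˡ (sym (e z)) ⟩
            (z + τ) * ((z + τ) * (z + τ) ^ n) ∎)

      -- algClosed only provides roots of polynomials without second
      -- coefficient; a translation reduces to this case.
      monicRoot : ∀ m (bs : Vec Carrier (suc m)) → ∃ λ x → x ^ suc m + evC bs x ≈ 0#
      monicRoot m bs with Vec.initLast bs
      ... | bs′ , b , ≡.refl = z + τ , (begin
        (z + τ) ^ suc m + evC (bs′ ∷ʳ b) (z + τ)
          ≈⟨ +-cong (proj₂ top₂ z) (trans (evC-∷ʳ bs′ b (z + τ)) (+-cong (proj₂ low z) (*-congˡ (proj₂ top z)))) ⟩
        evC (proj₁ top₂) z + n * τ * z ^ m + z ^ suc m + (evC (proj₁ low) z + b * (evC (proj₁ top) z + z ^ m))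
          ≈⟨ +-congʳ (+-congʳ (+-congˡ (*-congʳ nτ≈-b))) ⟩
        evC (proj₁ top₂) z + - b * z ^ m + z ^ suc m + (evC (proj₁ low) z + b * (evC (proj₁ top) z + z ^ m))
          ≈⟨ trans (gather (evC (proj₁ top₂) z) (evC (proj₁ low) z) b (evC (proj₁ top) z) (z ^ m) (z ^ suc m))
               (+-cong (sym (pow≈^ z (suc m))) (sym (trans (evC-+ (proj₁ top₂) _ z)
                 (+-congˡ (trans (evC-+ (proj₁ low) _ z) (+-congˡ (evC-scale b (proj₁ top) z))))))) ⟩
        pow R z (suc m) + evC cs z
          ≈⟨ root ⟩
        0# ∎)
        where
        n = ι (+ suc m)
        -- The Tschirnhaus shift: after it, the coefficient of zᵐ is (m + 1)τ + b = 0.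
        -- Characteristic 0 makes m + 1 invertible.
        τ = - b * inv n
        nτ≈-b : n * τ ≈ - b
        nτ≈-b = trans (solve 3 (λ n b i → n :* (:- b :* i) := (n :* i) :* (:- b)) refl n b (inv n))
          (trans (*-congʳ (inverseʳ n (ι≉0 (+ suc m) λ ()))) (*-identityˡ _))
        top₂ = power-two-top τ m
        top = power-top τ m
        low = translate τ bs′
        cs = Vec.zipWith _+_ (proj₁ top₂) (Vec.zipWith _+_ (proj₁ low) (Vec.map (b *_) (proj₁ top)))
        z = proj₁ (algClosed m cs)
        root = proj₂ (algClosed m cs)
        gather : ∀ e₂ e₀ b e₁ p q → e₂ + - b * p + q + (e₀ + b * (e₁ + p)) ≈ q + (e₂ + (e₀ + b * e₁))
        gather e₂ e₀ b e₁ p q = trans (+-congˡ (+-congˡ (distribˡ b e₁ p)))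
          (trans (+-congʳ (+-congʳ (+-congˡ (sym (-‿distribˡ-* b p)))))
          (solve 5 (λ e₂ e₀ B q P → e₂ :+ (:- P) :+ q :+ (e₀ :+ (B :+ P)) := q :+ (e₂ :+ (e₀ :+ B))) refl e₂ e₀ (b * e₁) q (b * p)))

    -- A pure equation of degree at least 2 has no second coefficient, so `algClosed` applies
    -- directly. In degree 1 the constant term is the second coefficient, hence the separate case.
    nthRoot : ∀ n u → ∃ λ v → v ^ suc n ≈ u
    nthRoot zero    u = u , *-identityʳ u
    nthRoot (suc n) u =
      let (v , e) = algClosed (suc n) (- u ∷ Vec.replicate n 0#)
      in v , x-y≈0⇒x≈y (trans (+-cong (sym (pow≈^ v (suc (suc n))))
           (sym (trans (+-congˡ (trans (*-congˡ (evC-zero n v)) (zeroʳ v))) (+-identityʳ (- u))))) e)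

    v v′ : Carrier
    v = proj₁ (nthRoot 2 (ι (+ 2)))
    v³≈2 : v ^ 3 ≈ ι (+ 2)
    v³≈2 = proj₂ (nthRoot 2 (ι (+ 2)))
    v′ = inv v
    v≉0 : ¬ v ≈ 0#
    v≉0 e = ι≉0 (+ 2) (λ ()) (trans (sym v³≈2) (trans (*-congʳ e) (zeroˡ _)))

    -- A determination of λ^(4/3) that is affine in λ; it is the source of the two zeros with
    -- denominator 3.
    ω : Carrier → Carrier
    ω l = (1# + l) * v′

    -- (1 + λ)³ = 2λ⁴
    ω³ : ∀ {l} → Root l → ω l ^ 3 ≈ l ^ 4
    ω³ {l} r = begin
      ((1# + l) * v′) ^ 3
        ≈⟨ ^-distrib-* (1# + l) v′ 3 ⟩
      (1# + l) ^ 3 * v′ ^ 3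
        ≈⟨ *-congʳ (lc₁ (- (ι (+ 2) * l + 1#)) r (solve 1 (λ l → (con (+ 1) :+ l) :^ 3 :- con (+ 2) :* l :^ 4 :=
             (:- (con (+ 2) :* l :+ con (+ 1))) :* (l :* l :* l :- (l :* l :+ l :+ con (+ 1)))) refl l)) ⟩
      ι (+ 2) * l ^ 4 * v′ ^ 3
        ≈⟨ *-congʳ (*-congʳ (sym v³≈2)) ⟩
      v ^ 3 * l ^ 4 * v′ ^ 3
        ≈⟨ solve 3 (λ a b d → a :* b :* d := (a :* d) :* b) refl (v ^ 3) (l ^ 4) (v′ ^ 3) ⟩
      v ^ 3 * v′ ^ 3 * l ^ 4
        ≈⟨ *-congʳ (trans (sym (^-distrib-* v v′ 3)) (trans (^-congˡ 3 (inverseʳ v v≉0)) (1^n≈1 3))) ⟩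
      1# * l ^ 4
        ≈⟨ *-identityˡ _ ⟩
      l ^ 4 ∎

    ω≉0 : ∀ {l} → Root l → ¬ ω l ≈ 0#
    ω≉0 {l} r e = ^-≉0 4 (unit-≉0 (κ-inverse r)) (trans (sym (ω³ r)) (trans (*-congʳ e) (zeroˡ _)))

    hasRoot : ∀ m (bs : Vec Carrier (suc m)) {a} → ¬ a ≈ 0# → ∃ λ x → evC bs x + a * x ^ suc m ≈ 0#
    hasRoot m bs {a} a≉0 =
      let (x , e) = monicRoot m (Vec.map (inv a *_) bs)
      in x , (begin
        evC bs x + a * x ^ suc m                        ≈⟨ +-congʳ (sym (*-identityˡ _)) ⟩
        1# * evC bs x + a * x ^ suc m                   ≈⟨ +-congʳ (*-congʳ (sym (inverseʳ a a≉0))) ⟩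
        a * inv a * evC bs x + a * x ^ suc m            ≈⟨ solve 4 (λ a i e p → a :* i :* e :+ a :* p := a :* (p :+ i :* e))
                                                             refl a (inv a) (evC bs x) (x ^ suc m) ⟩
        a * (x ^ suc m + inv a * evC bs x)              ≈⟨ *-congˡ (+-congˡ (sym (evC-scale (inv a) bs x))) ⟩
        a * (x ^ suc m + evC (Vec.map (inv a *_) bs) x) ≈⟨ trans (*-congˡ e) (zeroʳ a) ⟩
        0#                                              ∎)

    evL : List ℤ → Carrier → Carrier
    evL []      x = 0#
    evL (a ∷ h) x = ι a + x * evL h x

    infixl 6 _+ᴸ_
    _+ᴸ_ : List ℤ → List ℤ → List ℤ
    []      +ᴸ h       = h
    (a ∷ g) +ᴸ []      = a ∷ g
    (a ∷ g) +ᴸ (b ∷ h) = a ℤ.+ b ∷ (g +ᴸ h)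

    -ᴸ_ : List ℤ → List ℤ
    -ᴸ []      = []
    -ᴸ (a ∷ h) = ℤ.- a ∷ -ᴸ h

    evL-+ : ∀ g h x → evL (g +ᴸ h) x ≈ evL g x + evL h x
    evL-+ []      h       x = sym (+-identityˡ _)
    evL-+ (a ∷ g) []      x = sym (+-identityʳ _)
    evL-+ (a ∷ g) (b ∷ h) x = trans (+-cong (ι-+ a b) (*-congˡ (evL-+ g h x)))
      (solve 5 (λ a b x g h → a :+ b :+ x :* (g :+ h) := a :+ x :* g :+ (b :+ x :* h)) refl (ι a) (ι b) x (evL g x) (evL h x))

    evL-neg : ∀ h x → evL (-ᴸ h) x ≈ - evL h x
    evL-neg []      x = sym -0#≈0#
    evL-neg (a ∷ h) x = trans (+-cong (ι-neg a) (*-congˡ (evL-neg h x)))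
      (solve 3 (λ a x h → :- a :+ x :* (:- h) := :- (a :+ x :* h)) refl (ι a) x (evL h x))

    evL-x : ∀ h x → evL (+ 0 ∷ h) x ≈ x * evL h x
    evL-x h x = +-identityˡ _

    evZ : ∀ {n} → Vec ℤ n → Carrier → Carrier
    evZ []       x = 0#
    evZ (a ∷ as) x = ι a + x * evZ as x

    evZ-∷ʳ : ∀ {n} (as : Vec ℤ n) d x → evZ (as ∷ʳ d) x ≈ evZ as x + ι d * x ^ n
    evZ-∷ʳ []       d x = solve 2 (λ d x → d :+ x :* con (+ 0) := con (+ 0) :+ d :* con (+ 1)) refl (ι d) x
    evZ-∷ʳ {suc n} (a ∷ as) d x = trans (+-congˡ (*-congˡ (evZ-∷ʳ as d x)))
      (solve 5 (λ a x e d p → a :+ x :* (e :+ d :* p) := a :+ x :* e :+ d :* (x :* p)) refl (ι a) x (evZ as x) (ι d) (x ^ n))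

    evZ-scale : ∀ {n} i (as : Vec ℤ n) x → evZ (Vec.map (i ℤ.*_) as) x ≈ ι i * evZ as x
    evZ-scale i []       x = sym (zeroʳ _)
    evZ-scale i (a ∷ as) x = trans (+-cong (ι-* i a) (*-congˡ (evZ-scale i as x)))
      (solve 4 (λ i a x e → i :* a :+ x :* (i :* e) := i :* (a :+ x :* e)) refl (ι i) (ι a) x (evZ as x))

    evZ-+ : ∀ {n} (as bs : Vec ℤ n) x → evZ (Vec.zipWith ℤ._+_ as bs) x ≈ evZ as x + evZ bs x
    evZ-+ []       []       x = sym (+-identityˡ _)
    evZ-+ (a ∷ as) (b ∷ bs) x = trans (+-cong (ι-+ a b) (*-congˡ (evZ-+ as bs x)))
      (solve 5 (λ a b x g h → a :+ b :+ x :* (g :+ h) := a :+ x :* g :+ (b :+ x :* h)) refl (ι a) (ι b) x (evZ as x) (evZ bs x))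

    evZ-zero : ∀ n x → evZ (Vec.replicate n (+ 0)) x ≈ 0#
    evZ-zero zero    x = refl
    evZ-zero (suc n) x = trans (+-identityˡ _) (trans (*-congˡ (evZ-zero n x)) (zeroʳ x))

    pv : ∀ {n} → Vec ℤ n → ℤ → Carrier → Carrier
    pv {n} as a x = evZ as x + ι a * x ^ n

    record Leading (f : Carrier → Carrier) (n : ℕ) : Set (c ⊔ ℓ) where
      constructor leading
      field
        {deg}  : ℕ
        deg<n  : deg ℕ.< n
        lead   : ℤ
        lead≢0 : ¬ lead ≡ + 0
        lower  : Vec ℤ deg
        agrees : ∀ x → f x ≈ pv lower lead x

    -- Leading zeros can be recognised because the coefficients are integers; this is why
    -- annihilating polynomials are kept over ℤ and not over the field.
    strip : ∀ {n} (as : Vec ℤ n) → (∀ x → evZ as x ≈ 0#) ⊎ Leading (evZ as) n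
    strip [] = inj₁ λ x → refl
    strip (a ∷ as) with strip as
    ... | inj₂ (leading {deg} d< b b≢0 bs e) = inj₂ (leading (s≤s d<) b b≢0 (a ∷ bs) λ x →
      trans (+-congˡ (*-congˡ (e x)))
        (solve 5 (λ a x e b p → a :+ x :* (e :+ b :* p) := a :+ x :* e :+ b :* (x :* p)) refl (ι a) x (evZ bs x) (ι b) (x ^ deg)))
    ... | inj₁ z with a ℤ.≟ + 0
    ...   | yes ≡.refl = inj₁ λ x → trans (+-identityˡ _) (trans (*-congˡ (z x)) (zeroʳ x))
    ...   | no a≢0 = inj₂ (leading (s≤s z≤n) a a≢0 [] λ x →
      trans (+-congˡ (*-congˡ (z x))) (solve 2 (λ a x → a :+ x :* con (+ 0) := con (+ 0) :+ a :* con (+ 1)) refl (ι a) x))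

    stripL : (h : List ℤ) → (∀ x → evL h x ≈ 0#) ⊎ ∃ (Leading (evL h))
    stripL h with strip (Vec.fromList h)
    ... | inj₁ z = inj₁ λ x → trans (sym (same h x)) (z x)
      where
      same : ∀ h x → evZ (Vec.fromList h) x ≈ evL h x
      same []      x = refl
      same (a ∷ h) x = +-congˡ (*-congˡ (same h x))
    ... | inj₂ (leading d< b b≢0 bs e) = inj₂ (_ , leading d< b b≢0 bs λ x → trans (sym (same h x)) (e x))
      where
      same : ∀ h x → evZ (Vec.fromList h) x ≈ evL h x
      same []      x = refl
      same (a ∷ h) x = +-congˡ (*-congˡ (same h x))

    -- Pseudo-division: multiplying by powers of the leading coefficient a keeps everything
    -- integral. The identity is asserted only at the roots of the divisor, where the quotient does
    -- not contribute and so need not be recorded.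
    record Remainder {m} (as : Vec ℤ (suc m)) (a : ℤ) (h : List ℤ) : Set (c ⊔ ℓ) where
      constructor remainder
      field
        k     : ℕ
        rem   : Vec ℤ (suc m)
        equal : ∀ x → pv as a x ≈ 0# → ι a ^ k * evL h x ≈ evZ rem x

    pseudoDivide : ∀ {m} (as : Vec ℤ (suc m)) a h → Remainder as a h
    pseudoDivide {m} as a [] = remainder 0 (Vec.replicate (suc m) (+ 0)) λ x _ →
      trans (zeroʳ _) (sym (evZ-zero (suc m) x))
    pseudoDivide {m} as a (b ∷ h) = extend (pseudoDivide as a h)
      where
      extend : Remainder as a h → Remainder as a (b ∷ h)
      extend (remainder k rem equal) with Vec.initLast rem
      ... | r , d , ≡.refl = remainder (suc k)
        (Vec.zipWith ℤ._+_ (Vec.map (a ℤ.*_) (a ℤ.^ k ℤ.* b ∷ r)) (Vec.map (ℤ.- d ℤ.*_) as)) λ x fx≈0 → begin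
        ι a * ι a ^ k * (ι b + x * evL h x)
          ≈⟨ solve 5 (λ a p b x e → a :* p :* (b :+ x :* e) := a :* (p :* b :+ x :* (p :* e))) refl (ι a) (ι a ^ k) (ι b) x (evL h x) ⟩
        ι a * (ι a ^ k * ι b + x * (ι a ^ k * evL h x))
          ≈⟨ *-congˡ (+-cong (*-congʳ (sym (ι-^ a k))) (*-congˡ (trans (equal x fx≈0) (evZ-∷ʳ r d x)))) ⟩
        ι a * (ι (a ℤ.^ k) * ι b + x * (evZ r x + ι d * x ^ m))
          ≈⟨ lc₁ (ι d) fx≈0 (identity (ι a) (ι (a ℤ.^ k) * ι b) x (evZ r x) (ι d) (x ^ m) (evZ as x)) ⟩
        ι a * (ι (a ℤ.^ k) * ι b + x * evZ r x) + - ι d * evZ as x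
          ≈⟨ sym (+-cong (*-congˡ (+-congʳ (ι-* (a ℤ.^ k) b))) (*-congʳ (ι-neg d))) ⟩
        ι a * evZ (a ℤ.^ k ℤ.* b ∷ r) x + ι (ℤ.- d) * evZ as x
          ≈⟨ sym (+-cong (evZ-scale a (a ℤ.^ k ℤ.* b ∷ r) x) (evZ-scale (ℤ.- d) as x)) ⟩
        evZ (Vec.map (a ℤ.*_) (a ℤ.^ k ℤ.* b ∷ r)) x + evZ (Vec.map (ℤ.- d ℤ.*_) as) x
          ≈⟨ sym (evZ-+ (Vec.map (a ℤ.*_) (a ℤ.^ k ℤ.* b ∷ r)) (Vec.map (ℤ.- d ℤ.*_) as) x) ⟩
        evZ (Vec.zipWith ℤ._+_ (Vec.map (a ℤ.*_) (a ℤ.^ k ℤ.* b ∷ r)) (Vec.map (ℤ.- d ℤ.*_) as)) x ∎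
        where
        identity : ∀ a q x r d p e → a * (q + x * (r + d * p)) - (a * (q + x * r) + - d * e) ≈ d * (e + a * (x * p) - 0#)
        identity a q x r d p e = begin
          a * (q + x * (r + d * p)) - (a * (q + x * r) + - d * e)
            ≈⟨ +-congʳ (*-congˡ (trans (+-congˡ (distribˡ x r (d * p))) (sym (+-assoc q (x * r) (x * (d * p)))))) ⟩
          a * ((q + x * r) + x * (d * p)) - (a * (q + x * r) + - d * e)
            ≈⟨ solve 4 (λ a s D E → a :* (s :+ D) :- (a :* s :+ E) := a :* D :- E) refl a (q + x * r) (x * (d * p)) (- d * e) ⟩
          a * (x * (d * p)) - - d * e
            ≈⟨ solve 5 (λ a x d p e → a :* (x :* (d :* p)) :- (:- d) :* e := d :* (e :+ a :* (x :* p) :- con (+ 0))) refl a x d p e ⟩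
          d * (e + a * (x * p) - 0#) ∎

    -- In f(x) - f(s) = (x - s)g(x) the quotient g has coefficients in the field, but g(s) = f′(s)
    -- and f′ is integral. So if s is also a root of g, an integer polynomial of smaller degree
    -- annihilates s.
    record Division {m} (as : Vec ℤ (suc m)) (a : ℤ) (s : Carrier) : Set (c ⊔ ℓ) where
      constructor division
      field
        quotient   : Vec Carrier m
        divides    : ∀ x → pv as a x - pv as a s ≈ (x - s) * (evC quotient x + ι a * x ^ m)
        derivative : Vec ℤ m
        atPoint    : evC quotient s + ι a * s ^ m ≈ pv derivative (+ suc m ℤ.* a) s

    divideBy : ∀ {m} (as : Vec ℤ (suc m)) a s → Division as a s
    divideBy {zero} (b ∷ []) a s = division []
      (λ x → solve 4 (λ b x a s → (b :+ x :* con (+ 0) :+ a :* (x :* con (+ 1))) :- (b :+ s :* con (+ 0) :+ a :* (s :* con (+ 1))) :=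
        (x :- s) :* (con (+ 0) :+ a :* con (+ 1))) refl (ι b) x (ι a) s)
      [] (+-congˡ (*-congʳ (ι-cong (≡.sym (ℤP.*-identityˡ a)))))
    divideBy {suc m} (b ∷ as) a s = extend (divideBy as a s)
      where
      extend : Division as a s → Division (b ∷ as) a s
      extend (division q div d at) = division (pv as a s ∷ q)
        (λ x → begin
          (ι b + x * evZ as x + ι a * (x * x ^ suc m)) - (ι b + s * evZ as s + ι a * (s * s ^ suc m))
            ≈⟨ +-cong (peel (ι b) x (evZ as x) (ι a) (x ^ suc m)) (-‿cong (peel (ι b) s (evZ as s) (ι a) (s ^ suc m))) ⟩
          (ι b + x * pv as a x) - (ι b + s * pv as a s)
            ≈⟨ solve 5 (λ b x f s g → (b :+ x :* f) :- (b :+ s :* g) := (x :- s) :* g :+ x :* (f :- g)) refl (ι b) x (pv as a x) s (pv as a s) ⟩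
          (x - s) * pv as a s + x * (pv as a x - pv as a s)
            ≈⟨ +-congˡ (*-congˡ (div x)) ⟩
          (x - s) * pv as a s + x * ((x - s) * (evC q x + ι a * x ^ m))
            ≈⟨ solve 4 (λ d g x q → d :* g :+ x :* (d :* q) := d :* (g :+ x :* q)) refl (x - s) (pv as a s) x (evC q x + ι a * x ^ m) ⟩
          (x - s) * (pv as a s + x * (evC q x + ι a * x ^ m))
            ≈⟨ *-congˡ (sym (peel (pv as a s) x (evC q x) (ι a) (x ^ m))) ⟩
          (x - s) * (pv as a s + x * evC q x + ι a * (x * x ^ m)) ∎)
        (Vec.zipWith ℤ._+_ as (+ 0 ∷ d))
        (begin
          pv as a s + s * evC q s + ι a * (s * s ^ m)
            ≈⟨ peel (pv as a s) s (evC q s) (ι a) (s ^ m) ⟩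
          pv as a s + s * (evC q s + ι a * s ^ m)
            ≈⟨ +-congˡ (*-congˡ at) ⟩
          (evZ as s + ι a * (s * s ^ m)) + s * (evZ d s + ι (+ suc m ℤ.* a) * s ^ m)
            ≈⟨ collect (evZ as s) (ι a) s (s ^ m) (evZ d s) (ι (+ suc m ℤ.* a)) ⟩
          (evZ as s + (0# + s * evZ d s)) + (ι a + ι (+ suc m ℤ.* a)) * (s * s ^ m)
            ≈⟨ sym (+-cong (evZ-+ as (+ 0 ∷ d) s) (*-congʳ (trans (ι-cong (ℤP.suc-* (+ suc m) a)) (ι-+ a (+ suc m ℤ.* a))))) ⟩
          evZ (Vec.zipWith ℤ._+_ as (+ 0 ∷ d)) s + ι (+ suc (suc m) ℤ.* a) * (s * s ^ m) ∎)
        where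
        peel : ∀ b x e a p → b + x * e + a * (x * p) ≈ b + x * (e + a * p)
        peel b x e a p = solve 5 (λ b x e a p → b :+ x :* e :+ a :* (x :* p) := b :+ x :* (e :+ a :* p)) refl b x e a p
        collect : ∀ e a s p d a′ → (e + a * (s * p)) + s * (d + a′ * p) ≈ (e + (0# + s * d)) + (a + a′) * (s * p)
        collect e a s p d a′ = trans (+-congˡ (trans (distribˡ s d (a′ * p)) (+-congˡ (solve 3 (λ s a p → s :* (a :* p) := a :* (s :* p)) refl s a′ p))))
          (solve 5 (λ e a S d a′ → (e :+ a :* S) :+ (d :+ a′ :* S) := (e :+ (con (+ 0) :+ d)) :+ (a :+ a′) :* S) refl e a (s * p) (s * d) a′)

  -- The six numbers are twisted zeros.

  module Backward where

    open TribonacciField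
    open Polynomials
    open Zeros
    open Coordinates

    module _ {l₁ l₂ l₃ : Carrier} (roots : Roots l₁ l₂ l₃) where
      open Roots roots

      -- The terms are (A + Bλᵢ)/P′(λᵢ), and Σ 1/P′(λᵢ) = Σ λᵢ/P′(λᵢ) = 0. So it is enough to choose
      -- μᵢ with λᵢμᵢᵏ affine in λᵢ, and all roots of unity can be 1.
      line⇒twisted : ∀ a (A B : Carrier) (μ : Carrier → Carrier) →
        (∀ {l} → Root l → pow R (μ l) (↧ₙ a) ≈ l) →
        (∀ {l} → Root l → l * zpow R inv (μ l) (↥ a) ≈ A + B * l) →
        IsTwistedRationalZero R inv l₁ l₂ l₃ a
      line⇒twisted a A B μ powers line =
        μ l₁ , μ l₂ , μ l₃ , 1# , 1# , 1# , powers root₁ , powers root₂ , powers root₃ ,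
        (0 , *-identityˡ 1#) , (0 , *-identityˡ 1#) , (0 , *-identityˡ 1#) ,
        trans (+-cong (+-cong (shape root₁) (shape root₂)) (shape root₃))
          (cancelˡ (*-≉0 (*-≉0 (x-y≉0 l₁≉l₂) (x-y≉0 l₁≉l₃)) (x-y≉0 l₂≉l₃))
            (trans (weighted-sum roots _ _ _)
              (solve 5 (λ A B a b c → (A :+ B :* a) :* (b :- c) :+ (A :+ B :* b) :* (c :- a) :+ (A :+ B :* c) :* (a :- b) :=
                con (+ 0)) refl A B l₁ l₂ l₃)))
        where
        x-y≉0 : ∀ {x y} → ¬ x ≈ y → ¬ x - y ≈ 0#
        x-y≉0 x≉y e = x≉y (x-y≈0⇒x≈y e)
        shape : ∀ {l} → Root l → 1# * coeffα R inv l * zpow R inv (μ l) (↥ a) ≈ (A + B * l) * inv (P′ R l)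
        shape {l} r = trans
          (solve 3 (λ l i z → con (+ 1) :* (l :* i) :* z := (l :* z) :* i) refl l (inv (P′ R l)) (zpow R inv (μ l) (↥ a)))
          (*-congʳ (line r))

      private
        inv≈κ : ∀ {l} → Root l → inv l ≈ κ l
        inv≈κ r = *-cancelˡ-≈ (unit-≉0 (κ-inverse r)) (trans (inverseʳ _ (unit-≉0 (κ-inverse r))) (sym (κ-inverse r)))

      at-zero : IsTwistedRationalZero R inv l₁ l₂ l₃ ((+ 0) / 1)
      at-zero = line⇒twisted ((+ 0) / 1) 0# 1# (λ l → l) (λ _ → *-identityʳ _)
        λ {l} _ → solve 1 (λ l → l :* con (+ 1) := con (+ 0) :+ con (+ 1) :* l) refl l

      negative : ∀ m a b → act (ℤ.- + m) 1ᵀ ≡ triple a b (+ 0) →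
                 ∀ q → ↧ₙ q ≡ 1 → ↥ q ≡ -[1+ m ] → IsTwistedRationalZero R inv l₁ l₂ l₃ q
      negative m a b coordinates q e₁ e₂ = line⇒twisted q (ι a) (ι b) (λ l → l)
        (λ {l} _ → trans (reflexive (≡.cong (pow R l) e₁)) (*-identityʳ _))
        λ {l} r → begin
          l * zpow R inv l (↥ q)                  ≡⟨ ≡.cong (λ k → l * zpow R inv l k) e₂ ⟩
          l * (inv l * pow R (inv l) m)           ≈⟨ trans (sym (*-assoc l (inv l) _)) (trans (*-congʳ (inverseʳ l (unit-≉0 (κ-inverse r)))) (*-identityˡ _)) ⟩
          pow R (inv l) m                         ≈⟨ trans (pow≈^ (inv l) m) (^-congˡ m (inv≈κ r)) ⟩
          κ l ^ m                                 ≈⟨ sym (zp-neg l (κ l) (+ m)) ⟩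
          zp l (κ l) (ℤ.- + m)                    ≈⟨ sym (trans (*-congˡ (OverRoot.evT-1 r)) (*-identityʳ _)) ⟩
          zp l (κ l) (ℤ.- + m) * evT l 1ᵀ         ≈⟨ OverRoot.evT-act r (ℤ.- + m) 1ᵀ ⟩
          evT l (act (ℤ.- + m) 1ᵀ)                ≡⟨ ≡.cong (evT l) coordinates ⟩
          ι a + ι b * l + 0# * (l * l)            ≈⟨ trans (+-congˡ (zeroˡ _)) (+-identityʳ _) ⟩
          ι a + ι b * l                           ∎

      private
        -- λ^(4/3) λ⁻¹, a cube root of λ.
        μ : Carrier → Carrier
        μ l = ω l * κ l

        μ³ : ∀ {l} → Root l → μ l ^ 3 ≈ l
        μ³ {l} r = begin
          (ω l * κ l) ^ 3        ≈⟨ trans (^-distrib-* (ω l) (κ l) 3) (*-congʳ (ω³ r)) ⟩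
          l ^ 4 * κ l ^ 3        ≈⟨ solve 2 (λ l k → l :^ 4 :* k :^ 3 := (l :* k) :^ 3 :* l) refl l (κ l) ⟩
          (l * κ l) ^ 3 * l      ≈⟨ trans (*-congʳ (trans (^-congˡ 3 (κ-inverse r)) (1^n≈1 3))) (*-identityˡ l) ⟩
          l                      ∎

      third : IsTwistedRationalZero R inv l₁ l₂ l₃ ((+ 1) / 3)
      third = line⇒twisted ((+ 1) / 3) v′ v′ μ μ³ λ {l} r → begin
        l * (ω l * κ l * 1#)        ≈⟨ solve 3 (λ l w k → l :* (w :* k :* con (+ 1)) := (l :* k) :* w) refl l (ω l) (κ l) ⟩
        l * κ l * ω l               ≈⟨ trans (*-congʳ (κ-inverse r)) (*-identityˡ _) ⟩
        (1# + l) * v′               ≈⟨ solve 2 (λ l v → (con (+ 1) :+ l) :* v := v :+ v :* l) refl l v′ ⟩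
        v′ + v′ * l                 ∎

      -- λμ⁻⁵ = λ⁻¹μ = λ⁻²ω, which is affine because 1 + λ = λ²(λ - 1).
      minus-five-thirds : IsTwistedRationalZero R inv l₁ l₂ l₃ (-[1+ 4 ] / 3)
      minus-five-thirds = line⇒twisted (-[1+ 4 ] / 3) (- v′) v′ μ μ³ λ {l} r → begin
        l * inv (μ l) ^ 5
          ≈⟨ trans (*-congˡ (fifth r)) (solve 2 (λ l w → l :* w := w :* l) refl l (κ l * κ l * μ l)) ⟩
        κ l * κ l * (ω l * κ l) * l
          ≈⟨ solve 3 (λ l k w → k :* k :* (w :* k) :* l := (l :* k) :* (k :* k :* w)) refl l (κ l) (ω l) ⟩
        l * κ l * (κ l * κ l * ω l)
          ≈⟨ trans (*-congʳ (κ-inverse r)) (*-identityˡ _) ⟩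
        κ l * κ l * ((1# + l) * v′)
          ≈⟨ lc₂ ((l - 1#) * v′ * (l * κ l + 1#)) (- (κ l * κ l * v′)) (κ-inverse r) r
               (solve 3 (λ l k v → k :* k :* ((con (+ 1) :+ l) :* v) :- (:- v :+ v :* l) :=
                 (l :- con (+ 1)) :* v :* (l :* k :+ con (+ 1)) :* (l :* k :- con (+ 1)) :+
                 (:- (k :* k :* v)) :* (l :* l :* l :- (l :* l :+ l :+ con (+ 1)))) refl l (κ l) v′) ⟩
        - v′ + v′ * l ∎
        where
        μ≉0 : ∀ {l} → Root l → ¬ μ l ≈ 0#
        μ≉0 r e = unit-≉0 (κ-inverse r) (trans (sym (μ³ r)) (trans (*-congʳ e) (zeroˡ _)))
        -- μ⁻⁵ = μ⁻⁶ μ = λ⁻² μ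
        fifth : ∀ {l} → Root l → inv (μ l) ^ 5 ≈ κ l * κ l * μ l
        fifth {l} r = *-cancelˡ-≈ (^-≉0 5 (μ≉0 r)) (begin
          μ l ^ 5 * inv (μ l) ^ 5
            ≈⟨ trans (sym (^-distrib-* (μ l) (inv (μ l)) 5)) (trans (^-congˡ 5 (inverseʳ (μ l) (μ≉0 r))) (1^n≈1 5)) ⟩
          1#
            ≈⟨ sym (trans (*-cong (trans (*-cong (μ³ r) (μ³ r)) refl) refl) (square r)) ⟩
          μ l ^ 3 * μ l ^ 3 * (κ l * κ l)
            ≈⟨ solve 2 (λ m k → m :^ 3 :* m :^ 3 :* (k :* k) := m :^ 5 :* (k :* k :* m)) refl (μ l) (κ l) ⟩
          μ l ^ 5 * (κ l * κ l * μ l) ∎)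
          where
          square : ∀ {l} → Root l → l * l * (κ l * κ l) ≈ 1#
          square {l} r = trans (solve 2 (λ l k → l :* l :* (k :* k) := (l :* k) :* (l :* k)) refl l (κ l))
            (trans (*-cong (κ-inverse r) (κ-inverse r)) (*-identityˡ 1#))

      backward : ∀ {a} → a ∈ twistedZeros → IsTwistedRationalZero R inv l₁ l₂ l₃ a
      backward (here ≡.refl)                                         = at-zero
      -- By computation, λ⁰ = 1, λ⁻³ = 2 - λ and λ⁻¹⁶ = 56λ - 103.
      backward (there (here ≡.refl))                                 = negative 0 (+ 1) (+ 0) ≡.refl (-[1+ 0 ] / 1) ≡.refl ≡.refl
      backward (there (there (here ≡.refl)))                         = negative 3 (+ 2) (ℤ.- + 1) ≡.refl (-[1+ 3 ] / 1) ≡.refl ≡.refl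
      backward (there (there (there (here ≡.refl))))                 = negative 16 (ℤ.- + 103) (+ 56) ≡.refl (-[1+ 16 ] / 1) ≡.refl ≡.refl
      backward (there (there (there (there (here ≡.refl)))))         = third
      backward (there (there (there (there (there (here ≡.refl)))))) = minus-five-thirds

  module WithStability (stable : ∀ {x y} → ¬ ¬ (x ≈ y) → x ≈ y) where

    -- Lines through determinations of powers of the roots, and their rigidity.

    module Lines where

      open TribonacciField public

      infixl 10 _^^_
      _^^_ : Carrier → ℤ → Carrier
      l ^^ k = zp l (κ l) k

      -- A family yᵢ = A + B lᵢ of determinations of the (M/(n+1))-th powers
      -- of the lᵢ, with their inverses.
      record Line (l₁ l₂ l₃ : Carrier) : Set (c ⊔ ℓ) where
        field
          A B            : Carrier
          y₁ y₂ y₃       : Carrier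
          y₁′ y₂′ y₃′    : Carrier
          n              : ℕ
          M              : ℤ
          inverse₁       : y₁ * y₁′ ≈ 1#
          inverse₂       : y₂ * y₂′ ≈ 1#
          inverse₃       : y₃ * y₃′ ≈ 1#
          power₁         : y₁ ^ suc n ≈ l₁ ^^ M
          power₂         : y₂ ^ suc n ≈ l₂ ^^ M
          power₃         : y₃ ^ suc n ≈ l₃ ^^ M
          line₁          : y₁ ≈ A + B * l₁
          line₂          : y₂ ≈ A + B * l₂
          line₃          : y₃ ≈ A + B * l₃

      rotateLine : ∀ {l₁ l₂ l₃} → Line l₁ l₂ l₃ → Line l₂ l₃ l₁
      rotateLine L = record
        { A = A ; B = B ; y₁ = y₂ ; y₂ = y₃ ; y₃ = y₁ ; y₁′ = y₂′ ; y₂′ = y₃′ ; y₃′ = y₁′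
        ; n = n ; M = M ; inverse₁ = inverse₂ ; inverse₂ = inverse₃ ; inverse₃ = inverse₁
        ; power₁ = power₂ ; power₂ = power₃ ; power₃ = power₁
        ; line₁ = line₂ ; line₂ = line₃ ; line₃ = line₁ }
        where open Line L

      module At {l₁ l₂ l₃ : Carrier} (roots : Roots l₁ l₂ l₃) where
        open Roots roots
        open Lattices
        open Over (Λ₂-isSubring root₁)
        private
          module Λ₁ = IsSubring (Λ-isSubring root₁)
          module S₂ = IsSubring (Λ₂-isSubring root₁)

        D∈Λ : Λ l₁ D
        D∈Λ = coords (+ 5) (+ 2) (ℤ.- + 3)
          (+-congˡ (trans (-‿distribˡ-* (ι (+ 3)) (l₁ * l₁)) refl))

        open Nakayama (Λ⊂Λ₂ root₁ D∈Λ)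

        O-isSubring : ∀ L → IsSubring (_∈O L)
        O-isSubring L = record
          { B-resp = order-resp ; B-+ = order-+ ; B-* = order-*
          ; B-neg = λ {x} f → order-resp (solve 1 (λ x → con (ℤ.- + 1) :* x := :- x) refl x)
              (order-* (order-B (S₂.B-neg S₂.B-1)) f)
          ; B-0 = order-B S₂.B-0 ; B-1 = order-B S₂.B-1 }

        -- D is not a unit of ℤ[1/2][l₁]: after multiplication by 2ᵏ, independence of 1, l₁, l₁²
        -- turns 1 + D g = 0 into three integer equations, by which 11 would divide a power of 2.
        1+Dg≉0 : ∀ {g} → Λ₂ l₁ g → ¬ 1# + D * g ≈ 0#
        1+Dg≉0 {g} (k , coords a b c e) p =
          let (p₀ , p₁ , p₂) = independent root₁ _ _ _ zero-combination in 11-power-equation k a b c p₀ p₁ p₂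
          where
          K = ι (+ (2 ℕ.^ k))
          zero-combination : ev l₁ (+ (2 ℕ.^ k) ℤ.+ + 5 ℤ.* a ℤ.- + 3 ℤ.* b ℤ.- c)
                                (+ 2 ℤ.* a ℤ.+ + 2 ℤ.* b ℤ.- + 4 ℤ.* c) (c ℤ.- + 3 ℤ.* a ℤ.- b) ≈ 0#
          zero-combination = begin
            _ ≈⟨ +-cong (+-cong
                   (ι≈ (⌜ + (2 ℕ.^ k) ⌝ ⊕ ⌜ + 5 ⌝ ⊗ ⌜ a ⌝ ⊝ ⌜ + 3 ⌝ ⊗ ⌜ b ⌝ ⊝ ⌜ c ⌝))
                   (*-congʳ (ι≈ (⌜ + 2 ⌝ ⊗ ⌜ a ⌝ ⊕ ⌜ + 2 ⌝ ⊗ ⌜ b ⌝ ⊝ ⌜ + 4 ⌝ ⊗ ⌜ c ⌝))))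
                   (*-congʳ (ι≈ (⌜ c ⌝ ⊝ ⌜ + 3 ⌝ ⊗ ⌜ a ⌝ ⊝ ⌜ b ⌝))) ⟩
            (K + ι (+ 5) * ι a - ι (+ 3) * ι b - ι c) + (ι (+ 2) * ι a + ι (+ 2) * ι b - ι (+ 4) * ι c) * l₁
              + (ι c - ι (+ 3) * ι a - ι b) * (l₁ * l₁)
              ≈⟨ lc₁ (ι (+ 3) * ι c * l₁ + ι (+ 3) * ι b + ι c) root₁ (solve 5 (λ K x a b c →
                  ((K :+ con (+ 5) :* a :- con (+ 3) :* b :- c) :+ (con (+ 2) :* a :+ con (+ 2) :* b :- con (+ 4) :* c) :* x
                    :+ (c :- con (+ 3) :* a :- b) :* (x :* x)) :-
                  (K :+ (con (+ 5) :+ con (+ 2) :* x :- con (+ 3) :* (x :* x)) :* (a :+ b :* x :+ c :* (x :* x))) :=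
                  (con (+ 3) :* c :* x :+ con (+ 3) :* b :+ c) :* (x :* x :* x :- (x :* x :+ x :+ con (+ 1))))
                  refl K l₁ (ι a) (ι b) (ι c)) ⟩
            K + D * ev l₁ a b c
              ≈⟨ +-cong (trans (ι-cong (pos-^ 2 k)) (ι-^ (+ 2) k)) (*-congˡ (sym e)) ⟩
            ι (+ 2) ^ k + D * (ι (+ 2) ^ k * g)
              ≈⟨ solve 3 (λ T D g → T :+ D :* (T :* g) := T :* (con (+ 1) :+ D :* g)) refl (ι (+ 2) ^ k) D g ⟩
            ι (+ 2) ^ k * (1# + D * g)
              ≈⟨ trans (*-congˡ p) (zeroʳ _) ⟩
            0# ∎

        -- Otherwise o/2 would be an integral inverse of t and its square one of D = t², making D a
        -- unit of ℤ[1/2][l₁].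
        t∤2 : ∀ L {o} → o ∈O L → ¬ t * o ≈ ι (+ 2)
        t∤2 L {o} o∈ e =
          let (g , g∈ , p) = inverse⇒ L {o * half * (o * half)} (order-* o/2∈ o/2∈) (begin
                D * (o * half * (o * half))            ≈⟨ *-congʳ (sym t²≈D) ⟩
                t * t * (o * half * (o * half))        ≈⟨ solve 3 (λ t o h → t :* t :* (o :* h :* (o :* h)) :=
                                                            (t :* o) :* h :* ((t :* o) :* h)) refl t o half ⟩
                (t * o) * half * ((t * o) * half)      ≈⟨ *-cong to/2≈1 to/2≈1 ⟩
                1# * 1#                                ≈⟨ *-identityˡ 1# ⟩
                1#                                     ∎)
          in 1+Dg≉0 g∈ p
          where
          o/2∈ : (o * half) ∈O L
          o/2∈ = order-* o∈ (order-B (Λ₂-half root₁))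
          to/2≈1 : t * o * half ≈ 1#
          to/2≈1 = trans (*-congʳ e) 2*half

        l₁∈ : ∀ L → l₁ ∈O L
        l₁∈ L = order-B (Λ⊂Λ₂ root₁ (Λ-x root₁))

        half∈ : ∀ L → half ∈O L
        half∈ L = order-B (Λ₂-half root₁)

        record HasLine (Y : Line l₁ l₂ l₃) (L : Lattice) : Set (c ⊔ ℓ) where
          constructor hasLine
          open Line Y
          field
            y₁∈  : y₁ ∈O L
            y₂∈  : y₂ ∈O L
            y₃∈  : y₃ ∈O L
            y₂′∈ : y₂′ ∈O L
            y₃′∈ : y₃′ ∈O L

        liftLine : ∀ {Y L L′} → (∀ x → x ∈O L → x ∈O L′) → HasLine Y L → HasLine Y L′
        liftLine f (hasLine p₁ p₂ p₃ q₂ q₃) = hasLine (f _ p₁) (f _ p₂) (f _ p₃) (f _ q₂) (f _ q₃)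

        module Ring (L : Lattice) (t∈ : t ∈O L) where
          open IsSubring (O-isSubring L) public

          private
            2l₂ : ι (+ 2) * l₂ ≈ 1# - l₁ + t
            2l₂ = lc₁ 1# e₁ (solve 3 (λ a b c → con (+ 2) :* b :- (con (+ 1) :- a :+ (b :- c)) :=
              con (+ 1) :* (a :+ b :+ c :- con (+ 1))) refl l₁ l₂ l₃)
            2l₃ : ι (+ 2) * l₃ ≈ 1# - l₁ - t
            2l₃ = lc₁ 1# e₁ (solve 3 (λ a b c → con (+ 2) :* c :- (con (+ 1) :- a :- (b :- c)) :=
              con (+ 1) :* (a :+ b :+ c :- con (+ 1))) refl l₁ l₂ l₃)

          halve : ∀ {x y} → ι (+ 2) * x ≈ y → y ∈O L → x ∈O L
          halve {x} {y} e y∈ = B-resp (begin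
            half * y                 ≈⟨ *-congˡ (sym e) ⟩
            half * (ι (+ 2) * x)     ≈⟨ solve 2 (λ h x → h :* (con (+ 2) :* x) := con (+ 2) :* h :* x) refl half x ⟩
            ι (+ 2) * half * x       ≈⟨ trans (*-congʳ 2*half) (*-identityˡ x) ⟩
            x                        ∎) (B-* (half∈ L) y∈)

          l₂∈ : l₂ ∈O L
          l₂∈ = halve 2l₂ (B-+ (B-minus B-1 (l₁∈ L)) t∈)
          l₃∈ : l₃ ∈O L
          l₃∈ = halve 2l₃ (B-minus (B-minus B-1 (l₁∈ L)) t∈)

          κ∈ : ∀ {l} → l ∈O L → κ l ∈O L
          κ∈ l∈ = B-minus (B-minus (B-* l∈ l∈) l∈) B-1

          zp∈ : ∀ {x x′} → x ∈O L → x′ ∈O L → ∀ k → zp x x′ k ∈O L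
          zp∈ p q (+ n)    = B-^ n p
          zp∈ p q -[1+ n ] = B-^ (suc n) q

          record U (z : Carrier) : Set (c ⊔ ℓ) where
            constructor unipotent
            field
              part   : Carrier
              part∈  : part ∈O L
              z≈     : z ≈ 1# + t * part

          U-resp : ∀ {z w} → z ≈ w → U z → U w
          U-resp e (unipotent o o∈ p) = unipotent o o∈ (trans (sym e) p)

          U-* : ∀ {z w} → U z → U w → U (z * w)
          U-* (unipotent o o∈ p) (unipotent q q∈ r) =
            unipotent (o + q + t * (o * q)) (B-+ (B-+ o∈ q∈) (B-* t∈ (B-* o∈ q∈)))
              (trans (*-cong p r) (solve 3 (λ t o q → (con (+ 1) :+ t :* o) :* (con (+ 1) :+ t :* q) :=
                con (+ 1) :+ t :* (o :+ q :+ t :* (o :* q))) refl t o q))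

          U-^ : ∀ {z} n → U z → U (z ^ n)
          U-^ zero    u = unipotent 0# B-0 (solve 1 (λ t → con (+ 1) := con (+ 1) :+ t :* con (+ 0)) refl t)
          U-^ (suc n) u = U-* u (U-^ n u)

          U-zp : ∀ {z w} k → U z → U w → U (zp z w k)
          U-zp (+ n)    u v = U-^ n u
          U-zp -[1+ n ] u v = U-^ (suc n) v

          U-quotient : ∀ {x y y′ o} → y * y′ ≈ 1# → x ≈ y + t * o → o ∈O L → y′ ∈O L → U (x * y′)
          U-quotient {x} {y} {y′} {o} e p o∈ y′∈ = unipotent (o * y′) (B-* o∈ y′∈)
            (trans (*-congʳ p) (trans
              (solve 4 (λ y t o y′ → (y :+ t :* o) :* y′ := y :* y′ :+ t :* (o :* y′)) refl y t o y′)
              (+-congʳ e)))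

          U-torsion-free : ∀ m → ¬ m ≡ 0 → ∀ {z} → U z → z ^ m ≈ 1# → z ≈ 1#
          U-torsion-free m m≢0 (unipotent o o∈ p) = torsion-free
            m m≢0 o∈ p
            where
            -- δ is 22/D in ℤ[l₁]. The elements `l₁ - 1#` and `v` form a Bézout identity (l₁ - 1)δ +
            -- vD = 2.
            δ = 1# - ι (+ 5) * l₁ - ι (+ 2) * (l₁ * l₁)
            v = - 1# - ι (+ 3) * l₁ - l₁ * l₁
            l₁∈′ = l₁∈ L
            torsion-free = Torsion.torsion-free stable (O-isSubring L) {t} {δ} {l₁ - 1#} {v} t∈
              (B-minus (B-minus B-1 (B-* (B-ι (+ 5)) l₁∈′)) (B-* (B-ι (+ 2)) (B-* l₁∈′ l₁∈′)))
              (B-minus l₁∈′ B-1)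
              (B-minus (B-minus (B-neg B-1) (B-* (B-ι (+ 3)) l₁∈′)) (B-* l₁∈′ l₁∈′))
              (trans (*-congʳ t²≈D) (lc₁ (ι (+ 6) * l₁ + ι (+ 17)) root₁
                (solve 1 (λ x → (con (+ 5) :+ con (+ 2) :* x :- con (+ 3) :* (x :* x)) :*
                    (con (+ 1) :- con (+ 5) :* x :- con (+ 2) :* (x :* x)) :- con (+ 22) :=
                  (con (+ 6) :* x :+ con (+ 17)) :* (x :* x :* x :- (x :* x :+ x :+ con (+ 1)))) refl l₁)))
              (trans (+-congˡ (*-congˡ t²≈D)) (lc₁ (ι (+ 3) * l₁ + ι (+ 8)) root₁
                (solve 1 (λ x → ((x :- con (+ 1)) :* (con (+ 1) :- con (+ 5) :* x :- con (+ 2) :* (x :* x)) :+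
                    (:- con (+ 1) :- con (+ 3) :* x :- x :* x) :* (con (+ 5) :+ con (+ 2) :* x :- con (+ 3) :* (x :* x))) :- con (+ 2) :=
                  (con (+ 3) :* x :+ con (+ 8)) :* (x :* x :* x :- (x :* x :+ x :+ con (+ 1)))) refl l₁)))
              (t∤2 L)

          -- 8B is a sum of products of differences.
          slope∈ : ∀ {A B y₁ y₂ y₃} → y₁ ≈ A + B * l₁ → y₂ ≈ A + B * l₂ → y₃ ≈ A + B * l₃ →
                   y₁ ∈O L → y₂ ∈O L → y₃ ∈O L → B ∈O L
          slope∈ {A} {B} {y₁} {y₂} {y₃} p₁ p₂ p₃ q₁ q₂ q₃ =
            halve refl (halve refl (halve (begin
              ι (+ 2) * (ι (+ 2) * (ι (+ 2) * B))
                ≈⟨ lc₂ (- (ι (+ 2) * B * (l₁ + l₂ + l₃ + 1#))) (ι (+ 6) * B) e₁ e₂ (solve 4 (λ B a b c →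
                     con (+ 2) :* (con (+ 2) :* (con (+ 2) :* B)) :-
                     B :* ((b :- c) :* (b :- c) :+ (c :- a) :* (c :- a) :+ (a :- b) :* (a :- b)) :=
                     (:- (con (+ 2) :* B :* (a :+ b :+ c :+ con (+ 1)))) :* (a :+ b :+ c :- con (+ 1)) :+
                     con (+ 6) :* B :* (a :* b :+ a :* c :+ b :* c :- (:- con (+ 1)))) refl B l₁ l₂ l₃) ⟩
              B * ((l₂ - l₃) * (l₂ - l₃) + (l₃ - l₁) * (l₃ - l₁) + (l₁ - l₂) * (l₁ - l₂))
                ≈⟨ solve 5 (λ A B a b c →
                     B :* ((b :- c) :* (b :- c) :+ (c :- a) :* (c :- a) :+ (a :- b) :* (a :- b)) :=
                     (b :- c) :* ((A :+ B :* b) :- (A :+ B :* c)) :+ (c :- a) :* ((A :+ B :* c) :- (A :+ B :* a))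
                       :+ (a :- b) :* ((A :+ B :* a) :- (A :+ B :* b))) refl A B l₁ l₂ l₃ ⟩
              (l₂ - l₃) * ((A + B * l₂) - (A + B * l₃)) + (l₃ - l₁) * ((A + B * l₃) - (A + B * l₁))
                + (l₁ - l₂) * ((A + B * l₁) - (A + B * l₂))
                ≈⟨ sym (+-cong (+-cong (*-congˡ (+-cong p₂ (-‿cong p₃))) (*-congˡ (+-cong p₃ (-‿cong p₁))))
                     (*-congˡ (+-cong p₁ (-‿cong p₂)))) ⟩
              (l₂ - l₃) * (y₂ - y₃) + (l₃ - l₁) * (y₃ - y₁) + (l₁ - l₂) * (y₁ - y₂) ∎)
              (B-+ (B-+ (B-* (B-minus l₂∈ l₃∈) (B-minus q₂ q₃)) (B-* (B-minus l₃∈ (l₁∈ L)) (B-minus q₃ q₁)))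
                (B-* (B-minus (l₁∈ L) l₂∈) (B-minus q₁ q₂)))))

          module Contains (Y : Line l₁ l₂ l₃) (Y∈ : HasLine Y L) where
            open HasLine Y∈
            open Line Y
            private
              B∈ : B ∈O L
              B∈ = slope∈ line₁ line₂ line₃ y₁∈ y₂∈ y₃∈
              swap : ∀ {x y u v} → x ≈ A + B * u → y ≈ A + B * v → x ≈ y + (u - v) * B
              swap {x} {y} {u} {v} p q = trans p (trans
                (solve 4 (λ A B u v → A :+ B :* u := A :+ B :* v :+ (u :- v) :* B) refl A B u v)
                (+-congʳ (sym q)))
            U₂₃ : U (y₂ * y₃′)
            U₂₃ = U-quotient inverse₃ (swap line₂ line₃) B∈ y₃′∈
            U₃₂ : U (y₃ * y₂′)
            U₃₂ = U-quotient inverse₂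
                    (trans (swap line₃ line₂)
                      (+-congˡ (solve 3 (λ b c B → (c :- b) :* B := (b :- c) :* (:- B)) refl l₂ l₃ B)))
                    (B-neg B∈) y₂′∈

          -- Cross ratios of lines are unipotent, hence equal as soon as some
          -- powers of them are.
          rigid : (Y W : Line l₁ l₂ l₃) → HasLine Y L → HasLine W L → (e : ℕ) (j : ℤ) (N : ℕ) → ¬ N ≡ 0 →
            (Line.y₂ Y ^ e * (Line.y₃ W * l₃ ^^ j)) ^ N ≈ (Line.y₃ Y ^ e * (Line.y₂ W * l₂ ^^ j)) ^ N →
            Line.y₂ Y ^ e * (Line.y₃ W * l₃ ^^ j) ≈ Line.y₃ Y ^ e * (Line.y₂ W * l₂ ^^ j)
          rigid Y W Y∈ W∈ e j N N≢0 powers-equal = begin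
            y₂ ^ e * (w₃ * l₃ ^^ j)
              ≈⟨ sym (trans (*-congʳ denominator) (*-identityˡ _)) ⟩
            (y₃ ^ e * (w₂ * l₂ ^^ j) * d′) * (y₂ ^ e * (w₃ * l₃ ^^ j))
              ≈⟨ solve 3 (λ d d′ n → (d :* d′) :* n := d :* (n :* d′)) refl
                   (y₃ ^ e * (w₂ * l₂ ^^ j)) d′ (y₂ ^ e * (w₃ * l₃ ^^ j)) ⟩
            y₃ ^ e * (w₂ * l₂ ^^ j) * (y₂ ^ e * (w₃ * l₃ ^^ j) * d′)
              ≈⟨ trans (*-congˡ z≈1) (*-identityʳ _) ⟩
            y₃ ^ e * (w₂ * l₂ ^^ j) ∎
            where
            open Line Y
            open Line W using () renaming (y₂ to w₂; y₃ to w₃; y₂′ to w₂′; inverse₂ to inverseʷ₂)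
            module CY = Contains Y Y∈
            module CW = Contains W W∈
            d′ = y₃′ ^ e * (w₂′ * zp (κ l₂) l₂ j)

            denominator : y₃ ^ e * (w₂ * l₂ ^^ j) * d′ ≈ 1#
            denominator = begin
              y₃ ^ e * (w₂ * l₂ ^^ j) * (y₃′ ^ e * (w₂′ * zp (κ l₂) l₂ j))
                ≈⟨ trans (solve 5 (λ a w k a′ m → a :* (w :* k) :* (a′ :* m) := (a :* a′) :* ((w :* k) :* m))
                     refl (y₃ ^ e) w₂ (l₂ ^^ j) (y₃′ ^ e) (w₂′ * zp (κ l₂) l₂ j))
                   (*-cong (sym (^-distrib-* y₃ y₃′ e))
                     (solve 4 (λ w k w′ k′ → (w :* k) :* (w′ :* k′) := (w :* w′) :* (k :* k′)) refl w₂ (l₂ ^^ j) w₂′ (zp (κ l₂) l₂ j))) ⟩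
              (y₃ * y₃′) ^ e * ((w₂ * w₂′) * (l₂ ^^ j * zp (κ l₂) l₂ j))
                ≈⟨ *-cong (trans (^-congˡ e inverse₃) (1^n≈1 e)) (*-cong inverseʷ₂ (zp-inverse (κ-inverse root₂) j)) ⟩
              1# * (1# * 1#)
                ≈⟨ trans (*-identityˡ _) (*-identityˡ _) ⟩
              1# ∎

            Ul₃₂ : U (l₃ * κ l₂)
            Ul₃₂ = U-quotient (κ-inverse root₂)
              (solve 2 (λ b c → c := b :+ (b :- c) :* (:- con (+ 1))) refl l₂ l₃) (B-neg B-1) (κ∈ l₂∈)
            Ul₂₃ : U (l₂ * κ l₃)
            Ul₂₃ = U-quotient (κ-inverse root₃)
              (solve 2 (λ b c → b := c :+ (b :- c) :* con (+ 1)) refl l₂ l₃) B-1 (κ∈ l₃∈)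

            Uz : U (y₂ ^ e * (w₃ * l₃ ^^ j) * d′)
            Uz = U-resp (begin
              (y₂ * y₃′) ^ e * (w₃ * w₂′ * zp (l₃ * κ l₂) (κ l₃ * l₂) j)
                ≈⟨ *-cong (^-distrib-* y₂ y₃′ e) (*-congˡ (zp-distrib l₃ (κ l₃) (κ l₂) l₂ j)) ⟩
              (y₂ ^ e * y₃′ ^ e) * (w₃ * w₂′ * (l₃ ^^ j * zp (κ l₂) l₂ j))
                ≈⟨ *-congˡ (solve 4 (λ w w′ k k′ → w :* w′ :* (k :* k′) := (w :* k) :* (w′ :* k′)) refl w₃ w₂′ (l₃ ^^ j) (zp (κ l₂) l₂ j)) ⟩
              (y₂ ^ e * y₃′ ^ e) * ((w₃ * l₃ ^^ j) * (w₂′ * zp (κ l₂) l₂ j))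
                ≈⟨ solve 4 (λ a b c d → (a :* b) :* (c :* d) := a :* c :* (b :* d)) refl
                     (y₂ ^ e) (y₃′ ^ e) (w₃ * l₃ ^^ j) (w₂′ * zp (κ l₂) l₂ j) ⟩
              y₂ ^ e * (w₃ * l₃ ^^ j) * d′ ∎)
              (U-* (U-^ e CY.U₂₃) (U-* CW.U₃₂ (U-zp j Ul₃₂ (U-resp (*-comm l₂ (κ l₃)) Ul₂₃))))

            z≈1 : y₂ ^ e * (w₃ * l₃ ^^ j) * d′ ≈ 1#
            z≈1 = U-torsion-free N N≢0 Uz (begin
              (y₂ ^ e * (w₃ * l₃ ^^ j) * d′) ^ N             ≈⟨ ^-distrib-* _ d′ N ⟩
              (y₂ ^ e * (w₃ * l₃ ^^ j)) ^ N * d′ ^ N         ≈⟨ *-congʳ powers-equal ⟩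
              (y₃ ^ e * (w₂ * l₂ ^^ j)) ^ N * d′ ^ N         ≈⟨ sym (^-distrib-* _ d′ N) ⟩
              (y₃ ^ e * (w₂ * l₂ ^^ j) * d′) ^ N             ≈⟨ trans (^-congˡ N denominator) (1^n≈1 N) ⟩
              1#                                             ∎)

        tLattice : Extension unitLattice (t ∈O_)
        tLattice = adjoinRoot unitLattice t 1
          (order-resp (trans (sym t²≈D) (*-congˡ (sym (*-identityʳ t)))) (order-B (Λ⊂Λ₂ root₁ D∈Λ)))

        power-inverse : ∀ {l y y′} n M → l * κ l ≈ 1# → y * y′ ≈ 1# → y ^ suc n ≈ l ^^ M →
                        y′ ^ suc n ≈ zp (κ l) l M
        power-inverse {l} {y} {y′} n M lκ yy′ p = *-cancelˡ-≈ (^-≉0 (suc n) (unit-≉0 yy′)) (begin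
          y ^ suc n * y′ ^ suc n   ≈⟨ sym (^-distrib-* y y′ (suc n)) ⟩
          (y * y′) ^ suc n         ≈⟨ trans (^-congˡ (suc n) yy′) (1^n≈1 (suc n)) ⟩
          1#                       ≈⟨ sym (zp-inverse lκ M) ⟩
          l ^^ M * zp (κ l) l M    ≈⟨ *-congʳ (sym p) ⟩
          y ^ suc n * zp (κ l) l M ∎)

        adjoinLine : ∀ L → t ∈O L → (Y : Line l₁ l₂ l₃) → Extension L (HasLine Y)
        adjoinLine L t∈ Y = extension E.ext E.lift (collect E.holds)
          where
          open Line Y
          l₂∈ = Ring.l₂∈ L t∈
          l₃∈ = Ring.l₃∈ L t∈
          κ∈ : ∀ {l} → l ∈O L → κ l ∈O L
          κ∈ = Ring.κ∈ L t∈
          zp∈ : ∀ {x x′} → x ∈O L → x′ ∈O L → ∀ k → zp x x′ k ∈O L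
          zp∈ = Ring.zp∈ L t∈
          collect : ∀ {L′} → All (_∈O L′) (y₁ ∷ y₂ ∷ y₃ ∷ y₂′ ∷ y₃′ ∷ []) → HasLine Y L′
          collect (p₁ ∷ p₂ ∷ p₃ ∷ q₂ ∷ q₃ ∷ []) = hasLine p₁ p₂ p₃ q₂ q₃
          module E = Extension (adjoinRoots L (y₁ ∷ y₂ ∷ y₃ ∷ y₂′ ∷ y₃′ ∷ [])
            ( (n , order-resp (sym power₁) (zp∈ (l₁∈ L) (κ∈ (l₁∈ L)) M))
            ∷ (n , order-resp (sym power₂) (zp∈ l₂∈ (κ∈ l₂∈) M))
            ∷ (n , order-resp (sym power₃) (zp∈ l₃∈ (κ∈ l₃∈) M))
            ∷ (n , order-resp (sym (power-inverse n M (κ-inverse root₂) inverse₂ power₂)) (zp∈ (κ∈ l₂∈) l₂∈ M))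
            ∷ (n , order-resp (sym (power-inverse n M (κ-inverse root₃) inverse₃ power₃)) (zp∈ (κ∈ l₃∈) l₃∈ M))
            ∷ []))

        -- The integrality that `rigid` requires is obtained by adjoining t, whose square is D, and
        -- then the entries of both lines. The exponents e and j allow one statement to give
        -- uniqueness of a line, the removal of roots of unity and the comparison with `ωLine`;
        -- rotating the roots gives the other pairs of entries.
        rigidity : (Y W : Line l₁ l₂ l₃) (e : ℕ) (j : ℤ) (N : ℕ) → ¬ N ≡ 0 →
          (Line.y₂ Y ^ e * (Line.y₃ W * l₃ ^^ j)) ^ N ≈ (Line.y₃ Y ^ e * (Line.y₂ W * l₂ ^^ j)) ^ N →
          Line.y₂ Y ^ e * (Line.y₃ W * l₃ ^^ j) ≈ Line.y₃ Y ^ e * (Line.y₂ W * l₂ ^^ j)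
        rigidity Y W e j N =
          Ring.rigid E₂.ext (E₂.lift _ (E₁.lift _ E₀.holds)) Y W (liftLine E₂.lift E₁.holds) E₂.holds e j N
          where
          module E₀ = Extension tLattice
          module E₁ = Extension (adjoinLine E₀.ext E₀.holds Y)
          module E₂ = Extension (adjoinLine E₁.ext (E₁.lift _ E₀.holds) W)

    -- The ratio A : B is rational.

    module Rational where

      open Lines
      open Polynomials using (pow≈^; nthRoot; hasRoot; evL; _+ᴸ_; -ᴸ_; evL-+; evL-neg; evL-x; pv; Leading; leading; strip; stripL; Remainder; remainder; pseudoDivide; Division; division; divideBy; evZ)

      -- An integral polynomial in x and l, reduced modulo P(l). The point is that the same three
      -- integer polynomials in x serve all roots l.
      record Coef (f : Carrier → Carrier → Carrier) : Set (c ⊔ ℓ) where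
        constructor coef
        field
          h₀ h₁ h₂ : List ℤ
          value    : ∀ x {l} → Root l → f x l ≈ evL h₀ x + evL h₁ x * l + evL h₂ x * (l * l)

      private
        coef-l : ∀ {f} → Coef f → Coef (λ x l → l * f x l)
        coef-l (coef h₀ h₁ h₂ v) = coef h₂ (h₀ +ᴸ h₂) (h₁ +ᴸ h₂) λ x {l} r → begin
          _ ≈⟨ *-congˡ (v x r) ⟩
          l * (evL h₀ x + evL h₁ x * l + evL h₂ x * (l * l))
            ≈⟨ lc₁ (evL h₂ x) r (solve 4 (λ x a b c →
                 x :* (a :+ b :* x :+ c :* (x :* x)) :- (c :+ (a :+ c) :* x :+ (b :+ c) :* (x :* x)) :=
                 c :* (x :* x :* x :- (x :* x :+ x :+ con (+ 1)))) refl l (evL h₀ x) (evL h₁ x) (evL h₂ x)) ⟩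
          evL h₂ x + (evL h₀ x + evL h₂ x) * l + (evL h₁ x + evL h₂ x) * (l * l)
            ≈⟨ sym (+-cong (+-congˡ (*-congʳ (evL-+ h₀ h₂ x))) (*-congʳ (evL-+ h₁ h₂ x))) ⟩
          evL h₂ x + evL (h₀ +ᴸ h₂) x * l + evL (h₁ +ᴸ h₂) x * (l * l) ∎

        minus : ∀ g h x → evL (g +ᴸ (-ᴸ h)) x ≈ evL g x - evL h x
        minus g h x = trans (evL-+ g (-ᴸ h) x) (+-congˡ (evL-neg h x))

        coef-κ : ∀ {f} → Coef f → Coef (λ x l → κ l * f x l)
        coef-κ (coef h₀ h₁ h₂ v) = coef (h₁ +ᴸ (-ᴸ h₀)) (h₂ +ᴸ (-ᴸ h₀)) h₀ λ x {l} r → begin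
          _ ≈⟨ *-congˡ (v x r) ⟩
          κ l * (evL h₀ x + evL h₁ x * l + evL h₂ x * (l * l))
            ≈⟨ lc₁ (evL h₁ x + evL h₂ x * l) r (solve 4 (λ x a b c →
                 (x :* x :- x :- con (+ 1)) :* (a :+ b :* x :+ c :* (x :* x)) :- ((b :- a) :+ (c :- a) :* x :+ a :* (x :* x)) :=
                 (b :+ c :* x) :* (x :* x :* x :- (x :* x :+ x :+ con (+ 1)))) refl l (evL h₀ x) (evL h₁ x) (evL h₂ x)) ⟩
          (evL h₁ x - evL h₀ x) + (evL h₂ x - evL h₀ x) * l + evL h₀ x * (l * l)
            ≈⟨ sym (+-congʳ (+-cong (minus h₁ h₀ x) (*-congʳ (minus h₂ h₀ x)))) ⟩
          evL (h₁ +ᴸ (-ᴸ h₀)) x + evL (h₂ +ᴸ (-ᴸ h₀)) x * l + evL h₀ x * (l * l) ∎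

        coef-x : ∀ {f} → Coef f → Coef (λ x l → x * f x l)
        coef-x (coef h₀ h₁ h₂ v) = coef (+ 0 ∷ h₀) (+ 0 ∷ h₁) (+ 0 ∷ h₂) λ x {l} r → begin
          _ ≈⟨ *-congˡ (v x r) ⟩
          x * (evL h₀ x + evL h₁ x * l + evL h₂ x * (l * l))
            ≈⟨ solve 5 (λ l x a b c → x :* (a :+ b :* l :+ c :* (l :* l)) := (x :* a) :+ (x :* b) :* l :+ (x :* c) :* (l :* l))
                 refl l x (evL h₀ x) (evL h₁ x) (evL h₂ x) ⟩
          x * evL h₀ x + x * evL h₁ x * l + x * evL h₂ x * (l * l)
            ≈⟨ sym (+-cong (+-cong (evL-x h₀ x) (*-congʳ (evL-x h₁ x))) (*-congʳ (evL-x h₂ x))) ⟩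
          evL (+ 0 ∷ h₀) x + evL (+ 0 ∷ h₁) x * l + evL (+ 0 ∷ h₂) x * (l * l) ∎

        coef-+ : ∀ {f g} → Coef f → Coef g → Coef (λ x l → f x l + g x l)
        coef-+ (coef h₀ h₁ h₂ v) (coef g₀ g₁ g₂ w) = coef (h₀ +ᴸ g₀) (h₁ +ᴸ g₁) (h₂ +ᴸ g₂) λ x {l} r → begin
          _ ≈⟨ +-cong (v x r) (w x r) ⟩
          (evL h₀ x + evL h₁ x * l + evL h₂ x * (l * l)) + (evL g₀ x + evL g₁ x * l + evL g₂ x * (l * l))
            ≈⟨ solve 6 (λ a B C a′ B′ C′ → (a :+ B :+ C) :+ (a′ :+ B′ :+ C′) := (a :+ a′) :+ (B :+ B′) :+ (C :+ C′))
                 refl (evL h₀ x) (evL h₁ x * l) (evL h₂ x * (l * l)) (evL g₀ x) (evL g₁ x * l) (evL g₂ x * (l * l)) ⟩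
          (evL h₀ x + evL g₀ x) + (evL h₁ x * l + evL g₁ x * l) + (evL h₂ x * (l * l) + evL g₂ x * (l * l))
            ≈⟨ sym (+-cong (+-cong (evL-+ h₀ g₀ x) (trans (*-congʳ (evL-+ h₁ g₁ x)) (distribʳ l _ _)))
                 (trans (*-congʳ (evL-+ h₂ g₂ x)) (distribʳ (l * l) _ _))) ⟩
          evL (h₀ +ᴸ g₀) x + evL (h₁ +ᴸ g₁) x * l + evL (h₂ +ᴸ g₂) x * (l * l) ∎

        coef-resp : ∀ {f g} → (∀ x l → f x l ≈ g x l) → Coef f → Coef g
        coef-resp e (coef h₀ h₁ h₂ v) = coef h₀ h₁ h₂ λ x {l} r → trans (sym (e x l)) (v x r)

        coef-power : ∀ n → Coef (λ x l → (x + l) ^ n)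
        coef-power zero = coef (+ 1 ∷ []) [] [] λ x {l} r →
          solve 2 (λ x l → con (+ 1) := con (+ 1) :+ x :* con (+ 0) :+ con (+ 0) :* l :+ con (+ 0) :* (l :* l)) refl x l
        coef-power (suc n) = coef-resp (λ x l → sym (distribʳ ((x + l) ^ n) x l))
          (coef-+ (coef-x (coef-power n)) (coef-l (coef-power n)))

        iterateᶜ : ∀ {f} (g : Carrier → Carrier) → (∀ {f} → Coef f → Coef (λ x l → g l * f x l)) →
                   ∀ n → Coef f → Coef (λ x l → g l ^ n * f x l)
        iterateᶜ g step zero    C = coef-resp (λ x l → sym (*-identityˡ _)) C
        iterateᶜ g step (suc n) C = coef-resp (λ x l → sym (*-assoc (g l) (g l ^ n) _)) (step (iterateᶜ g step n C))

      coefficients : ∀ n k → Coef (λ x l → zp (κ l) l k * (x + l) ^ n)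
      coefficients n (+ k)    = iterateᶜ κ coef-κ k (coef-power n)
      coefficients n -[1+ k ] = iterateᶜ (λ l → l) coef-l (suc k) (coef-power n)

      module Solutions {l₁ l₂ l₃ : Carrier} (roots : Roots l₁ l₂ l₃) (n : ℕ) (K : ℤ) where
        open Roots roots
        open Coef (coefficients (suc n) K)

        F : Carrier → Carrier → Carrier
        F x l = zp (κ l) l K * (x + l) ^ suc n

        -- s stands for A/B. The factor u, common to the three roots, absorbs the power of B and the
        -- scalar that remains after the roots of unity are removed.
        record Sol (s : Carrier) : Set (c ⊔ ℓ) where
          constructor sol
          field
            u  : Carrier
            p₁ : (s + l₁) ^ suc n ≈ u * l₁ ^^ K
            p₂ : (s + l₂) ^ suc n ≈ u * l₂ ^^ K
            p₃ : (s + l₃) ^ suc n ≈ u * l₃ ^^ K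

        private
          κl : ∀ {l} → Root l → κ l * l ≈ 1#
          κl {l} r = trans (*-comm (κ l) l) (κ-inverse r)

          to : ∀ {s u l} → Root l → (s + l) ^ suc n ≈ u * l ^^ K → F s l ≈ u
          to {s} {u} {l} r p = begin
            zp (κ l) l K * (s + l) ^ suc n  ≈⟨ *-congˡ p ⟩
            zp (κ l) l K * (u * l ^^ K)     ≈⟨ solve 3 (λ a u b → a :* (u :* b) := u :* (a :* b)) refl (zp (κ l) l K) u (l ^^ K) ⟩
            u * (zp (κ l) l K * l ^^ K)     ≈⟨ *-congˡ (zp-inverse (κl r) K) ⟩
            u * 1#                          ≈⟨ *-identityʳ u ⟩
            u                               ∎

          from : ∀ {s u l} → Root l → F s l ≈ u → (s + l) ^ suc n ≈ u * l ^^ K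
          from {s} {u} {l} r p = begin
            (s + l) ^ suc n                              ≈⟨ sym (*-identityˡ _) ⟩
            1# * (s + l) ^ suc n                         ≈⟨ *-congʳ (sym (zp-inverse (κ-inverse r) K)) ⟩
            l ^^ K * zp (κ l) l K * (s + l) ^ suc n      ≈⟨ solve 3 (λ a b c → a :* b :* c := (b :* c) :* a) refl (l ^^ K) (zp (κ l) l K) _ ⟩
            F s l * l ^^ K                               ≈⟨ *-congʳ p ⟩
            u * l ^^ K                                   ∎

        vandermonde : ∀ {a b c u} → a + b * l₁ + c * (l₁ * l₁) ≈ u → a + b * l₂ + c * (l₂ * l₂) ≈ u →
                      a + b * l₃ + c * (l₃ * l₃) ≈ u → b ≈ 0# × c ≈ 0#
        vandermonde {a} {b} {c} {u} e₁ e₂ e₃ = b≈0 , c≈0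
          where
          secant : ∀ {x y} → ¬ x ≈ y → a + b * x + c * (x * x) ≈ u → a + b * y + c * (y * y) ≈ u → b + c * (x + y) ≈ 0#
          secant {x} {y} x≉y p q = cancelˡ {x - y} (λ e → x≉y (x-y≈0⇒x≈y e))
            (trans (solve 5 (λ a b c x y → (x :- y) :* (b :+ c :* (x :+ y)) :=
                (a :+ b :* x :+ c :* (x :* x)) :- (a :+ b :* y :+ c :* (y :* y))) refl a b c x y)
              (x≈y⇒x-y≈0 (trans p (sym q))))
          c≈0 : c ≈ 0#
          c≈0 = cancelˡ {l₂ - l₃} (λ e → l₂≉l₃ (x-y≈0⇒x≈y e))
            (trans (solve 5 (λ b c x y z → (y :- z) :* c := (b :+ c :* (x :+ y)) :- (b :+ c :* (x :+ z))) refl b c l₁ l₂ l₃)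
              (x≈y⇒x-y≈0 (trans (secant l₁≉l₂ e₁ e₂) (sym (secant l₁≉l₃ e₁ e₃)))))
          b≈0 : b ≈ 0#
          b≈0 = trans (sym (trans (+-congˡ (trans (*-congʳ c≈0) (zeroˡ _))) (+-identityʳ b))) (secant l₁≉l₂ e₁ e₂)

        -- `F s`, reduced modulo P, is a quadratic in l with the same value u at three distinct
        -- points, hence constant. Together with `⇒sol`, the solutions are exactly the common roots
        -- of the integer polynomials `h₁` and `h₂`.
        sol⇒ : ∀ {s} → Sol s → evL h₁ s ≈ 0# × evL h₂ s ≈ 0#
        sol⇒ {s} (sol u p₁ p₂ p₃) = vandermonde
          (trans (sym (value s root₁)) (to root₁ p₁)) (trans (sym (value s root₂)) (to root₂ p₂))
          (trans (sym (value s root₃)) (to root₃ p₃))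

        ⇒sol : ∀ {s} → evL h₁ s ≈ 0# → evL h₂ s ≈ 0# → Sol s
        ⇒sol {s} q₁ q₂ = sol (evL h₀ s) (at root₁) (at root₂) (at root₃)
          where
          at : ∀ {l} → Root l → (s + l) ^ suc n ≈ evL h₀ s * l ^^ K
          at {l} r = from r (trans (value s r) (trans (+-cong (+-congˡ (trans (*-congʳ q₁) (zeroˡ l))) (trans (*-congʳ q₂) (zeroˡ _)))
            (trans (+-identityʳ _) (+-identityʳ _))))

        private
          ^≈0 : ∀ {x} m → x ^ m ≈ 0# → x ≈ 0#
          ^≈0 m e = stable λ x≉0 → ^-≉0 m x≉0 e

          l^^-≉0 : ∀ {l} → Root l → ¬ l ^^ K ≈ 0#
          l^^-≉0 r = unit-≉0 (zp-inverse (κ-inverse r) K)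

        module Normalised {s : Carrier} (S : Sol s) where
          open Sol S

          u≉0 : ¬ u ≈ 0#
          u≉0 u≈0 = l₁≉l₂ (+-cancelˡ s (trans (zero-at p₁) (sym (zero-at p₂))))
            where
            zero-at : ∀ {l} → (s + l) ^ suc n ≈ u * l ^^ K → s + l ≈ 0#
            zero-at p = ^≈0 (suc n) (trans p (trans (*-congʳ u≈0) (zeroˡ _)))
            +-cancelˡ : ∀ a {x y} → a + x ≈ a + y → x ≈ y
            +-cancelˡ a {x} {y} e = lc₁ 1# e (solve 3 (λ a x y → x :- y := con (+ 1) :* ((a :+ x) :- (a :+ y))) refl a x y)

          v = proj₁ (nthRoot n u)
          v^≈u = proj₂ (nthRoot n u)

          v≉0 : ¬ v ≈ 0#
          v≉0 v≈0 = u≉0 (trans (sym v^≈u) (trans (*-congʳ v≈0) (zeroˡ _)))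

          v′ = inv v

          power : ∀ {l} → (s + l) ^ suc n ≈ u * l ^^ K → ((s + l) * v′) ^ suc n ≈ l ^^ K
          power {l} p = begin
            ((s + l) * v′) ^ suc n            ≈⟨ ^-distrib-* (s + l) v′ (suc n) ⟩
            (s + l) ^ suc n * v′ ^ suc n      ≈⟨ *-congʳ p ⟩
            u * l ^^ K * v′ ^ suc n           ≈⟨ *-congʳ (*-congʳ (sym v^≈u)) ⟩
            v ^ suc n * l ^^ K * v′ ^ suc n   ≈⟨ solve 3 (λ a b c → a :* b :* c := (a :* c) :* b) refl (v ^ suc n) (l ^^ K) (v′ ^ suc n) ⟩
            v ^ suc n * v′ ^ suc n * l ^^ K   ≈⟨ *-congʳ (sym (^-distrib-* v v′ (suc n))) ⟩
            (v * v′) ^ suc n * l ^^ K         ≈⟨ *-congʳ (trans (^-congˡ (suc n) (inverseʳ v v≉0)) (1^n≈1 (suc n))) ⟩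
            1# * l ^^ K                       ≈⟨ *-identityˡ _ ⟩
            l ^^ K                            ∎

          invertible : ∀ {l} → Root l → (s + l) ^ suc n ≈ u * l ^^ K → (s + l) * v′ * inv ((s + l) * v′) ≈ 1#
          invertible r p = inverseʳ _ λ e → l^^-≉0 r (trans (sym (power p)) (trans (*-congʳ e) (zeroˡ _)))

          line : Line l₁ l₂ l₃
          line = record
            { A = s * v′ ; B = v′ ; y₁ = (s + l₁) * v′ ; y₂ = (s + l₂) * v′ ; y₃ = (s + l₃) * v′
            ; y₁′ = inv ((s + l₁) * v′) ; y₂′ = inv ((s + l₂) * v′) ; y₃′ = inv ((s + l₃) * v′)
            ; n = n ; M = K
            ; inverse₁ = invertible root₁ p₁ ; inverse₂ = invertible root₂ p₂ ; inverse₃ = invertible root₃ p₃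
            ; power₁ = power p₁ ; power₂ = power p₂ ; power₃ = power p₃
            ; line₁ = expand l₁ ; line₂ = expand l₂ ; line₃ = expand l₃ }
            where
            expand : ∀ l → (s + l) * v′ ≈ s * v′ + v′ * l
            expand l = solve 3 (λ s l v → (s :+ l) :* v := s :* v :+ v :* l) refl s l v′

          v′≉0 : ¬ v′ ≈ 0#
          v′≉0 e = 0≉1 (trans (sym (trans (*-congˡ e) (zeroʳ v))) (inverseʳ v v≉0))

        -- By rigidity the two normalised lines have the same ratio of entries at l₂ and l₃, and (s
        -- + l₂)(s′ + l₃) - (s + l₃)(s′ + l₂) = (l₃ - l₂)(s - s′).
        unique : ∀ {s s′} → Sol s → Sol s′ → s ≈ s′
        unique {s} {s′} S S′ = x-y≈0⇒x≈y (cancelˡ (*-≉0 (*-≉0 N.v′≉0 N′.v′≉0) (λ e → l₂≉l₃ (sym (x-y≈0⇒x≈y e)))) (begin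
          N.v′ * N′.v′ * (l₃ - l₂) * (s - s′)
            ≈⟨ solve 6 (λ v v′ l₂ l₃ s s′ → v :* v′ :* (l₃ :- l₂) :* (s :- s′) :=
                 (s :+ l₂) :* v :* ((s′ :+ l₃) :* v′) :- (s :+ l₃) :* v :* ((s′ :+ l₂) :* v′)) refl N.v′ N′.v′ l₂ l₃ s s′ ⟩
          (s + l₂) * N.v′ * ((s′ + l₃) * N′.v′) - (s + l₃) * N.v′ * ((s′ + l₂) * N′.v′)
            ≈⟨ x≈y⇒x-y≈0 (trans (sym (pad _ _)) (trans equal (pad _ _))) ⟩
          0# ∎))
          where
          module N = Normalised S
          module N′ = Normalised S′
          open Sol S
          open Sol S′ using () renaming (p₂ to p₂′; p₃ to p₃′)
          pad : ∀ a b → a ^ 1 * (b * 1#) ≈ a * b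
          pad a b = *-cong (*-identityʳ a) (*-identityʳ b)
          both : ∀ a b → (a ^ 1 * (b * 1#)) ^ suc n ≈ a ^ suc n * b ^ suc n
          both a b = trans (^-congˡ (suc n) (pad a b)) (^-distrib-* a b (suc n))
          equal : ((s + l₂) * N.v′) ^ 1 * ((s′ + l₃) * N′.v′ * 1#) ≈ ((s + l₃) * N.v′) ^ 1 * ((s′ + l₂) * N′.v′ * 1#)
          equal = At.rigidity roots N.line N′.line 1 (+ 0) (suc n) (λ ()) (begin
            (((s + l₂) * N.v′) ^ 1 * ((s′ + l₃) * N′.v′ * 1#)) ^ suc n
              ≈⟨ both ((s + l₂) * N.v′) ((s′ + l₃) * N′.v′) ⟩
            ((s + l₂) * N.v′) ^ suc n * ((s′ + l₃) * N′.v′) ^ suc n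
              ≈⟨ trans (*-cong (N.power p₂) (N′.power p₃′)) (*-comm _ _) ⟩
            l₃ ^^ K * l₂ ^^ K
              ≈⟨ sym (*-cong (N.power p₃) (N′.power p₂′)) ⟩
            ((s + l₃) * N.v′) ^ suc n * ((s′ + l₂) * N′.v′) ^ suc n
              ≈⟨ sym (both ((s + l₃) * N.v′) ((s′ + l₂) * N′.v′)) ⟩
            (((s + l₃) * N.v′) ^ 1 * ((s′ + l₂) * N′.v′ * 1#)) ^ suc n ∎)

        IsRational : Carrier → Set ℓ
        IsRational s = ∃ λ p → ∃ λ q → ¬ q ≡ + 0 × ι q * s ≈ ι p

        -- An annihilating polynomial of minimal degree divides h₁ and h₂, so
        -- all its roots are solutions; if it is not linear then s is a double
        -- root, and its derivative annihilates s.
        annihilated⇒rational : ∀ {s} → Sol s → ∀ m (as : Vec ℤ m) a → ¬ a ≡ + 0 → pv as a s ≈ 0# → ¬ ¬ IsRational s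
        annihilated⇒rational {s} S = <-rec _ step
          where
          Claim : ℕ → Set ℓ
          Claim m = ∀ (as : Vec ℤ m) a → ¬ a ≡ + 0 → pv as a s ≈ 0# → ¬ ¬ IsRational s
          ^k≉0 : ∀ {a} k → ¬ a ≡ + 0 → ¬ ι a ^ k ≈ 0#
          ^k≉0 {a} k a≢0 = ^-≉0 k (ι≉0 a a≢0)
          step : ∀ m → (∀ {j} → j ℕ.< m → Claim j) → Claim m
          step zero rec [] a a≢0 e _ = ι≉0 a a≢0 (trans (sym (trans (+-identityˡ _) (*-identityʳ (ι a)))) e)
          step (suc zero) rec (b ∷ []) a a≢0 e irr = irr (ℤ.- b , a , a≢0 , trans
            (lc₁ 1# e (solve 3 (λ a b s → a :* s :- (:- b) := con (+ 1) :* (b :+ s :* con (+ 0) :+ a :* (s :* con (+ 1)) :- con (+ 0)))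
              refl (ι a) (ι b) s)) (sym (ι-neg b)))
          step (suc (suc m)) rec as a a≢0 e irr = cases (strip (Remainder.rem R₁)) (strip (Remainder.rem R₂))
            where
            R₁ = pseudoDivide as a h₁
            R₂ = pseudoDivide as a h₂
            smaller : ∀ {h} (Q : Remainder as a h) → evL h s ≈ 0# → Leading (evZ (Remainder.rem Q)) (suc (suc m)) → ⊥
            smaller (remainder k r equal) h≈0 (leading d< b b≢0 bs agrees) = rec d< bs b b≢0
              (trans (sym (agrees s)) (trans (sym (equal s e)) (trans (*-congˡ h≈0) (zeroʳ _)))) irr
            vanish : ∀ {h} (Q : Remainder as a h) → (∀ x → evZ (Remainder.rem Q) x ≈ 0#) → ∀ x → pv as a x ≈ 0# → evL h x ≈ 0#
            vanish (remainder k r equal) z x fx = cancelˡ (^k≉0 k a≢0) (trans (equal x fx) (z x))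
            open Division (divideBy as a s)
            second = hasRoot m quotient (ι≉0 a a≢0)
            x = proj₁ second
            fx≈0 : pv as a x ≈ 0#
            fx≈0 = trans (x-y≈0⇒x≈y (trans (divides x) (trans (*-congˡ (proj₂ second)) (zeroʳ _)))) e
            cases : (∀ x → evZ (Remainder.rem R₁) x ≈ 0#) ⊎ Leading (evZ (Remainder.rem R₁)) (suc (suc m)) →
                    (∀ x → evZ (Remainder.rem R₂) x ≈ 0#) ⊎ Leading (evZ (Remainder.rem R₂)) (suc (suc m)) → ⊥
            cases (inj₂ L) _ = smaller R₁ (proj₁ (sol⇒ S)) L
            cases _ (inj₂ L) = smaller R₂ (proj₂ (sol⇒ S)) L
            cases (inj₁ z₁) (inj₁ z₂) = rec ℕP.≤-refl derivative (+ suc (suc m) ℤ.* a)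
              (λ z → a≢0 (ℤP.*-cancelˡ-≡ (+ suc (suc m)) a (+ 0) (≡.trans z (≡.sym (ℤP.*-zeroʳ (+ suc (suc m)))))))
              (trans (sym atPoint) (trans (+-cong (evC-at quotient (unique S (⇒sol (vanish R₁ z₁ x fx≈0) (vanish R₂ z₂ x fx≈0))))
                (*-congˡ (^-congˡ (suc m) (unique S (⇒sol (vanish R₁ z₁ x fx≈0) (vanish R₂ z₂ x fx≈0)))))) (proj₂ second))) irr
              where
              evC-at : ∀ {n} (q : Vec Carrier n) {x y} → x ≈ y → evalPoly R q x ≈ evalPoly R q y
              evC-at []      p = refl
              evC-at (b ∷ q) p = +-congˡ (*-cong p (evC-at q p))

        rational : ∀ {s} → Sol s → ¬ ¬ IsRational s
        rational {s} S = initial (stripL h₁) (stripL h₂)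
          where
          initial : (∀ x → evL h₁ x ≈ 0#) ⊎ ∃ (Leading (evL h₁)) → (∀ x → evL h₂ x ≈ 0#) ⊎ ∃ (Leading (evL h₂)) → ¬ ¬ IsRational s
          initial (inj₂ (_ , leading _ a a≢0 as agrees)) _ =
            annihilated⇒rational S _ as a a≢0 (trans (sym (agrees s)) (proj₁ (sol⇒ S)))
          initial _ (inj₂ (_ , leading _ a a≢0 as agrees)) =
            annihilated⇒rational S _ as a a≢0 (trans (sym (agrees s)) (proj₂ (sol⇒ S)))
          -- If both polynomials vanished identically, everything would be a solution, even -l₁; but
          -- there s + l₁ = 0 forces u = 0.
          initial (inj₁ z₁) (inj₁ z₂) = ⊥-elim (Normalised.u≉0 T u₀≈0)
            where
            T : Sol (- l₁)
            T = ⇒sol (z₁ (- l₁)) (z₂ (- l₁))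
            u₀≈0 : Sol.u T ≈ 0#
            u₀≈0 = cancelˡ (l^^-≉0 root₁) (trans (*-comm _ _) (trans (sym (Sol.p₁ T))
              (trans (*-congʳ (-‿inverseˡ l₁)) (zeroˡ _))))

    -- A unit whose ℓ-th power is λ³ forces ℓ = 1 or ℓ = 3.

    module Exponent where

      open Lines
      open Rational
      open Zeros using (evT; module OverRoot)
      open Coordinates
      open PowerSums

      private
        newton : ∀ {a b d u v} → a + b + d ≈ ι u → a * b + a * d + b * d ≈ ι v → a * b * d ≈ 1# →
                 ∀ k → a ^ k + b ^ k + d ^ k ≈ ι (psum u v k)
        newton E₁ E₂ E₃ 0 = refl
        newton {a} {b} {d} E₁ E₂ E₃ 1 = trans (+-cong (+-cong (*-identityʳ a) (*-identityʳ b)) (*-identityʳ d)) E₁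
        newton {a} {b} {d} {u} {v} E₁ E₂ E₃ 2 = begin
          a ^ 2 + b ^ 2 + d ^ 2
            ≈⟨ solve 3 (λ a b d → a :^ 2 :+ b :^ 2 :+ d :^ 2 := (a :+ b :+ d) :* (a :+ b :+ d) :- con (+ 2) :* (a :* b :+ a :* d :+ b :* d)) refl a b d ⟩
          (a + b + d) * (a + b + d) - ι (+ 2) * (a * b + a * d + b * d)
            ≈⟨ +-cong (*-cong E₁ E₁) (-‿cong (*-congˡ E₂)) ⟩
          ι u * ι u - ι (+ 2) * ι v
            ≈⟨ sym (ι≈ (⌜ u ⌝ ⊗ ⌜ u ⌝ ⊝ ⌜ + 2 ⌝ ⊗ ⌜ v ⌝)) ⟩
          ι (u ℤ.* u ℤ.- + 2 ℤ.* v) ∎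
        newton {a} {b} {d} {u} {v} E₁ E₂ E₃ (suc (suc (suc k))) = begin
          a * (a * (a * a ^ k)) + b * (b * (b * b ^ k)) + d * (d * (d * d ^ k))
            ≈⟨ +-cong (+-cong (cubic a b d (a ^ k)) (trans (cubic b a d (b ^ k)) (swap₁ (b ^ k))))
                 (trans (cubic d a b (d ^ k)) (swap₂ (d ^ k))) ⟩
          term a (a ^ k) + term b (b ^ k) + term d (d ^ k)
            ≈⟨ +-cong (+-cong (replace a (a ^ k)) (replace b (b ^ k))) (replace d (d ^ k)) ⟩
          term′ a (a ^ k) + term′ b (b ^ k) + term′ d (d ^ k)
            ≈⟨ gather (ι u) (ι v) (a * (a * a ^ k)) (a * a ^ k) (a ^ k) (b * (b * b ^ k)) (b * b ^ k) (b ^ k)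
                 (d * (d * d ^ k)) (d * d ^ k) (d ^ k) ⟩
          ι u * (a ^ suc (suc k) + b ^ suc (suc k) + d ^ suc (suc k)) - ι v * (a ^ suc k + b ^ suc k + d ^ suc k) + (a ^ k + b ^ k + d ^ k)
            ≈⟨ +-cong (+-cong (*-congˡ (newton E₁ E₂ E₃ (suc (suc k)))) (-‿cong (*-congˡ (newton E₁ E₂ E₃ (suc k))))) (newton E₁ E₂ E₃ k) ⟩
          ι u * ι (psum u v (suc (suc k))) - ι v * ι (psum u v (suc k)) + ι (psum u v k)
            ≈⟨ sym (ι≈ (⌜ u ⌝ ⊗ ⌜ psum u v (suc (suc k)) ⌝ ⊝ ⌜ v ⌝ ⊗ ⌜ psum u v (suc k) ⌝ ⊕ ⌜ psum u v k ⌝)) ⟩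
          ι (u ℤ.* psum u v (suc (suc k)) ℤ.- v ℤ.* psum u v (suc k) ℤ.+ psum u v k) ∎
          where
          term : Carrier → Carrier → Carrier
          term x p = (a + b + d) * (x * (x * p)) - (a * b + a * d + b * d) * (x * p) + a * b * d * p
          term′ : Carrier → Carrier → Carrier
          term′ x p = ι u * (x * (x * p)) - ι v * (x * p) + p
          cubic : ∀ a b d p → a * (a * (a * p)) ≈ (a + b + d) * (a * (a * p)) - (a * b + a * d + b * d) * (a * p) + a * b * d * p
          cubic a b d p = solve 4 (λ a b d p → a :* (a :* (a :* p)) := (a :+ b :+ d) :* (a :* (a :* p)) :- (a :* b :+ a :* d :+ b :* d) :* (a :* p) :+ a :* b :* d :* p) refl a b d p
          swap₁ : ∀ p → (b + a + d) * (b * (b * p)) - (b * a + b * d + a * d) * (b * p) + b * a * d * p ≈ term b p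
          swap₁ p = solve 4 (λ a b d p → (b :+ a :+ d) :* (b :* (b :* p)) :- (b :* a :+ b :* d :+ a :* d) :* (b :* p) :+ b :* a :* d :* p :=
            (a :+ b :+ d) :* (b :* (b :* p)) :- (a :* b :+ a :* d :+ b :* d) :* (b :* p) :+ a :* b :* d :* p) refl a b d p
          swap₂ : ∀ p → (d + a + b) * (d * (d * p)) - (d * a + d * b + a * b) * (d * p) + d * a * b * p ≈ term d p
          swap₂ p = solve 4 (λ a b d p → (d :+ a :+ b) :* (d :* (d :* p)) :- (d :* a :+ d :* b :+ a :* b) :* (d :* p) :+ d :* a :* b :* p :=
            (a :+ b :+ d) :* (d :* (d :* p)) :- (a :* b :+ a :* d :+ b :* d) :* (d :* p) :+ a :* b :* d :* p) refl a b d p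
          replace : ∀ x p → term x p ≈ term′ x p
          replace x p = +-cong (+-cong (*-congʳ E₁) (-‿cong (*-congʳ E₂))) (trans (*-congʳ E₃) (*-identityˡ p))
          gather : ∀ u v a₂ a₁ a₀ b₂ b₁ b₀ d₂ d₁ d₀ →
            (u * a₂ - v * a₁ + a₀) + (u * b₂ - v * b₁ + b₀) + (u * d₂ - v * d₁ + d₀) ≈
            u * (a₂ + b₂ + d₂) - v * (a₁ + b₁ + d₁) + (a₀ + b₀ + d₀)
          gather u v a₂ a₁ a₀ b₂ b₁ b₀ d₂ d₁ d₀ = begin
            (u * a₂ - v * a₁ + a₀) + (u * b₂ - v * b₁ + b₀) + (u * d₂ - v * d₁ + d₀)
              ≈⟨ +-congʳ (pair (u * a₂) (v * a₁) a₀ (u * b₂) (v * b₁) b₀) ⟩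
            ((u * a₂ + u * b₂) - (v * a₁ + v * b₁) + (a₀ + b₀)) + (u * d₂ - v * d₁ + d₀)
              ≈⟨ pair (u * a₂ + u * b₂) (v * a₁ + v * b₁) (a₀ + b₀) (u * d₂) (v * d₁) d₀ ⟩
            (u * a₂ + u * b₂ + u * d₂) - (v * a₁ + v * b₁ + v * d₁) + (a₀ + b₀ + d₀)
              ≈⟨ +-congʳ (+-cong (sum3 u a₂ b₂ d₂) (-‿cong (sum3 v a₁ b₁ d₁))) ⟩
            u * (a₂ + b₂ + d₂) - v * (a₁ + b₁ + d₁) + (a₀ + b₀ + d₀) ∎
            where
            pair : ∀ A B C A′ B′ C′ → (A - B + C) + (A′ - B′ + C′) ≈ (A + A′) - (B + B′) + (C + C′)
            pair A B C A′ B′ C′ = solve 6 (λ A B C A′ B′ C′ → (A :- B :+ C) :+ (A′ :- B′ :+ C′) := (A :+ A′) :- (B :+ B′) :+ (C :+ C′)) refl A B C A′ B′ C′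
            sum3 : ∀ u a b d → u * a + u * b + u * d ≈ u * (a + b + d)
            sum3 u a b d = solve 4 (λ u a b d → u :* a :+ u :* b :+ u :* d := u :* (a :+ b :+ d)) refl u a b d

      module _ {l₁ l₂ l₃ : Carrier} (roots : Roots l₁ l₂ l₃) where
        open Roots roots
        open Lattices
        -- Over ℤ[l₁] this time, without inverting 2, since the power sums have to be rational
        -- integers.
        open Over (Λ-isSubring root₁)
        private module Λ₁ = IsSubring (Λ-isSubring root₁)

        trace : ∀ e → ∃ λ i → evT l₁ e + evT l₂ e + evT l₃ e ≈ ι i
        trace (triple a b k) = + 3 ℤ.* a ℤ.+ b ℤ.+ + 3 ℤ.* k , (begin
          ev l₁ a b k + ev l₂ a b k + ev l₃ a b k
            ≈⟨ lc₂ (ι b + ι k * (l₁ + l₂ + l₃ + 1#)) (- (ι (+ 2) * ι k)) e₁ e₂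
                 (solve 6 (λ x y z a b k → (a :+ b :* x :+ k :* (x :* x)) :+ (a :+ b :* y :+ k :* (y :* y)) :+ (a :+ b :* z :+ k :* (z :* z))
                     :- (con (+ 3) :* a :+ b :+ con (+ 3) :* k) :=
                   (b :+ k :* (x :+ y :+ z :+ con (+ 1))) :* (x :+ y :+ z :- con (+ 1)) :+
                   (:- (con (+ 2) :* k)) :* (x :* y :+ x :* z :+ y :* z :- (:- con (+ 1)))) refl l₁ l₂ l₃ (ι a) (ι b) (ι k)) ⟩
          ι (+ 3) * ι a + ι b + ι (+ 3) * ι k
            ≈⟨ sym (ι≈ (⌜ + 3 ⌝ ⊗ ⌜ a ⌝ ⊕ ⌜ b ⌝ ⊕ ⌜ + 3 ⌝ ⊗ ⌜ k ⌝)) ⟩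
          ι (+ 3 ℤ.* a ℤ.+ b ℤ.+ + 3 ℤ.* k) ∎)

        private
          O-B : ∀ L → IsSubring (_∈O L)
          O-B L = record
            { B-resp = order-resp ; B-+ = order-+ ; B-* = order-*
            ; B-neg = λ {x} f → order-resp (solve 1 (λ x → con (ℤ.- + 1) :* x := :- x) refl x)
                (order-* (order-B (Λ₁.B-neg Λ₁.B-1)) f)
            ; B-0 = order-B Λ₁.B-0 ; B-1 = order-B Λ₁.B-1 }

          adjoinRootOfP : ∀ L {l} → Root l → Extension L (l ∈O_)
          adjoinRootOfP L {l} r = adjoin L l 2 λ {s} S → span-resp
            (lc₁ (- s) r (solve 2 (λ l s → (s :+ l :* s :+ l :* (l :* s)) :- l :^ 3 :* s :=
              :- s :* (l :* l :* l :- (l :* l :+ l :+ con (+ 1)))) refl l s))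
            (span-+ (span-+ (span-++ˡ _ S) (adj-* l V 2 (span-++ˡ _ S)))
              (adj-* l V 2 (adj-* l V 1 (span-++ˡ _ S))))
            where V = Lattice.gens L

        -- Let d x = p′ in lowest terms and y d + z p′ = 1. Then d(y + z x) = 1, so d has an
        -- integral inverse and is a unit of ℤ[l₁]; comparing the constant coordinates gives d = 1.
        rational-integral⇒integer : ∀ L {x} → x ∈O L → ∀ p q → ¬ q ≡ + 0 → ι q * x ≈ ι p → ∃ λ i → x ≈ ι i
        rational-integral⇒integer L {x} x∈ p q q≢0 e =
          reduced (lowestTerms p q q≢0)
          where
          reduced : LowestTerms p q → ∃ λ i → x ≈ ι i
          reduced (lowest p′ d g cop g≢0 ep eq) = denominator d p′ (bézoutℕ p′ d cop) dx≈p′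
            where
            dx≈p′ : ι (+ suc d) * x ≈ ι p′
            dx≈p′ = *-cancelˡ-≈ (ι≉0 g g≢0) (begin
              ι g * (ι (+ suc d) * x)  ≈⟨ solve 3 (λ g d x → g :* (d :* x) := (d :* g) :* x) refl (ι g) (ι (+ suc d)) x ⟩
              ι (+ suc d) * ι g * x    ≈⟨ *-congʳ (trans (sym (ι-* (+ suc d) g)) (ι-cong (≡.sym eq))) ⟩
              ι q * x                  ≈⟨ trans e (trans (ι-cong ep) (ι-* p′ g)) ⟩
              ι p′ * ι g               ≈⟨ *-comm _ _ ⟩
              ι g * ι p′               ∎)
            denominator : ∀ d p′ → (∃ λ y → ∃ λ z → y ℤ.* + suc d ℤ.+ p′ ℤ.* + z ≡ + 1) → ι (+ suc d) * x ≈ ι p′ → ∃ λ i → x ≈ ι i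
            denominator d p′ (y , z , eq) dx = unit d dx (inverse⇒ L {ι y + ι (+ z) * x}
                (order-+ (order-B (Λ₁.B-ι y)) (order-* (order-B (Λ₁.B-ι (+ z))) x∈)) (begin
                  ι (+ suc d) * (ι y + ι (+ z) * x)
                    ≈⟨ solve 4 (λ d y z x → d :* (y :+ z :* x) := y :* d :+ (d :* x) :* z) refl (ι (+ suc d)) (ι y) (ι (+ z)) x ⟩
                  ι y * ι (+ suc d) + ι (+ suc d) * x * ι (+ z)
                    ≈⟨ +-congˡ (*-congʳ dx) ⟩
                  ι y * ι (+ suc d) + ι p′ * ι (+ z)
                    ≈⟨ sym (ι≈ (⌜ y ⌝ ⊗ ⌜ + suc d ⌝ ⊕ ⌜ p′ ⌝ ⊗ ⌜ + z ⌝)) ⟩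
                  ι (y ℤ.* + suc d ℤ.+ p′ ℤ.* + z)
                    ≈⟨ ι-cong eq ⟩
                  1# ∎))
              where
              open Nakayama (Λ₁.B-ι (+ suc d))
              unit : ∀ d → ι (+ suc d) * x ≈ ι p′ → (∃ λ g → Λ l₁ g × 1# + ι (+ suc d) * g ≈ 0#) → ∃ λ i → x ≈ ι i
              unit zero    dx _ = p′ , trans (sym (*-identityˡ x)) dx
              unit (suc d) _ (g , coords a b k e , z) = ⊥-elim (impossible (proj₁ (independent root₁
                  (+ 1 ℤ.+ + suc (suc d) ℤ.* a) (+ suc (suc d) ℤ.* b) (+ suc (suc d) ℤ.* k) (begin
                    ev l₁ (+ 1 ℤ.+ + suc (suc d) ℤ.* a) (+ suc (suc d) ℤ.* b) (+ suc (suc d) ℤ.* k)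
                      ≈⟨ +-cong (+-cong (ι≈ (⌜ + 1 ⌝ ⊕ ⌜ + suc (suc d) ⌝ ⊗ ⌜ a ⌝)) (*-congʳ (ι-* (+ suc (suc d)) b))) (*-congʳ (ι-* (+ suc (suc d)) k)) ⟩
                    (1# + ι (+ suc (suc d)) * ι a) + ι (+ suc (suc d)) * ι b * l₁ + ι (+ suc (suc d)) * ι k * (l₁ * l₁)
                      ≈⟨ solve 5 (λ l D a b k → (con (+ 1) :+ D :* a) :+ D :* b :* l :+ D :* k :* (l :* l) := con (+ 1) :+ D :* (a :+ b :* l :+ k :* (l :* l)))
                           refl l₁ (ι (+ suc (suc d))) (ι a) (ι b) (ι k) ⟩
                    1# + ι (+ suc (suc d)) * ev l₁ a b k
                      ≈⟨ +-congˡ (*-congˡ (sym e)) ⟩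
                    1# + ι (+ suc (suc d)) * g
                      ≈⟨ z ⟩
                    0# ∎))))
                where
                impossible : + 1 ℤ.+ + suc (suc d) ℤ.* a ≡ + 0 → ⊥
                impossible e = big (ℕP.m*n≡1⇒m≡1 (suc (suc d)) ℤ.∣ a ∣ (≡.trans (≡.sym (ℤP.abs-* (+ suc (suc d)) a))
                  (≡.trans (≡.cong ℤ.∣_∣ (isolate (+ suc (suc d) ℤ.* a) e)) ≡.refl)))
                  where
                  big : suc (suc d) ≡ 1 → ⊥
                  big ()
                  isolate : ∀ x → + 1 ℤ.+ x ≡ + 0 → x ≡ -[1+ 0 ]
                  isolate x e = ≡.trans (≡.sym (≡.trans (≡.sym (ℤP.+-assoc (ℤ.- + 1) (+ 1) x)) (ℤP.+-identityˡ x)))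
                    (≡.cong (λ y → ℤ.- + 1 ℤ.+ y) e)

        module RootsOfCubes {n : ℕ} {υ₁ υ₂ υ₃ : Carrier}
          (r₁ : υ₁ ^ suc n ≈ l₁ ^ 3) (r₂ : υ₂ ^ suc n ≈ l₂ ^ 3) (r₃ : υ₃ ^ suc n ≈ l₃ ^ 3)
          (υυυ≈1 : υ₁ * υ₂ * υ₃ ≈ 1#)
          {p₁ p₂ q : ℤ} (q≢0 : ¬ q ≡ + 0)
          (rational₁ : ι q * (υ₁ + υ₂ + υ₃) ≈ ι p₁)
          (rational₂ : ι q * (υ₁ * υ₂ + υ₁ * υ₃ + υ₂ * υ₃) ≈ ι p₂) where

          private
            module E₂ = Extension (adjoinRootOfP unitLattice root₂)
            module E₃ = Extension (adjoinRootOfP E₂.ext root₃)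
            cube∈ : ∀ {l} → l ∈O E₃.ext → l ^ 3 ∈O E₃.ext
            cube∈ = IsSubring.B-^ (O-B E₃.ext) 3
            module E = Extension (adjoinRoots E₃.ext (υ₁ ∷ υ₂ ∷ υ₃ ∷ [])
              ( (n , order-resp (sym r₁) (cube∈ (order-B (Λ-x root₁))))
              ∷ (n , order-resp (sym r₂) (cube∈ (E₃.lift _ E₂.holds)))
              ∷ (n , order-resp (sym r₃) (cube∈ E₃.holds)) ∷ []))

            elementary : All (_∈O E.ext) (υ₁ ∷ υ₂ ∷ υ₃ ∷ []) →
              (υ₁ + υ₂ + υ₃ ∈O E.ext) × (υ₁ * υ₂ + υ₁ * υ₃ + υ₂ * υ₃ ∈O E.ext)
            elementary (a ∷ b ∷ d ∷ []) = order-+ (order-+ a b) d ,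
              order-+ (order-+ (order-* a b) (order-* a d)) (order-* b d)

            U = rational-integral⇒integer E.ext (proj₁ (elementary E.holds)) p₁ q q≢0 rational₁
            V = rational-integral⇒integer E.ext (proj₂ (elementary E.holds)) p₂ q q≢0 rational₂
            u = proj₁ U
            v = proj₁ V

            seven : psum u v (suc n) ≡ + 7
            seven = ι-injective _ (+ 7) (begin
              ι (psum u v (suc n))                     ≈⟨ sym (newton (proj₂ U) (proj₂ V) υυυ≈1 (suc n)) ⟩
              υ₁ ^ suc n + υ₂ ^ suc n + υ₃ ^ suc n     ≈⟨ +-cong (+-cong r₁ r₂) r₃ ⟩
              l₁ ^ 3 + l₂ ^ 3 + l₃ ^ 3                 ≈⟨ newton {u = + 1} {v = ℤ.- + 1} e₁ e₂ e₃ 3 ⟩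
              ι (+ 7)                                  ∎)

            -- As a b d = 1, the products of pairs are the inverses of a, b, d. Passing to inverses
            -- interchanges the first two elementary symmetric functions, and so u and v.
            dual : ∀ {a b d u v} → a + b + d ≈ ι u → a * b + a * d + b * d ≈ ι v → a * b * d ≈ 1# →
                   ∀ k → (b * d) ^ k + (a * d) ^ k + (a * b) ^ k ≈ ι (psum v u k)
            dual {a} {b} {d} {u} {v} E₁ E₂ E₃ = newton
              (trans (solve 3 (λ a b d → b :* d :+ a :* d :+ a :* b := a :* b :+ a :* d :+ b :* d) refl a b d) E₂)
              (trans (solve 3 (λ a b d → b :* d :* (a :* d) :+ b :* d :* (a :* b) :+ a :* d :* (a :* b) := a :* b :* d :* (a :+ b :+ d)) refl a b d)
                (trans (*-cong E₃ E₁) (*-identityˡ _)))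
              (trans (solve 3 (λ a b d → b :* d :* (a :* d) :* (a :* b) := a :* b :* d :* (a :* b :* d)) refl a b d)
                (trans (*-cong E₃ E₃) (*-identityˡ 1#)))

            product : ∀ {x y l m} → x ^ suc n ≈ l ^ 3 → y ^ suc n ≈ m ^ 3 → (x * y) ^ suc n ≈ (l * m) ^ 3
            product {x} {y} {l} {m} p q = trans (^-distrib-* x y (suc n)) (trans (*-cong p q) (sym (^-distrib-* l m 3)))

            five : psum v u (suc n) ≡ + 5
            five = ι-injective _ (+ 5) (begin
              ι (psum v u (suc n))                     ≈⟨ sym (dual (proj₂ U) (proj₂ V) υυυ≈1 (suc n)) ⟩
              (υ₂ * υ₃) ^ suc n + (υ₁ * υ₃) ^ suc n + (υ₁ * υ₂) ^ suc n
                                                       ≈⟨ +-cong (+-cong (product r₂ r₃) (product r₁ r₃)) (product r₁ r₂) ⟩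
              (l₂ * l₃) ^ 3 + (l₁ * l₃) ^ 3 + (l₁ * l₂) ^ 3
                                                       ≈⟨ dual {u = + 1} {v = ℤ.- + 1} e₁ e₂ e₃ 3 ⟩
              ι (+ 5)                                  ∎)

          one-or-three : suc n ≡ 1 ⊎ suc n ≡ 3
          one-or-three = psum-7-5 u v (suc n) seven five

    -- From a rational ratio A : B to a unit whose ℓ-th power is λ³.

    module RationalSlope where

      open Lines
      open Rational
      open Zeros using (evT; module OverRoot)
      open Exponent
      open Coordinates

      private
        zp-one : ∀ k → zp 1# 1# k ≈ 1#
        zp-one (+ n)    = 1^n≈1 n
        zp-one -[1+ n ] = 1^n≈1 (suc n)

        evT-lincomb : ∀ l i j e f → ι i * evT l e + ι j * evT l f ≈ evT l (i *ᵀ e +ᵀ j *ᵀ f)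
        evT-lincomb l i j (triple a b k) (triple a′ b′ k′) = sym (begin
          ι (i ℤ.* a ℤ.+ j ℤ.* a′) + ι (i ℤ.* b ℤ.+ j ℤ.* b′) * l + ι (i ℤ.* k ℤ.+ j ℤ.* k′) * (l * l)
            ≈⟨ +-cong (+-cong (ι≈ (⌜ i ⌝ ⊗ ⌜ a ⌝ ⊕ ⌜ j ⌝ ⊗ ⌜ a′ ⌝)) (*-congʳ (ι≈ (⌜ i ⌝ ⊗ ⌜ b ⌝ ⊕ ⌜ j ⌝ ⊗ ⌜ b′ ⌝))))
                 (*-congʳ (ι≈ (⌜ i ⌝ ⊗ ⌜ k ⌝ ⊕ ⌜ j ⌝ ⊗ ⌜ k′ ⌝))) ⟩
          (ι i * ι a + ι j * ι a′) + (ι i * ι b + ι j * ι b′) * l + (ι i * ι k + ι j * ι k′) * (l * l)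
            ≈⟨ +-cong (+-congˡ (factor (ι i) (ι b) (ι j) (ι b′) l)) (factor (ι i) (ι k) (ι j) (ι k′) (l * l)) ⟩
          (ι i * ι a + ι j * ι a′) + (ι i * (ι b * l) + ι j * (ι b′ * l)) + (ι i * (ι k * (l * l)) + ι j * (ι k′ * (l * l)))
            ≈⟨ distribute (ι i) (ι j) (ι a) (ι b * l) (ι k * (l * l)) (ι a′) (ι b′ * l) (ι k′ * (l * l)) ⟩
          ι i * ev l a b k + ι j * ev l a′ b′ k′ ∎)
          where
          factor : ∀ i b j b′ l → (i * b + j * b′) * l ≈ i * (b * l) + j * (b′ * l)
          factor i b j b′ l = solve 5 (λ i b j b′ l → (i :* b :+ j :* b′) :* l := i :* (b :* l) :+ j :* (b′ :* l)) refl i b j b′ l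
          distribute : ∀ i j a B C a′ B′ C′ → (i * a + j * a′) + (i * B + j * B′) + (i * C + j * C′) ≈
                       i * (a + B + C) + j * (a′ + B′ + C′)
          distribute i j a B C a′ B′ C′ = sym (trans
            (+-cong (trans (distribˡ i (a + B) C) (+-congʳ (distribˡ i a B))) (trans (distribˡ j (a′ + B′) C′) (+-congʳ (distribˡ j a′ B′))))
            (solve 6 (λ a B C a′ B′ C′ → (a :+ B :+ C) :+ (a′ :+ B′ :+ C′) := (a :+ a′) :+ (B :+ B′) :+ (C :+ C′))
              refl (i * a) (i * B) (i * C) (j * a′) (j * B′) (j * C′)))

      module _ {l₁ l₂ l₃ : Carrier} (roots : Roots l₁ l₂ l₃) (n : ℕ) (K : ℤ) where
        open Roots roots
        open Solutions roots n K

        -- θ = p + qλ satisfies θ^ℓ = Uλᴷ, and a Bézout relation between ℓ and K gives φ = λˣθʸ with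
        -- φ^ℓ = Cλ. Taking the product over the roots, which have norm 1, yields C³ = Φ^ℓ for the
        -- norm Φ of φ. Hence υ = φ³/Φ satisfies υ^ℓ = λ³ and has norm 1.
        exponent : ∀ {s} → Sol s → IsRational s → Coprime ℤ.∣ K ∣ (suc n) → suc n ≡ 1 ⊎ suc n ≡ 3
        exponent {s} S (p , q , q≢0 , qs≈p) coprime = go (bézoutℕ K n coprime)
          where
          open Sol S
          open Normalised S using (u≉0)

          θ : Carrier → Carrier
          θ l = ι p + ι q * l

          θ≈ : ∀ l → θ l ≈ ι q * (s + l)
          θ≈ l = trans (+-congʳ (sym qs≈p)) (sym (distribˡ (ι q) s l))

          U : Carrier
          U = ι q ^ suc n * u

          θ^ : ∀ {l} → (s + l) ^ suc n ≈ u * l ^^ K → θ l ^ suc n ≈ U * l ^^ K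
          θ^ {l} e = trans (^-congˡ (suc n) (θ≈ l)) (trans (^-distrib-* (ι q) (s + l) (suc n))
            (trans (*-congˡ e) (sym (*-assoc _ u _))))

          θ≉0 : ∀ {l} → Root l → (s + l) ^ suc n ≈ u * l ^^ K → ¬ θ l ≈ 0#
          θ≉0 {l} r e θ≈0 = *-≉0 (*-≉0 (^-≉0 (suc n) (ι≉0 q q≢0)) u≉0) (unit-≉0 (zp-inverse (κ-inverse r) K))
            (trans (sym (θ^ e)) (trans (*-congʳ θ≈0) (zeroˡ _)))

          coordinates : ∀ k j → ∃ λ e → ∀ {l} → Root l → l ^^ k * θ l ^ j ≈ evT l e
          coordinates k j =
            let (e , eq) = θ-power j
            in act k e , λ r → trans (*-congˡ (eq r)) (OverRoot.evT-act r k e)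
            where
            θ-power : ∀ j → ∃ λ e → ∀ {l} → Root l → θ l ^ j ≈ evT l e
            θ-power zero = 1ᵀ , λ r → sym (OverRoot.evT-1 r)
            θ-power (suc j) =
              let (e , eq) = θ-power j
              in p *ᵀ e +ᵀ q *ᵀ shift e , λ {l} r → trans (*-congˡ (eq r))
                   (trans (distribʳ _ (ι p) (ι q * l)) (trans (+-congˡ (trans (*-assoc (ι q) l _) (*-congˡ (OverRoot.evT-shift r e))))
                     (evT-lincomb l p q e (shift e))))

          norm : ℤ
          norm = p ℤ.* p ℤ.* p ℤ.+ p ℤ.* p ℤ.* q ℤ.- p ℤ.* q ℤ.* q ℤ.+ q ℤ.* q ℤ.* q

          θθθ : θ l₁ * θ l₂ * θ l₃ ≈ ι norm
          θθθ = begin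
            θ l₁ * θ l₂ * θ l₃
              ≈⟨ expand (ι p) (ι q) l₁ l₂ l₃ ⟩
            ι p * ι p * ι p + ι p * ι p * ι q * (l₁ + l₂ + l₃) + ι p * ι q * ι q * (l₁ * l₂ + l₁ * l₃ + l₂ * l₃) + ι q * ι q * ι q * (l₁ * l₂ * l₃)
              ≈⟨ +-cong (+-cong (+-congˡ (*-congˡ e₁)) (*-congˡ e₂)) (*-congˡ e₃) ⟩
            ι p * ι p * ι p + ι p * ι p * ι q * 1# + ι p * ι q * ι q * - 1# + ι q * ι q * ι q * 1#
              ≈⟨ solve 2 (λ p q → p :* p :* p :+ p :* p :* q :* con (+ 1) :+ p :* q :* q :* (:- con (+ 1)) :+ q :* q :* q :* con (+ 1) :=
                   p :* p :* p :+ p :* p :* q :- p :* q :* q :+ q :* q :* q) refl (ι p) (ι q) ⟩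
            ι p * ι p * ι p + ι p * ι p * ι q - ι p * ι q * ι q + ι q * ι q * ι q
              ≈⟨ sym (ι≈ (p~ ⊗ p~ ⊗ p~ ⊕ p~ ⊗ p~ ⊗ q~ ⊝ p~ ⊗ q~ ⊗ q~ ⊕ q~ ⊗ q~ ⊗ q~)) ⟩
            ι norm ∎
            where
            p~ = ⌜ p ⌝
            q~ = ⌜ q ⌝
            expand : ∀ p q x y z → (p + q * x) * (p + q * y) * (p + q * z) ≈
              p * p * p + p * p * q * (x + y + z) + p * q * q * (x * y + x * z + y * z) + q * q * q * (x * y * z)
            expand p q x y z = solve 5 (λ p q x y z → (p :+ q :* x) :* (p :+ q :* y) :* (p :+ q :* z) :=
              p :* p :* p :+ p :* p :* q :* (x :+ y :+ z) :+ p :* q :* q :* (x :* y :+ x :* z :+ y :* z) :+ q :* q :* q :* (x :* y :* z)) refl p q x y z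

          go : (∃ λ x → ∃ λ y → x ℤ.* + suc n ℤ.+ K ℤ.* + y ≡ + 1) → suc n ≡ 1 ⊎ suc n ≡ 3
          go (x , y , bez) = RootsOfCubes.one-or-three roots {n} {φ l₁ ^ 3 * Φ′} {φ l₂ ^ 3 * Φ′} {φ l₃ ^ 3 * Φ′}
            (υ-power root₁ p₁) (υ-power root₂ p₂) (υ-power root₃ p₃) υυυ
            -- With T₁, T₂ the traces of φ³, φ⁶ and m the norm of φ, one has Συᵢ = T₁/m and Συᵢυⱼ =
            -- (T₁² - T₂)/2m²; both are written over the denominator 2m².
            {+ 2 ℤ.* m ℤ.* T₁} {T₁ ℤ.* T₁ ℤ.- T₂} {+ 2 ℤ.* m ℤ.* m} q′≢0 rational₁ rational₂
            where
            φ : Carrier → Carrier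
            φ l = l ^^ x * θ l ^ y
            C = U ^ y
            Φ = φ l₁ * φ l₂ * φ l₃
            Φ′ = inv Φ
            m = norm ℤ.^ y

            φ^ : ∀ {l} → Root l → (s + l) ^ suc n ≈ u * l ^^ K → φ l ^ suc n ≈ C * l
            φ^ {l} r e = begin
              (l ^^ x * θ l ^ y) ^ suc n
                ≈⟨ ^-distrib-* (l ^^ x) (θ l ^ y) (suc n) ⟩
              (l ^^ x) ^ suc n * (θ l ^ y) ^ suc n
                ≈⟨ *-cong (sym (zp-*ℕ (κ-inverse r) x (suc n))) (trans (^-comm-exp (θ l) y (suc n)) (^-congˡ y (θ^ e))) ⟩
              l ^^ (x ℤ.* + suc n) * (U * l ^^ K) ^ y
                ≈⟨ *-congˡ (trans (^-distrib-* U (l ^^ K) y) (*-congˡ (sym (zp-*ℕ (κ-inverse r) K y)))) ⟩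
              l ^^ (x ℤ.* + suc n) * (C * l ^^ (K ℤ.* + y))
                ≈⟨ solve 3 (λ a b d → a :* (b :* d) := b :* (a :* d)) refl (l ^^ (x ℤ.* + suc n)) C (l ^^ (K ℤ.* + y)) ⟩
              C * (l ^^ (x ℤ.* + suc n) * l ^^ (K ℤ.* + y))
                ≈⟨ *-congˡ (sym (zp-+ (κ-inverse r) (x ℤ.* + suc n) (K ℤ.* + y))) ⟩
              C * l ^^ (x ℤ.* + suc n ℤ.+ K ℤ.* + y)
                ≈⟨ *-congˡ (trans (reflexive (≡.cong (l ^^_) bez)) (*-identityʳ l)) ⟩
              C * l ∎

            Φ≈ : Φ ≈ ι m
            Φ≈ = begin
              φ l₁ * φ l₂ * φ l₃
                ≈⟨ regroup (l₁ ^^ x) (θ l₁ ^ y) (l₂ ^^ x) (θ l₂ ^ y) (l₃ ^^ x) (θ l₃ ^ y) ⟩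
              (l₁ ^^ x * l₂ ^^ x * l₃ ^^ x) * (θ l₁ ^ y * θ l₂ ^ y * θ l₃ ^ y)
                ≈⟨ *-cong (trans (*-congʳ (sym (zp-distrib l₁ (κ l₁) l₂ (κ l₂) x))) (sym (zp-distrib (l₁ * l₂) (κ l₁ * κ l₂) l₃ (κ l₃) x)))
                     (trans (*-congʳ (sym (^-distrib-* (θ l₁) (θ l₂) y))) (sym (^-distrib-* (θ l₁ * θ l₂) (θ l₃) y))) ⟩
              zp (l₁ * l₂ * l₃) (κ l₁ * κ l₂ * κ l₃) x * (θ l₁ * θ l₂ * θ l₃) ^ y
                ≈⟨ *-cong (trans (zp-cong e₃ κκκ x) (zp-one x)) (trans (^-congˡ y θθθ) (sym (ι-^ norm y))) ⟩
              1# * ι m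
                ≈⟨ *-identityˡ _ ⟩
              ι m ∎
              where
              regroup : ∀ a b c d e f → (a * b) * (c * d) * (e * f) ≈ (a * c * e) * (b * d * f)
              regroup a b c d e f = solve 6 (λ a b c d e f → (a :* b) :* (c :* d) :* (e :* f) := (a :* c :* e) :* (b :* d :* f)) refl a b c d e f
              κκκ : κ l₁ * κ l₂ * κ l₃ ≈ 1#
              κκκ = begin
                κ l₁ * κ l₂ * κ l₃
                  ≈⟨ sym (trans (*-congʳ e₃) (*-identityˡ _)) ⟩
                l₁ * l₂ * l₃ * (κ l₁ * κ l₂ * κ l₃)
                  ≈⟨ sym (regroup l₁ (κ l₁) l₂ (κ l₂) l₃ (κ l₃)) ⟩
                (l₁ * κ l₁) * (l₂ * κ l₂) * (l₃ * κ l₃)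
                  ≈⟨ *-cong (*-cong (κ-inverse root₁) (κ-inverse root₂)) (κ-inverse root₃) ⟩
                1# * 1# * 1#
                  ≈⟨ trans (*-identityʳ _) (*-identityʳ _) ⟩
                1# ∎

            ^^-≉0 : ∀ {l} → Root l → ∀ k → ¬ l ^^ k ≈ 0#
            ^^-≉0 r k = unit-≉0 (zp-inverse (κ-inverse r) k)

            Φ≉0 : ¬ Φ ≈ 0#
            Φ≉0 = *-≉0 (*-≉0 (*-≉0 (^^-≉0 root₁ x) (^-≉0 y (θ≉0 root₁ p₁)))
                             (*-≉0 (^^-≉0 root₂ x) (^-≉0 y (θ≉0 root₂ p₂))))
                       (*-≉0 (^^-≉0 root₃ x) (^-≉0 y (θ≉0 root₃ p₃)))

            ΦΦ′ : Φ * Φ′ ≈ 1#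
            ΦΦ′ = inverseʳ Φ Φ≉0

            C³Φ′^ : C ^ 3 * Φ′ ^ suc n ≈ 1#
            C³Φ′^ = begin
              C ^ 3 * Φ′ ^ suc n
                ≈⟨ *-congʳ (trans (sym (*-identityʳ (C ^ 3))) (trans (*-congˡ (sym e₃))
                     (solve 4 (λ C x y z → C :^ 3 :* (x :* y :* z) := (C :* x) :* (C :* y) :* (C :* z)) refl C l₁ l₂ l₃))) ⟩
              (C * l₁) * (C * l₂) * (C * l₃) * Φ′ ^ suc n
                ≈⟨ *-congʳ (sym (*-cong (*-cong (φ^ root₁ p₁) (φ^ root₂ p₂)) (φ^ root₃ p₃))) ⟩
              φ l₁ ^ suc n * φ l₂ ^ suc n * φ l₃ ^ suc n * Φ′ ^ suc n
                ≈⟨ *-congʳ (trans (*-congʳ (sym (^-distrib-* (φ l₁) (φ l₂) (suc n)))) (sym (^-distrib-* (φ l₁ * φ l₂) (φ l₃) (suc n)))) ⟩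
              Φ ^ suc n * Φ′ ^ suc n
                ≈⟨ trans (sym (^-distrib-* Φ Φ′ (suc n))) (trans (^-congˡ (suc n) ΦΦ′) (1^n≈1 (suc n))) ⟩
              1# ∎

            υ-power : ∀ {l} → Root l → (s + l) ^ suc n ≈ u * l ^^ K → (φ l ^ 3 * Φ′) ^ suc n ≈ l ^ 3
            υ-power {l} r e = begin
              (φ l ^ 3 * Φ′) ^ suc n
                ≈⟨ ^-distrib-* (φ l ^ 3) Φ′ (suc n) ⟩
              (φ l ^ 3) ^ suc n * Φ′ ^ suc n
                ≈⟨ *-congʳ (trans (^-comm-exp (φ l) 3 (suc n)) (trans (^-congˡ 3 (φ^ r e)) (^-distrib-* C l 3))) ⟩
              C ^ 3 * l ^ 3 * Φ′ ^ suc n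
                ≈⟨ solve 3 (λ a b d → a :* b :* d := (a :* d) :* b) refl (C ^ 3) (l ^ 3) (Φ′ ^ suc n) ⟩
              C ^ 3 * Φ′ ^ suc n * l ^ 3
                ≈⟨ trans (*-congʳ C³Φ′^) (*-identityˡ _) ⟩
              l ^ 3 ∎

            υυυ : φ l₁ ^ 3 * Φ′ * (φ l₂ ^ 3 * Φ′) * (φ l₃ ^ 3 * Φ′) ≈ 1#
            υυυ = trans (solve 4 (λ a b d i → a :^ 3 :* i :* (b :^ 3 :* i) :* (d :^ 3 :* i) := (a :* b :* d :* i) :^ 3) refl (φ l₁) (φ l₂) (φ l₃) Φ′)
              (trans (^-congˡ 3 ΦΦ′) (1^n≈1 3))

            φ-trace : ∀ j → ∃ λ T → φ l₁ ^ j + φ l₂ ^ j + φ l₃ ^ j ≈ ι T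
            φ-trace j =
              let (e , eq) = coordinates (x ℤ.* + j) (y ℕ.* j)
                  (T , tr) = trace roots e
                  at : ∀ {l} → Root l → φ l ^ j ≈ evT l e
                  at {l} r = trans (^-distrib-* (l ^^ x) (θ l ^ y) j)
                    (trans (*-cong (sym (zp-*ℕ (κ-inverse r) x j)) (^-assocʳ (θ l) y j)) (eq r))
              in T , trans (+-cong (+-cong (at root₁) (at root₂)) (at root₃)) tr

            T₁ = proj₁ (φ-trace 3)
            T₂ = proj₁ (φ-trace 6)

            m≢0 : ¬ m ≡ + 0
            m≢0 m≡0 = Φ≉0 (trans Φ≈ (ι-cong m≡0))

            q′≢0 : ¬ + 2 ℤ.* m ℤ.* m ≡ + 0
            q′≢0 e with ℤP.i*j≡0⇒i≡0∨j≡0 (+ 2 ℤ.* m) e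
            ... | inj₂ m≡0 = m≢0 m≡0
            ... | inj₁ e′ with ℤP.i*j≡0⇒i≡0∨j≡0 (+ 2) e′
            ...   | inj₂ m≡0 = m≢0 m≡0

            ι2m² : ι (+ 2 ℤ.* m ℤ.* m) ≈ ι (+ 2) * Φ * Φ
            ι2m² = trans (ι≈ (⌜ + 2 ⌝ ⊗ ⌜ m ⌝ ⊗ ⌜ m ⌝)) (*-cong (*-congˡ (sym Φ≈)) (sym Φ≈))

            rational₁ : ι (+ 2 ℤ.* m ℤ.* m) * (φ l₁ ^ 3 * Φ′ + φ l₂ ^ 3 * Φ′ + φ l₃ ^ 3 * Φ′) ≈ ι (+ 2 ℤ.* m ℤ.* T₁)
            rational₁ = begin
              ι (+ 2 ℤ.* m ℤ.* m) * (φ l₁ ^ 3 * Φ′ + φ l₂ ^ 3 * Φ′ + φ l₃ ^ 3 * Φ′)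
                ≈⟨ *-congʳ ι2m² ⟩
              ι (+ 2) * Φ * Φ * (φ l₁ ^ 3 * Φ′ + φ l₂ ^ 3 * Φ′ + φ l₃ ^ 3 * Φ′)
                ≈⟨ solve 5 (λ Φ Φ′ a b d → con (+ 2) :* Φ :* Φ :* (a :* Φ′ :+ b :* Φ′ :+ d :* Φ′) :=
                     con (+ 2) :* Φ :* (Φ :* Φ′) :* (a :+ b :+ d)) refl Φ Φ′ (φ l₁ ^ 3) (φ l₂ ^ 3) (φ l₃ ^ 3) ⟩
              ι (+ 2) * Φ * (Φ * Φ′) * (φ l₁ ^ 3 + φ l₂ ^ 3 + φ l₃ ^ 3)
                ≈⟨ *-cong (trans (*-congˡ ΦΦ′) (trans (*-identityʳ _) (*-congˡ Φ≈))) (proj₂ (φ-trace 3)) ⟩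
              ι (+ 2) * ι m * ι T₁
                ≈⟨ sym (ι≈ (⌜ + 2 ⌝ ⊗ ⌜ m ⌝ ⊗ ⌜ T₁ ⌝)) ⟩
              ι (+ 2 ℤ.* m ℤ.* T₁) ∎

            rational₂ : ι (+ 2 ℤ.* m ℤ.* m) * (φ l₁ ^ 3 * Φ′ * (φ l₂ ^ 3 * Φ′) + φ l₁ ^ 3 * Φ′ * (φ l₃ ^ 3 * Φ′) + φ l₂ ^ 3 * Φ′ * (φ l₃ ^ 3 * Φ′))
                        ≈ ι (T₁ ℤ.* T₁ ℤ.- T₂)
            rational₂ = begin
              ι (+ 2 ℤ.* m ℤ.* m) * (a * Φ′ * (b * Φ′) + a * Φ′ * (d * Φ′) + b * Φ′ * (d * Φ′))
                ≈⟨ *-congʳ ι2m² ⟩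
              ι (+ 2) * Φ * Φ * (a * Φ′ * (b * Φ′) + a * Φ′ * (d * Φ′) + b * Φ′ * (d * Φ′))
                ≈⟨ solve 5 (λ Φ Φ′ a b d → con (+ 2) :* Φ :* Φ :* (a :* Φ′ :* (b :* Φ′) :+ a :* Φ′ :* (d :* Φ′) :+ b :* Φ′ :* (d :* Φ′)) :=
                     (Φ :* Φ′) :* (Φ :* Φ′) :* ((a :+ b :+ d) :* (a :+ b :+ d) :- (a :* a :+ b :* b :+ d :* d))) refl Φ Φ′ a b d ⟩
              (Φ * Φ′) * (Φ * Φ′) * ((a + b + d) * (a + b + d) - (a * a + b * b + d * d))
                ≈⟨ trans (*-congʳ (trans (*-cong ΦΦ′ ΦΦ′) (*-identityˡ 1#))) (*-identityˡ _) ⟩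
              (a + b + d) * (a + b + d) - (a * a + b * b + d * d)
                ≈⟨ +-cong (*-cong (proj₂ (φ-trace 3)) (proj₂ (φ-trace 3)))
                     (-‿cong (trans (+-cong (+-cong (square (φ l₁)) (square (φ l₂))) (square (φ l₃))) (proj₂ (φ-trace 6)))) ⟩
              ι T₁ * ι T₁ - ι T₂
                ≈⟨ sym (ι≈ (⌜ T₁ ⌝ ⊗ ⌜ T₁ ⌝ ⊝ ⌜ T₂ ⌝)) ⟩
              ι (T₁ ℤ.* T₁ ℤ.- T₂) ∎
              where
              a = φ l₁ ^ 3
              b = φ l₂ ^ 3
              d = φ l₃ ^ 3
              square : ∀ z → z ^ 3 * z ^ 3 ≈ z ^ 6
              square z = solve 1 (λ z → z :^ 3 :* z :^ 3 := z :^ 6) refl z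

    -- The exponents K for ℓ = 1 and ℓ = 3.

    module Forward where

      open Lines
      open Polynomials using (pow≈^; v′; ω; ω³; ω≉0)
      open Rational
      open Zeros using (evT; module OverRoot)
      open RationalSlope
      open Coordinates
      open OddCoordinate

      zpow≈zp : ∀ x k → zpow R inv x k ≈ zp x (inv x) k
      zpow≈zp x (+ n)    = pow≈^ x n
      zpow≈zp x -[1+ n ] = pow≈^ (inv x) (suc n)

      module _ {l₁ l₂ l₃ : Carrier} (roots : Roots l₁ l₂ l₃) where
        open Roots roots

        private
          ^^-≉0 : ∀ {l} → Root l → ∀ k → ¬ l ^^ k ≈ 0#
          ^^-≉0 r k = unit-≉0 (zp-inverse (κ-inverse r) k)

        -- Comparison with the constant line turns rigidity into a statement about powers of one
        -- line and powers of the roots; `exact` and `vertical⇒K≡0` rest on this.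
        unitLine : Line l₁ l₂ l₃
        unitLine = record
          { A = 1# ; B = 0# ; y₁ = 1# ; y₂ = 1# ; y₃ = 1# ; y₁′ = 1# ; y₂′ = 1# ; y₃′ = 1# ; n = 0 ; M = + 0
          ; inverse₁ = one ; inverse₂ = one ; inverse₃ = one ; power₁ = one ; power₂ = one ; power₃ = one
          ; line₁ = at l₁ ; line₂ = at l₂ ; line₃ = at l₃ }
          where
          one : 1# * 1# ≈ 1#
          one = *-identityˡ 1#
          at : ∀ l → 1# ≈ 1# + 0# * l
          at l = solve 1 (λ l → con (+ 1) := con (+ 1) :+ con (+ 0) :* l) refl l

        rootLine : Line l₁ l₂ l₃
        rootLine = record
          { A = 0# ; B = 1# ; y₁ = l₁ ; y₂ = l₂ ; y₃ = l₃ ; y₁′ = κ l₁ ; y₂′ = κ l₂ ; y₃′ = κ l₃ ; n = 0 ; M = + 1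
          ; inverse₁ = κ-inverse root₁ ; inverse₂ = κ-inverse root₂ ; inverse₃ = κ-inverse root₃
          ; power₁ = refl ; power₂ = refl ; power₃ = refl
          ; line₁ = at l₁ ; line₂ = at l₂ ; line₃ = at l₃ }
          where
          at : ∀ l → l ≈ 0# + 1# * l
          at l = solve 1 (λ l → l := con (+ 0) :+ con (+ 1) :* l) refl l

        ωLine : Line l₁ l₂ l₃
        ωLine = record
          { A = v′ ; B = v′ ; y₁ = ω l₁ ; y₂ = ω l₂ ; y₃ = ω l₃ ; y₁′ = inv (ω l₁) ; y₂′ = inv (ω l₂) ; y₃′ = inv (ω l₃)
          ; n = 2 ; M = + 4
          ; inverse₁ = inverseʳ _ (ω≉0 root₁) ; inverse₂ = inverseʳ _ (ω≉0 root₂) ; inverse₃ = inverseʳ _ (ω≉0 root₃)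
          ; power₁ = ω³ root₁ ; power₂ = ω³ root₂ ; power₃ = ω³ root₃
          ; line₁ = at l₁ ; line₂ = at l₂ ; line₃ = at l₃ }
          where
          at : ∀ l → ω l ≈ v′ + v′ * l
          at l = solve 2 (λ l v → (con (+ 1) :+ l) :* v := v :+ v :* l) refl l v′

        fromRatios : ∀ {x₁ x₂ x₃ g₁ g₂ g₃} → ¬ g₃ ≈ 0# → x₂ * g₃ ≈ x₃ * g₂ → x₃ * g₁ ≈ x₁ * g₃ →
                     ∃ λ u → x₁ ≈ u * g₁ × x₂ ≈ u * g₂ × x₃ ≈ u * g₃
        fromRatios {x₁} {x₂} {x₃} {g₁} {g₂} {g₃} g₃≉0 e₂₃ e₃₁ = u ,
          divide (sym e₃₁) , divide e₂₃ , divide refl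
          where
          u = x₃ * inv g₃
          divide : ∀ {x g} → x * g₃ ≈ x₃ * g → x ≈ u * g
          divide {x} {g} e = *-cancelˡ-≈ g₃≉0 (begin
            g₃ * x                   ≈⟨ trans (*-comm g₃ x) e ⟩
            x₃ * g                   ≈⟨ sym (trans (*-congʳ (inverseʳ g₃ g₃≉0)) (*-identityˡ _)) ⟩
            g₃ * inv g₃ * (x₃ * g)   ≈⟨ solve 4 (λ a b x g → a :* b :* (x :* g) := a :* (x :* b :* g)) refl g₃ (inv g₃) x₃ g ⟩
            g₃ * (u * g)             ∎)

        linear⇒ : ∀ {α β u} e → ¬ u ≈ 0# →
          α + β * l₁ ≈ u * evT l₁ e → α + β * l₂ ≈ u * evT l₂ e → α + β * l₃ ≈ u * evT l₃ e → c₂ e ≡ + 0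
        linear⇒ {α} {β} {u} (triple a b k) u≉0 p₁ p₂ p₃ = ι≈0⇒≡0 k (cancelˡ u≉0 (proj₂ (Solutions.vandermonde roots 0 (+ 0)
            (at p₁) (at p₂) (at p₃))))
          where
          at : ∀ {l} → α + β * l ≈ u * ev l a b k → (u * ι a - α) + (u * ι b - β) * l + u * ι k * (l * l) ≈ 0#
          at {l} p = lc₁ (- 1#) p (shape α β u l (ι a) (ι b) (ι k))
            where
            shape : ∀ α β u l a b k → (u * a - α) + (u * b - β) * l + u * k * (l * l) - 0# ≈ - 1# * ((α + β * l) - u * (a + b * l + k * (l * l)))
            shape α β u l a b k = begin
              (u * a - α) + (u * b - β) * l + u * k * (l * l) - 0#
                ≈⟨ solve 6 (λ a′ α b′ β l k′ → (a′ :- α) :+ (b′ :- β) :* l :+ k′ :* (l :* l) :- con (+ 0) :=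
                     (:- con (+ 1)) :* ((α :+ β :* l) :- (a′ :+ b′ :* l :+ k′ :* (l :* l)))) refl (u * a) α (u * b) β l (u * k) ⟩
              - 1# * ((α + β * l) - (u * a + u * b * l + u * k * (l * l)))
                ≈⟨ *-congˡ (+-congˡ (-‿cong (solve 5 (λ u a b k l → u :* a :+ u :* b :* l :+ u :* k :* (l :* l) :=
                     u :* (a :+ b :* l :+ k :* (l :* l))) refl u a b k l))) ⟩
              - 1# * ((α + β * l) - u * (a + b * l + k * (l * l))) ∎

        module _ {s : Carrier} where

          T-case : ∀ {K} → Solutions.Sol roots 0 K s → K ∈ (+ 1 ∷ + 0 ∷ -[1+ 2 ] ∷ -[1+ 15 ] ∷ [])
          T-case {K} S = OverRoot.T-zeros root₁ K (OverRoot.has-resp root₁ (sym (OverRoot.evT-act root₁ K 1ᵀ))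
            (≡.subst (OverRoot.Has root₁ _) (linear⇒ {s} {1#} {u} e u≉0 (at root₁ p₁) (at root₂ p₂) (at root₃ p₃)) (OverRoot.has-evT root₁ e)))
            where
            open Solutions roots 0 K
            open Sol S
            open Normalised S using (u≉0)
            e = act K 1ᵀ
            at : ∀ {l} → Root l → (s + l) ^ 1 ≈ u * l ^^ K → s + 1# * l ≈ u * evT l e
            at {l} r p = begin
              s + 1# * l             ≈⟨ trans (+-congˡ (*-identityˡ l)) (sym (*-identityʳ _)) ⟩
              (s + l) ^ 1            ≈⟨ p ⟩
              u * l ^^ K             ≈⟨ *-congˡ (sym (trans (*-congˡ (OverRoot.evT-1 r)) (*-identityʳ _))) ⟩
              u * (l ^^ K * evT l 1ᵀ) ≈⟨ *-congˡ (OverRoot.evT-act r K 1ᵀ) ⟩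
              u * evT l e            ∎

          module Cubic {K : ℤ} (S : Solutions.Sol roots 2 K s) where
            open Solutions roots 2 K
            open Sol S
            open Normalised S using (line; power; u≉0; v′≉0) renaming (v′ to w)

            private
              σ : Carrier → Carrier
              σ l = (s + l) * w

              cubes : ∀ e j → K ℤ.* + e ≡ + 4 ℤ.+ j ℤ.* + 3 → ∀ {x y} → Root x → Root y →
                      (s + x) ^ 3 ≈ u * x ^^ K → (σ x ^ e * (ω y * y ^^ j)) ^ 3 ≈ x ^^ (K ℤ.* + e) * y ^^ (K ℤ.* + e)
              cubes e j eq {x} {y} rx ry p = begin
                (σ x ^ e * (ω y * y ^^ j)) ^ 3
                  ≈⟨ trans (^-distrib-* (σ x ^ e) _ 3) (*-cong (^-comm-exp (σ x) e 3) (^-distrib-* (ω y) (y ^^ j) 3)) ⟩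
                (σ x ^ 3) ^ e * (ω y ^ 3 * (y ^^ j) ^ 3)
                  ≈⟨ *-cong (trans (^-congˡ e (power p)) (sym (zp-*ℕ (κ-inverse rx) K e)))
                       (*-cong (ω³ ry) (sym (zp-*ℕ (κ-inverse ry) j 3))) ⟩
                x ^^ (K ℤ.* + e) * (y ^^ (+ 4) * y ^^ (j ℤ.* + 3))
                  ≈⟨ *-congˡ (trans (sym (zp-+ (κ-inverse ry) (+ 4) (j ℤ.* + 3))) (reflexive (≡.cong (y ^^_) (≡.sym eq)))) ⟩
                x ^^ (K ℤ.* + e) * y ^^ (K ℤ.* + e) ∎

            -- For Ke = 4 + 3j, both σᵉ and ωλʲ have the cube λ^(Ke), so their quotients at two
            -- roots agree up to a cube root of unity, which rigidity removes.
            cubic-proportional : ∀ e j → K ℤ.* + e ≡ + 4 ℤ.+ j ℤ.* + 3 →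
              ∃ λ a → σ l₁ ^ e ≈ a * (ω l₁ * l₁ ^^ j) × σ l₂ ^ e ≈ a * (ω l₂ * l₂ ^^ j) × σ l₃ ^ e ≈ a * (ω l₃ * l₃ ^^ j)
            cubic-proportional e j eq = fromRatios (*-≉0 (ω≉0 root₃) (^^-≉0 root₃ j))
              (At.rigidity roots line ωLine e j 3 (λ ())
                (trans (cubes e j eq root₂ root₃ p₂) (trans (*-comm _ _) (sym (cubes e j eq root₃ root₂ p₃)))))
              (At.rigidity (rotate roots) (rotateLine line) (rotateLine ωLine) e j 3 (λ ())
                (trans (cubes e j eq root₃ root₁ p₃) (trans (*-comm _ _) (sym (cubes e j eq root₁ root₃ p₁)))))

            private
              σ≉0 : ∀ {l} → Root l → (s + l) ^ 3 ≈ u * l ^^ K → ¬ σ l ≈ 0#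
              σ≉0 r p e = ^^-≉0 r K (trans (sym (power p)) (trans (*-congʳ e) (zeroˡ _)))

            V-case : ∀ j → K ≡ + 4 ℤ.+ j ℤ.* + 3 → j ∈ (+ 0 ∷ -[1+ 1 ] ∷ [])
            V-case j eq = finish (cubic-proportional 1 j (≡.trans (ℤP.*-identityʳ K) eq))
              where
              e = act j 1+Xᵀ
              finish : (∃ λ a → σ l₁ ^ 1 ≈ a * (ω l₁ * l₁ ^^ j) × σ l₂ ^ 1 ≈ a * (ω l₂ * l₂ ^^ j) × σ l₃ ^ 1 ≈ a * (ω l₃ * l₃ ^^ j)) →
                       j ∈ (+ 0 ∷ -[1+ 1 ] ∷ [])
              finish (a , q₁ , q₂ , q₃) = OverRoot.V-zeros root₁ j (OverRoot.has-resp root₁ (sym (OverRoot.evT-act root₁ j 1+Xᵀ))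
                (≡.subst (OverRoot.Has root₁ _) (linear⇒ {s * w} {w} {a * v′} e av′≉0 (at root₁ q₁) (at root₂ q₂) (at root₃ q₃)) (OverRoot.has-evT root₁ e)))
                where
                at : ∀ {l} → Root l → σ l ^ 1 ≈ a * (ω l * l ^^ j) → s * w + w * l ≈ a * v′ * evT l e
                at {l} r q = begin
                  s * w + w * l
                    ≈⟨ solve 3 (λ s w l → s :* w :+ w :* l := (s :+ l) :* w :* con (+ 1)) refl s w l ⟩
                  σ l ^ 1
                    ≈⟨ q ⟩
                  a * ((1# + l) * v′ * l ^^ j)
                    ≈⟨ solve 4 (λ a m v k → a :* (m :* v :* k) := a :* v :* (k :* m)) refl a (1# + l) v′ (l ^^ j) ⟩
                  a * v′ * (l ^^ j * (1# + l))
                    ≈⟨ *-congˡ (trans (*-congˡ (sym (OverRoot.evT-1+X r))) (OverRoot.evT-act r j 1+Xᵀ)) ⟩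
                  a * v′ * evT l e ∎
                av′≉0 : ¬ a * v′ ≈ 0#
                av′≉0 z = σ≉0 root₁ p₁ (trans (sym (*-identityʳ _)) (trans q₁
                  (trans (solve 4 (λ a m v k → a :* (m :* v :* k) := a :* v :* (k :* m)) refl a (1# + l₁) v′ (l₁ ^^ j))
                    (trans (*-congʳ z) (zeroˡ _)))))

            -- σ² ∝ (1 + λ)λʲ and σ³ ∝ λᴷ give σ ∝ (1 + λ)⁻¹λᴷ⁻ʲ ∝ (λ - 1)²λᴷ⁻ʲ.
            odd-case : ∀ j → K ℤ.* + 2 ≡ + 4 ℤ.+ j ℤ.* + 3 → ⊥
            odd-case j eq = finish (cubic-proportional 2 j eq)
              where
              m = K ℤ.- j
              e = act m square
              finish : (∃ λ a → σ l₁ ^ 2 ≈ a * (ω l₁ * l₁ ^^ j) × σ l₂ ^ 2 ≈ a * (ω l₂ * l₂ ^^ j) × σ l₃ ^ 2 ≈ a * (ω l₃ * l₃ ^^ j)) → ⊥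
              finish (a , q₁ , q₂ , q₃) = odd-≢0 (odd-act m)
                (linear⇒ {ι (+ 2) * a * v′ * (s * w)} {ι (+ 2) * a * v′ * w} {1#} e (λ z → 0≉1 (sym z))
                  (at root₁ p₁ q₁) (at root₂ p₂ q₂) (at root₃ p₃ q₃))
                where
                evT-square : ∀ l → evT l square ≈ (l - 1#) * (l - 1#)
                evT-square l = solve 1 (λ l → con (+ 1) :+ con (ℤ.- + 2) :* l :+ con (+ 1) :* (l :* l) := (l :- con (+ 1)) :* (l :- con (+ 1))) refl l
                at : ∀ {l} → Root l → (s + l) ^ 3 ≈ u * l ^^ K → σ l ^ 2 ≈ a * (ω l * l ^^ j) →
                     ι (+ 2) * a * v′ * (s * w) + ι (+ 2) * a * v′ * w * l ≈ 1# * evT l e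
                at {l} r p q = trans reduce (trans (OverRoot.evT-act r m square) (sym (*-identityˡ _)))
                  where
                  k′ = zp (κ l) l j
                  σ³ : σ l * (a * (ω l * l ^^ j)) ≈ l ^^ K
                  σ³ = trans (*-congˡ (sym q)) (trans (solve 1 (λ x → x :* x :^ 2 := x :^ 3) refl (σ l)) (power p))
                  two : (1# + l) * ((l - 1#) * (l - 1#)) ≈ ι (+ 2)
                  two = lc₁ 1# r (solve 1 (λ l → (con (+ 1) :+ l) :* ((l :- con (+ 1)) :* (l :- con (+ 1))) :- con (+ 2) :=
                    con (+ 1) :* (l :* l :* l :- (l :* l :+ l :+ con (+ 1)))) refl l)
                  reduce : ι (+ 2) * a * v′ * (s * w) + ι (+ 2) * a * v′ * w * l ≈ l ^^ m * evT l square
                  reduce = begin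
                    ι (+ 2) * a * v′ * (s * w) + ι (+ 2) * a * v′ * w * l
                      ≈⟨ solve 5 (λ a v s w l → con (+ 2) :* a :* v :* (s :* w) :+ con (+ 2) :* a :* v :* w :* l :=
                           con (+ 2) :* (((s :+ l) :* w) :* (a :* v))) refl a v′ s w l ⟩
                    ι (+ 2) * (σ l * (a * v′))
                      ≈⟨ *-congʳ (sym two) ⟩
                    (1# + l) * ((l - 1#) * (l - 1#)) * (σ l * (a * v′))
                      ≈⟨ sym (trans (*-congˡ (zp-inverse (κ-inverse r) j)) (*-identityʳ _)) ⟩
                    (1# + l) * ((l - 1#) * (l - 1#)) * (σ l * (a * v′)) * (l ^^ j * k′)
                      ≈⟨ rearrange (1# + l) ((l - 1#) * (l - 1#)) (σ l) a v′ (l ^^ j) k′ ⟩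
                    σ l * (a * (ω l * l ^^ j)) * k′ * ((l - 1#) * (l - 1#))
                      ≈⟨ *-cong (*-cong σ³ (sym (zp-neg l (κ l) j))) (sym (evT-square l)) ⟩
                    l ^^ K * l ^^ (ℤ.- j) * evT l square
                      ≈⟨ *-congʳ (sym (zp-+ (κ-inverse r) K (ℤ.- j))) ⟩
                    l ^^ m * evT l square ∎
                    where
                    rearrange : ∀ p q x a v y z → p * q * (x * (a * v)) * (y * z) ≈ x * (a * (p * v * y)) * z * q
                    rearrange p q x a v y z = begin
                      p * q * (x * (a * v)) * (y * z)
                        ≈⟨ solve 4 (λ P q Y z → P :* q :* Y :* z := P :* Y :* z :* q) refl p q (x * (a * v)) (y * z) ⟩
                      p * (x * (a * v)) * (y * z) * q
                        ≈⟨ *-congʳ (solve 6 (λ p x a v y z → p :* (x :* (a :* v)) :* (y :* z) := x :* (a :* (p :* v :* y)) :* z) refl p x a v y z) ⟩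
                      x * (a * (p * v * y)) * z * q ∎

    -- From a twisted zero to a solution.

    module ForwardDirection where

      open Lines
      open Polynomials using (pow≈^; nthRoot)
      open Rational
      open RationalSlope
      open Forward
      open Membership

      module _ (k : ℤ) (d : ℕ) where

        K : ℤ
        K = + suc d ℤ.+ k

        record Term (l : Carrier) : Set (c ⊔ ℓ) where
          constructor term
          field
            root : Root l
            μ ξ  : Carrier
            m    : ℕ
            μ^   : μ ^ suc d ≈ l
            ξ^   : ξ ^ suc m ≈ 1#

          l≉0 : ¬ l ≈ 0#
          l≉0 = unit-≉0 (κ-inverse root)

          μ≉0 : ¬ μ ≈ 0#
          μ≉0 e = l≉0 (trans (sym μ^) (trans (*-congʳ e) (zeroˡ _)))

          μ′^ : inv μ ^ suc d ≈ κ l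
          μ′^ = *-cancelˡ-≈ l≉0 (begin
            l * inv μ ^ suc d              ≈⟨ *-congʳ (sym μ^) ⟩
            μ ^ suc d * inv μ ^ suc d      ≈⟨ sym (^-distrib-* μ (inv μ) (suc d)) ⟩
            (μ * inv μ) ^ suc d            ≈⟨ trans (^-congˡ (suc d) (inverseʳ μ μ≉0)) (1^n≈1 (suc d)) ⟩
            1#                             ≈⟨ sym (κ-inverse root) ⟩
            l * κ l                        ∎)

          -- The factor `l` comes from α = λ/P′(λ), which is why y^ℓ involves the exponent K = k + ℓ
          -- and not k.
          y : Carrier
          y = ξ * (l * zp μ (inv μ) k)

          y^ : y ^ suc d ≈ ξ ^ suc d * l ^^ K
          y^ = begin
            (ξ * (l * zp μ (inv μ) k)) ^ suc d
              ≈⟨ trans (^-distrib-* ξ _ (suc d)) (*-congˡ (^-distrib-* l _ (suc d))) ⟩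
            ξ ^ suc d * (l ^ suc d * zp μ (inv μ) k ^ suc d)
              ≈⟨ *-congˡ (*-congˡ (trans (sym (zp-^ μ (inv μ) (suc d) k)) (zp-cong μ^ μ′^ k))) ⟩
            ξ ^ suc d * (l ^^ (+ suc d) * l ^^ k)
              ≈⟨ *-congˡ (sym (zp-+ (κ-inverse root) (+ suc d) k)) ⟩
            ξ ^ suc d * l ^^ K ∎

          y^* : ∀ M → ξ ^ M ≈ 1# → y ^ (suc d ℕ.* M) ≈ l ^^ (K ℤ.* + M)
          y^* M ξᴹ≈1 = begin
            y ^ (suc d ℕ.* M)                  ≈⟨ sym (^-assocʳ y (suc d) M) ⟩
            (y ^ suc d) ^ M                    ≈⟨ trans (^-congˡ M y^) (^-distrib-* (ξ ^ suc d) (l ^^ K) M) ⟩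
            (ξ ^ suc d) ^ M * (l ^^ K) ^ M     ≈⟨ *-cong (trans (^-comm-exp ξ (suc d) M) (trans (^-congˡ (suc d) ξᴹ≈1) (1^n≈1 (suc d))))
                                                    (sym (zp-*ℕ (κ-inverse root) K M)) ⟩
            1# * l ^^ (K ℤ.* + M)              ≈⟨ *-identityˡ _ ⟩
            l ^^ (K ℤ.* + M)                   ∎

          order∣ : ∀ {M} q → M ≡ suc m ℕ.* q → ξ ^ M ≈ 1#
          order∣ q e = trans (^-congʳ ξ e) (trans (sym (^-assocʳ ξ (suc m) q)) (trans (^-congˡ q ξ^) (1^n≈1 q)))

        module _ {l₁ l₂ l₃ : Carrier} (roots : Roots l₁ l₂ l₃) (X₁ : Term l₁) (X₂ : Term l₂) (X₃ : Term l₃) where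
          open Roots roots
          open Term X₁ using () renaming (y to y₁; m to m₁; y^* to y₁^*; order∣ to order₁)
          open Term X₂ using () renaming (y to y₂; m to m₂; y^* to y₂^*; order∣ to order₂)
          open Term X₃ using () renaming (y to y₃; m to m₃; y^* to y₃^*; order∣ to order₃)

          private
            M′ M : ℕ
            -- Arranged so that `suc M′` reduces to `suc m₁ * (suc m₂ * suc m₃)`, an exponent that
            -- kills all three roots of unity.
            M′ = m₃ ℕ.+ m₂ ℕ.* suc m₃ ℕ.+ m₁ ℕ.* (suc m₂ ℕ.* suc m₃)
            M = suc M′

            ^^-≉0 : ∀ {l} → Root l → ∀ k → ¬ l ^^ k ≈ 0#
            ^^-≉0 r k = unit-≉0 (zp-inverse (κ-inverse r) k)

            x-y≉0 : ∀ {x y} → ¬ x ≈ y → ¬ x - y ≈ 0#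
            x-y≉0 x≉y e = x≉y (x-y≈0⇒x≈y e)

            pow₁ : y₁ ^ (suc d ℕ.* M) ≈ l₁ ^^ (K ℤ.* + M)
            pow₁ = y₁^* M (order₁ (suc m₂ ℕ.* suc m₃) ≡.refl)
            pow₂ : y₂ ^ (suc d ℕ.* M) ≈ l₂ ^^ (K ℤ.* + M)
            pow₂ = y₂^* M (order₂ (suc m₁ ℕ.* suc m₃) (swap (suc m₁) (suc m₂) (suc m₃)))
              where
              swap : ∀ a b c → a ℕ.* (b ℕ.* c) ≡ b ℕ.* (a ℕ.* c)
              swap a b c = ≡.trans (≡.sym (ℕP.*-assoc a b c)) (≡.trans (≡.cong (ℕ._* c) (ℕP.*-comm a b)) (ℕP.*-assoc b a c))
            pow₃ : y₃ ^ (suc d ℕ.* M) ≈ l₃ ^^ (K ℤ.* + M)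
            pow₃ = y₃^* M (order₃ (suc m₁ ℕ.* suc m₂) (≡.trans (≡.sym (ℕP.*-assoc (suc m₁) (suc m₂) (suc m₃))) (ℕP.*-comm (suc m₁ ℕ.* suc m₂) (suc m₃))))

            y≉0 : ∀ {l y} → Root l → y ^ (suc d ℕ.* M) ≈ l ^^ (K ℤ.* + M) → ¬ y ≈ 0#
            y≉0 r p e = ^^-≉0 r (K ℤ.* + M) (trans (sym p) (trans (*-congʳ e) (zeroˡ _)))

          module _ (sum≈0 : y₁ * inv (P′ R l₁) + y₂ * inv (P′ R l₂) + y₃ * inv (P′ R l₃) ≈ 0#) where

            collinear : y₁ * (l₂ - l₃) + y₂ * (l₃ - l₁) + y₃ * (l₁ - l₂) ≈ 0#
            collinear = trans (sym (weighted-sum roots y₁ y₂ y₃)) (trans (*-congˡ sum≈0) (zeroʳ _))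

            B A : Carrier
            B = (y₂ - y₃) * inv (l₂ - l₃)
            A = y₁ - B * l₁

            private
              B₂₃ : B * (l₂ - l₃) ≈ y₂ - y₃
              B₂₃ = trans (solve 3 (λ y i t → y :* i :* t := (t :* i) :* y) refl (y₂ - y₃) (inv (l₂ - l₃)) (l₂ - l₃))
                (trans (*-congʳ (inverseʳ _ (x-y≉0 l₂≉l₃))) (*-identityˡ _))

              B₁₃ : y₁ - y₃ ≈ B * (l₁ - l₃)
              B₁₃ = *-cancelˡ-≈ (x-y≉0 l₂≉l₃) (lc₂ 1# (l₃ - l₁) collinear B₂₃
                (trans (stepᴮ B l₁ l₂ l₃ y₁ y₃) expand))
                where
                stepᴮ : ∀ B a b c y z → (b - c) * (y - z) - (b - c) * (B * (a - c)) ≈ (b - c) * (y - z) - (a - c) * (B * (b - c))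
                stepᴮ B a b c y z = +-congˡ (-‿cong (solve 4 (λ B a b c → (b :- c) :* (B :* (a :- c)) := (a :- c) :* (B :* (b :- c))) refl B a b c))
                expand : (l₂ - l₃) * (y₁ - y₃) - (l₁ - l₃) * (B * (l₂ - l₃)) ≈
                  1# * (y₁ * (l₂ - l₃) + y₂ * (l₃ - l₁) + y₃ * (l₁ - l₂) - 0#) + (l₃ - l₁) * (B * (l₂ - l₃) - (y₂ - y₃))
                expand = begin
                  (l₂ - l₃) * (y₁ - y₃) - (l₁ - l₃) * (B * (l₂ - l₃))
                    ≈⟨ solve 6 (λ a b c x z E → (b :- c) :* (x :- z) :- (a :- c) :* E := (b :- c) :* (x :- z) :+ (c :- a) :* E) refl l₁ l₂ l₃ y₁ y₃ (B * (l₂ - l₃)) ⟩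
                  (l₂ - l₃) * (y₁ - y₃) + (l₃ - l₁) * (B * (l₂ - l₃))
                    ≈⟨ +-congʳ (solve 6 (λ a b c x y z → (b :- c) :* (x :- z) :=
                         con (+ 1) :* (x :* (b :- c) :+ y :* (c :- a) :+ z :* (a :- b) :- con (+ 0)) :+ (c :- a) :* (:- (y :- z))) refl l₁ l₂ l₃ y₁ y₂ y₃) ⟩
                  1# * (y₁ * (l₂ - l₃) + y₂ * (l₃ - l₁) + y₃ * (l₁ - l₂) - 0#) + (l₃ - l₁) * - (y₂ - y₃) + (l₃ - l₁) * (B * (l₂ - l₃))
                    ≈⟨ solve 4 (λ s w E y → s :+ w :* (:- y) :+ w :* E := s :+ w :* (E :- y)) refl _ (l₃ - l₁) (B * (l₂ - l₃)) (y₂ - y₃) ⟩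
                  1# * (y₁ * (l₂ - l₃) + y₂ * (l₃ - l₁) + y₃ * (l₁ - l₂) - 0#) + (l₃ - l₁) * (B * (l₂ - l₃) - (y₂ - y₃)) ∎

            Y : Line l₁ l₂ l₃
            Y = record
              { A = A ; B = B ; y₁ = y₁ ; y₂ = y₂ ; y₃ = y₃ ; y₁′ = inv y₁ ; y₂′ = inv y₂ ; y₃′ = inv y₃
              -- `suc n` is `suc d * M` by computation.
              ; n = M′ ℕ.+ d ℕ.* M ; M = K ℤ.* + M
              ; inverse₁ = inverseʳ y₁ (y≉0 root₁ pow₁) ; inverse₂ = inverseʳ y₂ (y≉0 root₂ pow₂) ; inverse₃ = inverseʳ y₃ (y≉0 root₃ pow₃)
              ; power₁ = pow₁ ; power₂ = pow₂ ; power₃ = pow₃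
              ; line₁ = solve 2 (λ y b → y := y :- b :+ b) refl y₁ (B * l₁)
              ; line₂ = lc₂ (- 1#) 1# B₂₃ (sym B₁₃) (trans (solve 5 (λ B a b x y → y :- (x :- B :* a :+ B :* b) :=
                  y :- x :+ B :* (a :- b)) refl B l₁ l₂ y₁ y₂) merge)
              ; line₃ = lc₁ 1# (sym B₁₃) (solve 5 (λ B a c x z → z :- (x :- B :* a :+ B :* c) :=
                  con (+ 1) :* (B :* (a :- c) :- (x :- z))) refl B l₁ l₃ y₁ y₃) }
              where
              merge : y₂ - y₁ + B * (l₁ - l₂) ≈ - 1# * (B * (l₂ - l₃) - (y₂ - y₃)) + 1# * (B * (l₁ - l₃) - (y₁ - y₃))
              merge = begin
                y₂ - y₁ + B * (l₁ - l₂)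
                  ≈⟨ +-congˡ (solve 4 (λ B a b c → B :* (a :- b) := B :* (a :- c) :- B :* (b :- c)) refl B l₁ l₂ l₃) ⟩
                y₂ - y₁ + (B * (l₁ - l₃) - B * (l₂ - l₃))
                  ≈⟨ solve 5 (λ x y z E F → y :- x :+ (E :- F) := (:- con (+ 1)) :* (F :- (y :- z)) :+ con (+ 1) :* (E :- (x :- z)))
                       refl y₁ y₂ y₃ (B * (l₁ - l₃)) (B * (l₂ - l₃)) ⟩
                - 1# * (B * (l₂ - l₃) - (y₂ - y₃)) + 1# * (B * (l₁ - l₃) - (y₁ - y₃)) ∎

            private
              simplify : ∀ x k → x ^ suc d * (1# * k) ≈ x ^ suc d * k
              simplify x k = *-congˡ (*-identityˡ k)

              powers : ∀ {x y a b} → Root a → Root b → x ^ (suc d ℕ.* M) ≈ a ^^ (K ℤ.* + M) → y ^ (suc d ℕ.* M) ≈ b ^^ (K ℤ.* + M) →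
                (x ^ suc d * (1# * b ^^ K)) ^ M ≈ (y ^ suc d * (1# * a ^^ K)) ^ M
              powers {x} {y} {a} {b} ra rb p q = trans (side rb p) (trans (*-comm _ _) (sym (side ra q)))
                where
                side : ∀ {x a b} → Root b → x ^ (suc d ℕ.* M) ≈ a ^^ (K ℤ.* + M) →
                       (x ^ suc d * (1# * b ^^ K)) ^ M ≈ a ^^ (K ℤ.* + M) * b ^^ (K ℤ.* + M)
                side {x} {a} {b} rb p = trans (^-congˡ M (simplify x (b ^^ K))) (trans (^-distrib-* (x ^ suc d) (b ^^ K) M)
                  (*-cong (trans (^-assocʳ x (suc d) M) p) (sym (zp-*ℕ (κ-inverse rb) K M))))

            -- No roots of unity remain in the ℓ-th powers of the yᵢ.
            exact : ∃ λ u → y₁ ^ suc d ≈ u * (1# * l₁ ^^ K) × y₂ ^ suc d ≈ u * (1# * l₂ ^^ K) × y₃ ^ suc d ≈ u * (1# * l₃ ^^ K)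
            exact = fromRatios roots (λ e → ^^-≉0 root₃ K (trans (sym (*-identityˡ _)) e))
              (At.rigidity roots Y (unitLine roots) (suc d) K M (λ ()) (powers root₂ root₃ pow₂ pow₃))
              (At.rigidity (rotate roots) (rotateLine Y) (rotateLine (unitLine roots)) (suc d) K M (λ ()) (powers root₃ root₁ pow₃ pow₁))

            -- B = 0 gives y₂ = y₃ and hence l₂ᴷ = l₃ᴷ. For K ≠ 0 the quotient l₂/l₃ would then be a
            -- root of unity congruent to 1 modulo t, that is, l₂ = l₃.
            vertical⇒K≡0 : B ≈ 0# → ¬ ¬ K ≡ + 0
            vertical⇒K≡0 B≈0 K≢0 = l₂≉l₃ (trans (sym (one l₂)) (trans
              (At.rigidity roots (rootLine roots) (unitLine roots) 1 (+ 0) ℤ.∣ K ∣ (λ e → K≢0 (ℤP.∣i∣≡0⇒i≡0 e))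
                (trans (^-congˡ ℤ.∣ K ∣ (one l₂)) (trans (absolute K l₂^K≈l₃^K) (sym (^-congˡ ℤ.∣ K ∣ (one l₃))))))
              (one l₃)))
              where
              one : ∀ x → x ^ 1 * (1# * 1#) ≈ x
              one x = solve 1 (λ x → x :* con (+ 1) :* (con (+ 1) :* con (+ 1)) := x) refl x
              y₂≈y₃ : y₂ ≈ y₃
              y₂≈y₃ = x-y≈0⇒x≈y (trans (sym B₂₃) (trans (*-congʳ B≈0) (zeroˡ _)))
              l₂^K≈l₃^K : l₂ ^^ K ≈ l₃ ^^ K
              l₂^K≈l₃^K =
                let (u , _ , q₂ , q₃) = exact
                in trans (sym (*-identityˡ _)) (trans (*-cancelˡ-≈ (λ u≈0 → ^-≉0 (suc d) (y≉0 root₂ pow₂) (trans q₂ (trans (*-congʳ u≈0) (zeroˡ _))))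
                     (trans (sym q₂) (trans (^-congˡ (suc d) y₂≈y₃) q₃))) (*-identityˡ _))
              absolute : ∀ K → l₂ ^^ K ≈ l₃ ^^ K → l₂ ^ ℤ.∣ K ∣ ≈ l₃ ^ ℤ.∣ K ∣
              absolute (+ n)    e = e
              absolute -[1+ n ] e = *-cancelˡ-≈ (^^-≉0 root₂ -[1+ n ]) (begin
                κ l₂ ^ suc n * l₂ ^ suc n   ≈⟨ flip root₂ ⟩
                1#                          ≈⟨ sym (flip root₃) ⟩
                κ l₃ ^ suc n * l₃ ^ suc n   ≈⟨ *-congʳ (sym e) ⟩
                κ l₂ ^ suc n * l₃ ^ suc n   ∎)
                where
                flip : ∀ {l} → Root l → κ l ^ suc n * l ^ suc n ≈ 1#
                flip r = zp-inverse (κ-inverse r) -[1+ n ]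

            solution : ¬ B ≈ 0# → ∃ (Solutions.Sol roots d K)
            solution B≉0 = A * B′ , Solutions.sol (B′ ^ suc d * proj₁ exact) (at line₁ (proj₁ (proj₂ exact)))
                (at line₂ (proj₁ (proj₂ (proj₂ exact)))) (at line₃ (proj₂ (proj₂ (proj₂ exact))))
              where
              open Line Y using (line₁; line₂; line₃)
              B′ = inv B
              at : ∀ {l y} → y ≈ A + B * l → y ^ suc d ≈ proj₁ exact * (1# * l ^^ K) → (A * B′ + l) ^ suc d ≈ B′ ^ suc d * proj₁ exact * l ^^ K
              at {l} {y} p q = begin
                (A * B′ + l) ^ suc d
                  ≈⟨ ^-congˡ (suc d) (trans (+-congˡ (sym (trans (*-congʳ (inverseʳ B B≉0)) (*-identityˡ l))))
                       (solve 4 (λ A B i l → A :* i :+ B :* i :* l := i :* (A :+ B :* l)) refl A B B′ l)) ⟩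
                (B′ * (A + B * l)) ^ suc d
                  ≈⟨ trans (^-congˡ (suc d) (*-congˡ (sym p))) (^-distrib-* B′ y (suc d)) ⟩
                B′ ^ suc d * y ^ suc d
                  ≈⟨ trans (*-congˡ (trans q (*-congˡ (*-identityˡ _)))) (sym (*-assoc _ _ _)) ⟩
                B′ ^ suc d * proj₁ exact * l ^^ K ∎

        coprime-K : Coprime ℤ.∣ k ∣ (suc d) → Coprime ℤ.∣ K ∣ (suc d)
        coprime-K cop {i} (i∣K , i∣d) = cop (ℕD.∣-trans (ℤSdiv i∣K i∣d) ℕD.∣-refl , i∣d)
          where
          ℤSdiv : i ℕD.∣ ℤ.∣ K ∣ → i ℕD.∣ suc d → i ℕD.∣ ℤ.∣ k ∣
          ℤSdiv p q = ≡.subst (λ z → i ℕD.∣ ℤ.∣ z ∣) (cancel (+ suc d) k)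
            (ℤS.∣⇒∣ᵤ (ℤS.∣m∣n⇒∣m-n {+ i} {K} {+ suc d} (ℤS.∣ᵤ⇒∣ p) (ℤS.∣ᵤ⇒∣ q)))
            where
            cancel : ∀ a b → (a ℤ.+ b) ℤ.- a ≡ b
            cancel a b = ℤR.solve 2 (λ a b → (a ℤR.:+ b) ℤR.:- a ℤR.:= b) ≡.refl a b

      -- K divisible by 3 contradicts lowest terms, and K = 1 modulo 3 is the family K = 4 + 3j. If
      -- K = 2 modulo 3, then 2K has the form 4 + 3j, so σ² takes the place of σ, and parity
      -- excludes the case.
      cubic-case : ∀ {l₁ l₂ l₃} (roots : Roots l₁ l₂ l₃) k .(cop : Coprime ℤ.∣ k ∣ 3) {s} →
                   Solutions.Sol roots 2 (K k 2) s → mkℚ k 2 cop ∈ twistedZeros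
      cubic-case roots k cop S = residue (K k 2 ℤ.%ℕ 3) (K k 2 ℤ./ℕ 3) (ℤD.n%ℕd<d (K k 2) 3) (ℤD.a≡a%ℕn+[a/ℕn]*n (K k 2) 3)
        where
        residue : ∀ r q → r ℕ.< 3 → K k 2 ≡ + r ℤ.+ q ℤ.* + 3 → mkℚ k 2 cop ∈ twistedZeros
        residue 0 q _ e = ⊥-elim (three (coprime-K k 2 (Cop.recompute cop) {3}
          (ℕD.divides ℤ.∣ q ∣ (≡.trans (≡.cong ℤ.∣_∣ (≡.trans e (ℤP.+-identityˡ (q ℤ.* + 3)))) (ℤP.abs-* q (+ 3))) , ℕD.∣-refl)))
          where
          three : 3 ≡ 1 → ⊥
          three ()
        residue 1 q _ e = from-3 cop (q ℤ.- + 1) e′ (Cubic.V-case roots S (q ℤ.- + 1) e′)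
          where
          e′ : K k 2 ≡ + 4 ℤ.+ (q ℤ.- + 1) ℤ.* + 3
          e′ = ≡.trans e (ℤR.solve 1 (λ q → ℤR.con (+ 1) ℤR.:+ q ℤR.:* ℤR.con (+ 3) ℤR.:= ℤR.con (+ 4) ℤR.:+ (q ℤR.:- ℤR.con (+ 1)) ℤR.:* ℤR.con (+ 3)) ≡.refl q)
        residue 2 q _ e = ⊥-elim (Cubic.odd-case roots S (+ 2 ℤ.* q) (≡.trans (≡.cong (ℤ._* + 2) e)
          (ℤR.solve 1 (λ q → (ℤR.con (+ 2) ℤR.:+ q ℤR.:* ℤR.con (+ 3)) ℤR.:* ℤR.con (+ 2) ℤR.:= ℤR.con (+ 4) ℤR.:+ (ℤR.con (+ 2) ℤR.:* q) ℤR.:* ℤR.con (+ 3)) ≡.refl q)))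
        residue (suc (suc (suc r))) q (s≤s (s≤s (s≤s ()))) e

      solution⇒ : ∀ {l₁ l₂ l₃} (roots : Roots l₁ l₂ l₃) k d .(cop : Coprime ℤ.∣ k ∣ (suc d)) {s} →
                  Solutions.Sol roots d (K k d) s → suc d ≡ 1 ⊎ suc d ≡ 3 → mkℚ k d cop ∈ twistedZeros
      solution⇒ roots k 0 cop S (inj₁ ≡.refl) = from-1 cop (T-case roots S)
      solution⇒ roots k 2 cop S (inj₂ ≡.refl) = cubic-case roots k cop S

      -- The conclusion is doubly negated because rationality of s and the equation K = 0 of the
      -- degenerate line are only available in that form.
      forward : ∀ {l₁ l₂ l₃} → AreTribRoots R l₁ l₂ l₃ → ∀ a → IsTwistedRationalZero R inv l₁ l₂ l₃ a → ¬ ¬ (a ∈ twistedZeros)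
      forward {l₁} {l₂} {l₃} trib a@(mkℚ k d cop) (μ₁ , μ₂ , μ₃ , ξ₁ , ξ₂ , ξ₃ , p₁ , p₂ , p₃ , (m₁ , u₁) , (m₂ , u₂) , (m₃ , u₃) , sum) a∉ =
        Solutions.rational roots d (K k d) S (λ rat → a∉ (solution⇒ roots k d cop S
          (exponent roots d (K k d) S rat (coprime-K k d (Cop.recompute cop)))))
        where
        roots = toRoots trib
        open Roots roots
        X₁ : Term k d l₁
        X₁ = term root₁ μ₁ ξ₁ m₁ (trans (sym (pow≈^ μ₁ (suc d))) p₁) (trans (sym (pow≈^ ξ₁ (suc m₁))) u₁)
        X₂ : Term k d l₂
        X₂ = term root₂ μ₂ ξ₂ m₂ (trans (sym (pow≈^ μ₂ (suc d))) p₂) (trans (sym (pow≈^ ξ₂ (suc m₂))) u₂)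
        X₃ : Term k d l₃
        X₃ = term root₃ μ₃ ξ₃ m₃ (trans (sym (pow≈^ μ₃ (suc d))) p₃) (trans (sym (pow≈^ ξ₃ (suc m₃))) u₃)
        sum′ : Term.y X₁ * inv (P′ R l₁) + Term.y X₂ * inv (P′ R l₂) + Term.y X₃ * inv (P′ R l₃) ≈ 0#
        sum′ = trans (+-cong (+-cong (shape ξ₁ l₁ μ₁) (shape ξ₂ l₂ μ₂)) (shape ξ₃ l₃ μ₃)) sum
          where
          shape : ∀ ξ l μ → ξ * (l * zp μ (inv μ) k) * inv (P′ R l) ≈ ξ * coeffα R inv l * zpow R inv μ k
          shape ξ l μ = trans (solve 4 (λ ξ l z i → ξ :* (l :* z) :* i := ξ :* (l :* i) :* z) refl ξ l (zp μ (inv μ) k) (inv (P′ R l)))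
            (*-congˡ (sym (zpow≈zp μ k)))
        B≉0 : ¬ B k d roots X₁ X₂ X₃ sum′ ≈ 0#
        B≉0 B≈0 = vertical⇒K≡0 k d roots X₁ X₂ X₃ sum′ B≈0 (λ K≡0 → a∉ (from-0 cop K≡0))
        S = proj₂ (solution k d roots X₁ X₂ X₃ sum′ B≉0)

-- Passage to stable equality, and the theorem.

-- The same ring with the double negation of its equality, in which
-- equations may be proved by contradiction.
module DoubleNegation {c ℓ : Level} (R : CommutativeRing c ℓ) where
  open CommutativeRing R

  _≈¬¬_ : Carrier → Carrier → Set ℓ
  x ≈¬¬ y = ¬ ¬ x ≈ y

  private
    pure : ∀ {x y} → x ≈ y → x ≈¬¬ y
    pure e k = k e

    lift : ∀ {x y z w} → (x ≈ y → z ≈ w) → x ≈¬¬ y → z ≈¬¬ w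
    lift f m k = m λ e → k (f e)

    lift₂ : ∀ {x y z w a b} → (x ≈ y → z ≈ w → a ≈ b) → x ≈¬¬ y → z ≈¬¬ w → a ≈¬¬ b
    lift₂ f m n k = m λ e → n λ e′ → k (f e e′)

  R¬¬ : CommutativeRing c ℓ
  R¬¬ = record
    { Carrier = Carrier ; _≈_ = _≈¬¬_ ; _+_ = _+_ ; _*_ = _*_ ; -_ = -_ ; 0# = 0# ; 1# = 1#
    ; isCommutativeRing = record
      { isRing = record
        { +-isAbelianGroup = record
          { isGroup = record
            { isMonoid = record
              { isSemigroup = record
                { isMagma = record
                  { isEquivalence = record { refl = pure refl ; sym = lift sym ; trans = lift₂ trans }
                  ; ∙-cong = lift₂ +-cong }
                ; assoc = λ x y z → pure (+-assoc x y z) }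
              ; identity = (λ x → pure (+-identityˡ x)) , (λ x → pure (+-identityʳ x)) }
            ; inverse = (λ x → pure (-‿inverseˡ x)) , (λ x → pure (-‿inverseʳ x))
            ; ⁻¹-cong = lift -‿cong }
          ; comm = λ x y → pure (+-comm x y) }
        ; *-cong = lift₂ *-cong
        ; *-assoc = λ x y z → pure (*-assoc x y z)
        ; *-identity = (λ x → pure (*-identityˡ x)) , (λ x → pure (*-identityʳ x))
        ; distrib = (λ x y z → pure (distribˡ x y z)) , (λ x y z → pure (distribʳ x y z)) }
      ; *-comm = λ x y → pure (*-comm x y) } }

  stable : ∀ {x y} → ¬ ¬ (x ≈¬¬ y) → x ≈¬¬ y
  stable m k = m λ n → n k

  pow≡ : ∀ x n → pow R¬¬ x n ≡ pow R x n
  pow≡ x zero    = ≡.refl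
  pow≡ x (suc n) = ≡.cong (x *_) (pow≡ x n)

  zpow≡ : ∀ inv x k → zpow R¬¬ inv x k ≡ zpow R inv x k
  zpow≡ inv x (+ n)    = pow≡ x n
  zpow≡ inv x -[1+ n ] = pow≡ (inv x) (suc n)

  private
    natCast≡ : ∀ n → natCast R¬¬ n ≡ natCast R n
    natCast≡ zero    = ≡.refl
    natCast≡ (suc n) = ≡.cong (λ z → 1# + z) (natCast≡ n)

    evalPoly≡ : ∀ {n} (cs : Vec Carrier n) x → evalPoly R¬¬ cs x ≡ evalPoly R cs x
    evalPoly≡ []       x = ≡.refl
    evalPoly≡ (c ∷ cs) x = ≡.cong (λ z → c + x * z) (evalPoly≡ cs x)

    pure≡ : ∀ {x x′ y} → x ≡ x′ → x′ ≈ y → x ≈¬¬ y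
    pure≡ ≡.refl = pure

  -- The axioms survive because a negated equation means the same for both equalities: this covers
  -- the conclusions of `0≉1` and `char0` as well as the hypothesis of `inverseʳ`. The other
  -- conclusions are only weakened.
  isACF0 : ∀ {inv} → IsACF0 R inv → IsACF0 R¬¬ inv
  isACF0 A = record
    { 0≉1 = λ m → m 0≉1
    ; inv-cong = lift inv-cong
    ; inverseʳ = λ x x≉0 → pure (inverseʳ x λ e → x≉0 (pure e))
    ; char0 = λ n m → m λ e → char0 n (trans (reflexive (≡.sym (natCast≡ (suc n)))) e)
    ; algClosed = λ n cs → let (x , e) = algClosed n cs in
        x , pure≡ (≡.cong₂ _+_ (pow≡ x (suc n)) (evalPoly≡ cs x)) e }
    where open IsACF0 A

  areTribRoots : ∀ {l₁ l₂ l₃} → AreTribRoots R l₁ l₂ l₃ → AreTribRoots R¬¬ l₁ l₂ l₃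
  areTribRoots (p₁ , p₂ , p₃ , n₁₂ , n₁₃ , n₂₃) =
    pure p₁ , pure p₂ , pure p₃ , (λ m → m n₁₂) , (λ m → m n₁₃) , (λ m → m n₂₃)

  isTwistedRationalZero : ∀ {inv l₁ l₂ l₃ a} → IsTwistedRationalZero R inv l₁ l₂ l₃ a →
                          IsTwistedRationalZero R¬¬ inv l₁ l₂ l₃ a
  isTwistedRationalZero {inv} {l₁} {l₂} {l₃} {a}
    (μ₁ , μ₂ , μ₃ , ξ₁ , ξ₂ , ξ₃ , p₁ , p₂ , p₃ , (m₁ , u₁) , (m₂ , u₂) , (m₃ , u₃) , sum) =
    μ₁ , μ₂ , μ₃ , ξ₁ , ξ₂ , ξ₃ , power μ₁ (↧ₙ a) p₁ , power μ₂ (↧ₙ a) p₂ , power μ₃ (↧ₙ a) p₃ ,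
    (m₁ , power ξ₁ (suc m₁) u₁) , (m₂ , power ξ₂ (suc m₂) u₂) , (m₃ , power ξ₃ (suc m₃) u₃) ,
    pure≡ (≡.cong₂ _+_ (≡.cong₂ _+_ (term ξ₁ l₁ μ₁) (term ξ₂ l₂ μ₂)) (term ξ₃ l₃ μ₃)) sum
    where
    power : ∀ x n {y} → pow R x n ≈ y → pow R¬¬ x n ≈¬¬ y
    power x n = pure≡ (pow≡ x n)
    term : ∀ ξ l μ → ξ * coeffα R¬¬ inv l * zpow R¬¬ inv μ (↥ a) ≡ ξ * coeffα R inv l * zpow R inv μ (↥ a)
    term ξ l μ = ≡.cong (λ z → ξ * coeffα R inv l * z) (zpow≡ inv μ (↥ a))

theorem1p10 : ∀ {c ℓ : Level} (R : CommutativeRing c ℓ)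
    (inv : CommutativeRing.Carrier R → CommutativeRing.Carrier R) →
    IsACF0 R inv →
    (l₁ l₂ l₃ : CommutativeRing.Carrier R) → AreTribRoots R l₁ l₂ l₃ →
    (a : ℚ) →
    IsTwistedRationalZero R inv l₁ l₂ l₃ a ⇔
    (a ∈ ((+ 0) / 1 ∷ -[1+ 0 ] / 1 ∷ -[1+ 3 ] / 1 ∷ -[1+ 16 ] / 1
    ∷ (+ 1) / 3 ∷ -[1+ 4 ] / 3 ∷ []))
theorem1p10 R inv acf l₁ l₂ l₃ trib a = mk⇔
  -- Membership in a list of rationals is decidable, which removes the double negation.
  (λ z → decidable-stable (a ∈? twistedZeros)
    (OverField.WithStability.ForwardDirection.forward R¬¬ inv (isACF0 acf) stable (areTribRoots trib) a (isTwistedRationalZero {a = a} z)))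
  -- This direction asserts equations in R itself, so it is carried out over R; its constructions
  -- are explicit and do not require stable equality.
  (OverField.Backward.backward R inv acf (OverField.TribonacciField.toRoots R inv acf trib))
  where
  open DoubleNegation R
  open Data.List.Membership.DecPropositional ℚ._≟_ using (_∈?_)
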